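{- Let $\mathcal B$ be a set of subsets of $V$ that has the good closure property. Let $I=(X_i\geq\varphi_i)_{1\leq i\leq n}$ be a system of inequalities over $\Omega=(\Omega_v,\Omega_p)$ with $\Omega_v=\{X_1,\dots,X_n\}$, and let $\mathbf P\in(2^V)^{\Omega_p}$ be an assignment such that $\mathbf P(P)\in\mathcal B$ for every $P\in\Omega_p$. Let $\mathbf X=(\mathbf X_1,\dots,\mathbf X_n)$ be the unique smallest solution of $I$ under $\mathbf P$. Then $\mathbf X_i\in\mathcal B$ for each $1\leq i\leq n$. Moreover, if $\mathcal B$ has the effective good closure property, then there exists an effective algorithm which takes as input the system $I$ and descriptions of the sets $\mathbf P(P)$, $P\in\Omega_p$, and produces as output descriptions of the sets $\mathbf X_i$, $1\leq i\leq n$.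
   Context: $V$ is a finite-dimensional real vector space, $2^V$ its set of subsets, $\mathcal C(V)$ its set of convex subsets (including $\emptyset$), $\operatorname{conv}$ the convex hull. For $A,B\subset V$ and $\rho\in\mathbb R$: $\rho\cdot A=\{\rho x: x\in A\}$; $A+B=\{a+b: a\in A,b\in B\}$; $A\,\widehat\oplus\,B=A\cup B$; and the positive geometric join is $A\,\mathring\star\,B=\{\lambda a+(1-\lambda)b: 0<\lambda<1,\ a\in A,\ b\in B\}$ (an associative commutative operation). Syntax. $\Omega_v$ (variables) and $\Omega_p$ (parameters) are disjoint finite sets of symbols, $\Omega=(\Omega_v,\Omega_p)$. $\mathrm{CL}(\Omega)$ is the set of formal convex linear combinations $E=\sum_{\omega\in\Omega_v\cup\Omega_p}\lambda_\omega\cdot\omega$ with $\lambda_\omega\geq0$, $\sum\lambda_\omega=1$. A monomial over $\Omega$ is a formal product $E_1\mathring\star\cdots\mathring\star E_k$, $k\geq1$, of distinct elements of $\mathrm{CL}(\Omega)$, up to permutation of factors (formally $E\mathring\star E=E$). A polynomial over $\Omega$ is a formal sum $M_1\widehat\oplus\cdots\widehat\oplus M_k$, $k\geq0$, of distinct monomials, up to permutation (formally $M\widehat\oplus M=M$); $\mathbb P[\Omega]$ is the set of polynomials. A system of inequalities over $\Omega$ is a tuple $(X_i\geq\varphi_i)_{1\leq i\leq n}$ with $\Omega_v=\{X_1,\dots,X_n\}$ and $\varphi_i\in\mathbb P[\Omega]$. Evaluation. For $\mathbf X\in\mathcal C(V)^{\Omega_v}$ and $\mathbf P\in(2^V)^{\Omega_p}$: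 $\operatorname{eval}(E;\mathbf X,\mathbf P)=\sum_{X\in\Omega_v,\lambda_X>0}\lambda_X\cdot\mathbf X(X)+\sum_{P\in\Omega_p,\lambda_P>0}\lambda_P\cdot\mathbf P(P)$ (Minkowski sums); for a monomial, $\operatorname{eval}$ is the positive geometric join of the evaluations of its distinct factors; for a polynomial, the union of the evaluations of its monomials (the empty polynomial evaluates to $\emptyset$). Solutions. Write $\mathbf X_i=\mathbf X(X_i)$. $\mathbf X\in\mathcal C(V)^{\Omega_v}$ is a solution of $I$ under $\mathbf P$ if $\mathbf X_i\supseteq\operatorname{eval}(\varphi_i;\mathbf X,\mathbf P)$ for all $i$. The smallest solution is the minimum solution under componentwise inclusion, i.e. the componentwise intersection of all solutions (it is always itself a solution). Good closure property. A set $\mathcal B$ of subsets of $V$ containing $\emptyset$ has the good closure property if it is closed under finite unions, nonnegative scalar multiplication, Minkowski sums, positive geometric joins, and convex hulls. It has the effective good closure property if in addition there is an algorithm which, given descriptions of $B_1,\dots,B_m\in\mathcal B$ and reals $b_1,\dots,b_m\geq0$, outputs descriptions of $\bigcup_iB_i$, $\sum_iB_i$, $(b_1\cdot B_1,\dots,b_m\cdot B_m)$, $B_1\mathring\star\cdots\mathring\star B_m$ and $\operatorname{conv}(B_1\cup\cdots\cup B_m)$. "Algorithm" means an algorithm performing arithmetic operations and comparisons on real numbers, with sets described by quantifier-free formulas with atoms $P=0$, $P>0$, $P$ a real polynomial. -}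

module Defs where

open import Level using (0ℓ; _⊔_) renaming (suc to lsuc)
open import Algebra.Bundles using (CommutativeRing)
open import Algebra.Structures using (IsCommutativeRing)
open import Algebra.Module.Structures using (IsLeftModule)
import Algebra.Properties.Semiring.Exp as Exp
open import Data.Fin.Base using (Fin; zero; suc)
open import Data.List.Base as List using (List; []; _∷_)
open import Data.List.NonEmpty.Base as List⁺ using (List⁺)
import Data.List.Relation.Binary.Permutation.Setoid as Permutation
import Data.List.Relation.Unary.Unique.Setoid as UniqueSetoid
open import Data.Nat.Base using (ℕ; zero; suc)
open import Data.Product.Base using (Σ; ∃; _×_; _,_)
open import Data.Sum.Base using (_⊎_)
open import Data.Vec.Base as Vec using (Vec; []; _∷_; lookup)
import Data.Vec.Relation.Unary.All as VecAll
open import Data.Vec.Relation.Binary.Pointwise.Inductive using (Pointwise)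
open import Function.Base using (_∘_)
open import Relation.Binary.Bundles using (Setoid)
import Relation.Binary.Construct.NonStrictToStrict as ToStrict
import Relation.Binary.Construct.On as On
open import Relation.Binary.PropositionalEquality.Core using (_≡_; _≢_)
open import Relation.Binary.PropositionalEquality.Properties using (setoid)
open import Relation.Binary.Structures using (IsTotalOrder)
open import Relation.Nullary.Negation.Core using (¬_)
open import Relation.Unary using (Pred; _∈_; _⊆_; _≐_; ∅; _∪_; ｛_｝; Satisfiable)

------------------------------------------------------------------------
-- The real numbers

-- The real numbers are characterised, up to isomorphism, as a
-- Dedekind-complete ordered field.

record RealNumbers : Set₁ where
  infixl 7 _*_
  infixl 6 _+_
  infix  8 -_
  infix  4 _≤_ _<_
  field
    Carrier           : Set
    _+_ _*_           : Carrier → Carrier → Carrier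
    -_                : Carrier → Carrier
    0# 1#             : Carrier
    isCommutativeRing : IsCommutativeRing _≡_ _+_ _*_ -_ 0# 1#
    0≢1               : 0# ≢ 1#
    inverse           : ∀ x → x ≢ 0# → ∃ λ y → x * y ≡ 1#
    _≤_               : Carrier → Carrier → Set
    isTotalOrder      : IsTotalOrder _≡_ _≤_
    +-monoˡ-≤         : ∀ z {x y} → x ≤ y → x + z ≤ y + z
    *-nonneg          : ∀ {x y} → 0# ≤ x → 0# ≤ y → 0# ≤ x * y

  UpperBound : Pred Carrier 0ℓ → Pred Carrier 0ℓ
  UpperBound S u = ∀ x → x ∈ S → x ≤ u

  field
    complete : ∀ (S : Pred Carrier 0ℓ) → Satisfiable S → Satisfiable (UpperBound S) →
               ∃ λ s → s ∈ UpperBound S × (∀ u → u ∈ UpperBound S → s ≤ u)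

  _<_ : Carrier → Carrier → Set
  _<_ = ToStrict._<_ _≡_ _≤_

  commutativeRing : CommutativeRing 0ℓ 0ℓ
  commutativeRing = record { isCommutativeRing = isCommutativeRing }

  open CommutativeRing commutativeRing public using (ring; semiring; _-_)
  open Exp semiring public using (_^_)

  sum : ∀ {n} → Vec Carrier n → Carrier
  sum = Vec.foldr _ _+_ 0#

------------------------------------------------------------------------
-- Finite-dimensional real vector spaces

-- A basis is part of the data because descriptions of subsets by
-- polynomial formulas refer to coordinates.

record FiniteDimensionalVectorSpace (ℝ : RealNumbers) : Set₁ where
  private module ℝ = RealNumbers ℝ
  infixr 7 _*ₗ_
  infixl 6 _+ᴹ_
  field
    Carrierᴹ     : Set
    _+ᴹ_         : Carrierᴹ → Carrierᴹ → Carrierᴹ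
    0ᴹ           : Carrierᴹ
    -ᴹ_          : Carrierᴹ → Carrierᴹ
    _*ₗ_         : ℝ.Carrier → Carrierᴹ → Carrierᴹ
    isLeftModule : IsLeftModule ℝ.ring _≡_ _+ᴹ_ 0ᴹ -ᴹ_ _*ₗ_
    dim          : ℕ
    basis        : Vec Carrierᴹ dim

  combination : Vec ℝ.Carrier dim → Carrierᴹ
  combination c = Vec.foldr _ _+ᴹ_ 0ᴹ (Vec.zipWith _*ₗ_ c basis)

  field
    coordinates             : Carrierᴹ → Vec ℝ.Carrier dim
    combination-coordinates : ∀ v → combination (coordinates v) ≡ v
    coordinates-combination : ∀ c → coordinates (combination c) ≡ c

------------------------------------------------------------------------
-- Formal expressions over n variables and k parameters

module Syntax (ℝ : RealNumbers) where
  open RealNumbers ℝ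

  record ConvexCombination (n k : ℕ) : Set where
    field
      varCoeffs   : Vec Carrier n
      parCoeffs   : Vec Carrier k
      varNonneg   : VecAll.All (0# ≤_) varCoeffs
      parNonneg   : VecAll.All (0# ≤_) parCoeffs
      sumsToOne   : sum varCoeffs + sum parCoeffs ≡ 1#

    coeffs : Vec Carrier n × Vec Carrier k
    coeffs = varCoeffs , parCoeffs

  -- Two combinations are equal when their coefficients are; the proofs of
  -- nonnegativity play no role.
  combinationSetoid : ℕ → ℕ → Setoid 0ℓ 0ℓ
  combinationSetoid n k =
    On.setoid (setoid (Vec Carrier n × Vec Carrier k)) (ConvexCombination.coeffs {n} {k})

  record Monomial (n k : ℕ) : Set where
    field
      factors  : List⁺ (ConvexCombination n k)
      distinct : UniqueSetoid.Unique (combinationSetoid n k) (List⁺.toList factors)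

    factorList : List (ConvexCombination n k)
    factorList = List⁺.toList factors

  monomialSetoid : ℕ → ℕ → Setoid 0ℓ 0ℓ
  monomialSetoid n k =
    On.setoid (Permutation.↭-setoid (combinationSetoid n k)) (Monomial.factorList {n} {k})

  record Polynomial (n k : ℕ) : Set where
    field
      monomials : List (Monomial n k)
      distinct  : UniqueSetoid.Unique (monomialSetoid n k) monomials

  -- The i-th entry φᵢ stands for the inequality Xᵢ ≥ φᵢ.
  System : ℕ → ℕ → Set
  System n k = Vec (Polynomial n k) n

------------------------------------------------------------------------
-- Subsets of V, evaluation and solutions

module Geometry (ℝ : RealNumbers) (V : FiniteDimensionalVectorSpace ℝ) where
  open RealNumbers ℝ
  open FiniteDimensionalVectorSpace V
  open Syntax ℝ

  Subset : Set₁
  Subset = Pred Carrierᴹ 0ℓ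

  infixr 7 _·_
  infixr 6 _⊕_ _⋆_

  _·_ : Carrier → Subset → Subset
  (ρ · A) v = ∃ λ x → x ∈ A × v ≡ ρ *ₗ x

  _⊕_ : Subset → Subset → Subset
  (A ⊕ B) v = ∃ λ a → ∃ λ b → a ∈ A × b ∈ B × v ≡ a +ᴹ b

  -- The positive geometric join.
  _⋆_ : Subset → Subset → Subset
  (A ⋆ B) v = ∃ λ t → ∃ λ a → ∃ λ b →
    0# < t × t < 1# × a ∈ A × b ∈ B × v ≡ t *ₗ a +ᴹ (1# - t) *ₗ b

  Convex : Pred Subset 0ℓ
  Convex A = ∀ {x y t} → 0# ≤ t → t ≤ 1# → x ∈ A → y ∈ A → t *ₗ x +ᴹ (1# - t) *ₗ y ∈ A

  -- The least convex set containing A.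
  data conv (A : Subset) : Subset where
    incl : A ⊆ conv A
    mix  : Convex (conv A)

  -- One summand λ · A of the value of a convex combination.  Summands with
  -- λ = 0 are omitted, i.e. replaced by the neutral element {0} of ⊕; this
  -- differs from 0 · A when A is empty.
  summand : Carrier → Subset → Subset
  summand λᵢ A v = (0# < λᵢ × v ∈ λᵢ · A) ⊎ (λᵢ ≡ 0# × v ≡ 0ᴹ)

  ⨁ : ∀ {m} → Vec Carrier m → (Fin m → Subset) → Subset
  ⨁ []        A = ｛ 0ᴹ ｝
  ⨁ (λᵢ ∷ λs) A = summand λᵢ (A zero) ⊕ ⨁ λs (A ∘ suc)

  module _ {n k} (𝐗 : Fin n → Subset) (𝐏 : Fin k → Subset) where

    evalCombination : ConvexCombination n k → Subset
    evalCombination E = ⨁ varCoeffs 𝐗 ⊕ ⨁ parCoeffs 𝐏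
      where open ConvexCombination E

    evalMonomial : Monomial n k → Subset
    evalMonomial M = List⁺.foldr₁ _⋆_ (List⁺.map evalCombination (Monomial.factors M))

    eval : Polynomial n k → Subset
    eval φ = List.foldr _∪_ ∅ (List.map evalMonomial (Polynomial.monomials φ))

  record IsSolution {n k} (I : System n k) (𝐏 : Fin k → Subset) (𝐗 : Fin n → Subset) : Set where
    field
      convex    : ∀ i → Convex (𝐗 i)
      satisfies : ∀ i → eval 𝐗 𝐏 (lookup I i) ⊆ 𝐗 i

  record IsSmallestSolution {n k} (I : System n k) (𝐏 : Fin k → Subset)
                            (𝐗 : Fin n → Subset) : Set₁ where
    field
      isSolution : IsSolution I 𝐏 𝐗
      smallest   : ∀ 𝐘 → IsSolution I 𝐏 𝐘 → ∀ i → 𝐗 i ⊆ 𝐘 i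

  -- Sets are compared by _≐_, so a set of subsets is a predicate that
  -- respects _≐_.
  record SetOfSubsets b : Set (lsuc 0ℓ ⊔ lsuc b) where
    field
      Member : Pred Subset b
      resp   : ∀ {A B} → A ≐ B → Member A → Member B

  infix 4 _∈ᴮ_
  _∈ᴮ_ : ∀ {b} → Subset → SetOfSubsets b → Set b
  A ∈ᴮ 𝓑 = SetOfSubsets.Member 𝓑 A

  record GoodClosureProperty {b} (𝓑 : SetOfSubsets b) : Set (lsuc 0ℓ ⊔ b) where
    field
      empty     : ∅ ∈ᴮ 𝓑
      union     : ∀ {A B} → A ∈ᴮ 𝓑 → B ∈ᴮ 𝓑 → A ∪ B ∈ᴮ 𝓑
      scale     : ∀ {ρ A} → 0# ≤ ρ → A ∈ᴮ 𝓑 → ρ · A ∈ᴮ 𝓑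
      minkowski : ∀ {A B} → A ∈ᴮ 𝓑 → B ∈ᴮ 𝓑 → A ⊕ B ∈ᴮ 𝓑
      join      : ∀ {A B} → A ∈ᴮ 𝓑 → B ∈ᴮ 𝓑 → A ⋆ B ∈ᴮ 𝓑
      hull      : ∀ {A} → A ∈ᴮ 𝓑 → conv A ∈ᴮ 𝓑

------------------------------------------------------------------------
-- Algorithms over the reals

-- A While language on binary trees whose leaves are nil or real numbers.
-- Arithmetic operations and comparisons of reals are single steps.
-- Finitely many constants from K may be built into a program: K empty gives
-- algorithms with only 0 and 1 available, K all of ℝ gives the
-- Blum–Shub–Smale convention.

module Computation (ℝ : RealNumbers) where
  open RealNumbers ℝ

  infixr 5 _∷_
  data Tree : Set where
    nil : Tree
    num : Carrier → Tree
    _∷_ : Tree → Tree → Tree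

  -- nil represents false, every other tree represents true.
  true : Tree
  true = nil ∷ nil

  infixr 9 _⨾_
  data Program (K : Pred Carrier 0ℓ) : Set where
    id                  : Program K
    _⨾_                 : (p q : Program K) → Program K  -- first p, then q
    ⟨_,_⟩               : (p q : Program K) → Program K
    fst snd             : Program K
    nil                 : Program K
    zero one            : Program K
    const               : ∀ c → c ∈ K → Program K
    add mul neg inv     : Program K
    less                : Program K
    isPair isNum        : Program K
    if_then_else_       : (t p q : Program K) → Program K
    while_loop_         : (t p : Program K) → Program K

  -- p ∙ x ⇓ y: program p halts on input x with output y.  A program
  -- applied to an input of the wrong shape has no output.
  infix 4 _∙_⇓_
  data _∙_⇓_ {K} : Program K → Tree → Tree → Set where
    id     : ∀ {x} → id ∙ x ⇓ x
    seq    : ∀ {p q x y z} → p ∙ x ⇓ y → q ∙ y ⇓ z → (p ⨾ q) ∙ x ⇓ z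
    pair   : ∀ {p q x y z} → p ∙ x ⇓ y → q ∙ x ⇓ z → ⟨ p , q ⟩ ∙ x ⇓ (y ∷ z)
    fst    : ∀ {x y} → fst ∙ (x ∷ y) ⇓ x
    snd    : ∀ {x y} → snd ∙ (x ∷ y) ⇓ y
    nil    : ∀ {x} → nil ∙ x ⇓ nil
    zero   : ∀ {x} → zero ∙ x ⇓ num 0#
    one    : ∀ {x} → one ∙ x ⇓ num 1#
    const  : ∀ {c c∈K x} → const c c∈K ∙ x ⇓ num c
    add    : ∀ {a b} → add ∙ (num a ∷ num b) ⇓ num (a + b)
    mul    : ∀ {a b} → mul ∙ (num a ∷ num b) ⇓ num (a * b)
    neg    : ∀ {a} → neg ∙ num a ⇓ num (- a)
    inv    : ∀ {a b} → a * b ≡ 1# → inv ∙ num a ⇓ num b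
    less-t : ∀ {a b} → a < b → less ∙ (num a ∷ num b) ⇓ true
    less-f : ∀ {a b} → ¬ a < b → less ∙ (num a ∷ num b) ⇓ nil
    pair-t : ∀ {x y} → isPair ∙ (x ∷ y) ⇓ true
    pair-n : isPair ∙ nil ⇓ nil
    pair-r : ∀ {a} → isPair ∙ num a ⇓ nil
    num-t  : ∀ {a} → isNum ∙ num a ⇓ true
    num-n  : isNum ∙ nil ⇓ nil
    num-p  : ∀ {x y} → isNum ∙ (x ∷ y) ⇓ nil
    if-t   : ∀ {t p q x c y} → t ∙ x ⇓ c → c ≢ nil → p ∙ x ⇓ y →
             (if t then p else q) ∙ x ⇓ y
    if-f   : ∀ {t p q x y} → t ∙ x ⇓ nil → q ∙ x ⇓ y →
             (if t then p else q) ∙ x ⇓ y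
    stop   : ∀ {t p x} → t ∙ x ⇓ nil → (while t loop p) ∙ x ⇓ x
    step   : ∀ {t p x c y z} → t ∙ x ⇓ c → c ≢ nil → p ∙ x ⇓ y →
             (while t loop p) ∙ y ⇓ z → (while t loop p) ∙ x ⇓ z

------------------------------------------------------------------------
-- Quantifier-free formulas

module Formulas (ℝ : RealNumbers) where
  open RealNumbers ℝ

  -- A real polynomial in d indeterminates: a list of coefficients with
  -- exponents.
  RealPolynomial : ℕ → Set
  RealPolynomial d = List (Carrier × Vec ℕ d)

  power : ∀ {d} → Vec Carrier d → Vec ℕ d → Carrier
  power x e = Vec.foldr _ _*_ 1# (Vec.zipWith _^_ x e)

  value : ∀ {d} → RealPolynomial d → Vec Carrier d → Carrier
  value []            x = 0#
  value ((c , e) ∷ p) x = c * power x e + value p x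

  data Formula (d : ℕ) : Set where
    _≈0 _>0 : RealPolynomial d → Formula d
    _∧_ _∨_ : Formula d → Formula d → Formula d
    ~_      : Formula d → Formula d

  infix 4 _⊨_
  _⊨_ : ∀ {d} → Vec Carrier d → Formula d → Set
  x ⊨ (p ≈0)  = value p x ≡ 0#
  x ⊨ (p >0)  = 0# < value p x
  x ⊨ (F ∧ G) = x ⊨ F × x ⊨ G
  x ⊨ (F ∨ G) = x ⊨ F ⊎ x ⊨ G
  x ⊨ (~ F)   = ¬ x ⊨ F

------------------------------------------------------------------------
-- Input and output of algorithms

module Encoding (ℝ : RealNumbers) where
  open RealNumbers ℝ
  open Syntax ℝ
  open Computation ℝ
  open Formulas ℝ

  encList : ∀ {a} {A : Set a} → (A → Tree) → List A → Tree
  encList enc []       = nil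
  encList enc (x ∷ xs) = enc x ∷ encList enc xs

  encVec : ∀ {a} {A : Set a} {m} → (A → Tree) → Vec A m → Tree
  encVec enc xs = encList enc (Vec.toList xs)

  encℕ : ℕ → Tree
  encℕ zero    = nil
  encℕ (suc m) = nil ∷ encℕ m

  encRealPolynomial : ∀ {d} → RealPolynomial d → Tree
  encRealPolynomial = encList λ (c , e) → num c ∷ encVec encℕ e

  encFormula : ∀ {d} → Formula d → Tree
  encFormula (p ≈0)  = encℕ 0 ∷ encRealPolynomial p
  encFormula (p >0)  = encℕ 1 ∷ encRealPolynomial p
  encFormula (F ∧ G) = encℕ 2 ∷ encFormula F ∷ encFormula G
  encFormula (F ∨ G) = encℕ 3 ∷ encFormula F ∷ encFormula G
  encFormula (~ F)   = encℕ 4 ∷ encFormula F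

  module _ {n k : ℕ} where

    encCombination : ConvexCombination n k → Tree
    encCombination E = encVec num varCoeffs ∷ encVec num parCoeffs
      where open ConvexCombination E

    encMonomial : Monomial n k → Tree
    encMonomial M = encList encCombination (Monomial.factorList M)

    encPolynomial : Polynomial n k → Tree
    encPolynomial φ = encList encMonomial (Polynomial.monomials φ)

    encSystem : System n k → Tree
    encSystem = encVec encPolynomial

------------------------------------------------------------------------
-- Effectivity

module Effectivity (ℝ : RealNumbers) (V : FiniteDimensionalVectorSpace ℝ) where
  open RealNumbers ℝ
  open FiniteDimensionalVectorSpace V
  open Syntax ℝ
  open Computation ℝ
  open Formulas ℝ
  open Encoding ℝ
  open Geometry ℝ V

  Description : Set
  Description = Formula dim

  infix 4 _Describes_
  _Describes_ : Description → Subset → Set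
  D Describes A = (λ v → coordinates v ⊨ D) ≐ A

  ComputesClosure : ∀ {b K} → SetOfSubsets b → Program K → Set (lsuc 0ℓ ⊔ b)
  ComputesClosure 𝓑 p =
    ∀ {m} (B : Vec Subset (suc m)) (D : Vec Description (suc m)) (ρ : Vec Carrier (suc m)) →
    VecAll.All (_∈ᴮ 𝓑) B → Pointwise _Describes_ D B → VecAll.All (0# ≤_) ρ →
    Σ Description λ D-union →
    Σ Description λ D-sum →
    Σ (Vec Description (suc m)) λ D-scaled →
    Σ Description λ D-join →
    Σ Description λ D-hull →
      p ∙ (encVec encFormula D ∷ encVec num ρ) ⇓
        (encFormula D-union ∷ encFormula D-sum ∷ encVec encFormula D-scaled
          ∷ encFormula D-join ∷ encFormula D-hull)
      × D-union Describes Vec.foldr₁ _∪_ B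
      × D-sum   Describes Vec.foldr₁ _⊕_ B
      × Pointwise _Describes_ D-scaled (Vec.zipWith _·_ ρ B)
      × D-join  Describes Vec.foldr₁ _⋆_ B
      × D-hull  Describes conv (Vec.foldr₁ _∪_ B)

  record EffectiveGoodClosureProperty (K : Pred Carrier 0ℓ) {b} (𝓑 : SetOfSubsets b)
         : Set (lsuc 0ℓ ⊔ b) where
    field
      goodClosure : GoodClosureProperty 𝓑
      algorithm   : ∃ λ (p : Program K) → ComputesClosure 𝓑 p

  -- One program serves all numbers of variables and parameters, all systems
  -- and all assignments.
  ComputesSmallestSolution : ∀ {b K} → SetOfSubsets b → Program K → Set (lsuc 0ℓ ⊔ b)
  ComputesSmallestSolution 𝓑 p =
    ∀ {n k} (I : System n k) (𝐏 : Fin k → Subset) (D : Vec Description k) →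
    (∀ j → 𝐏 j ∈ᴮ 𝓑) → (∀ j → lookup D j Describes 𝐏 j) →
    ∀ (𝐗 : Fin n → Subset) → IsSmallestSolution I 𝐏 𝐗 →
    Σ (Vec Description n) λ D′ →
      p ∙ (encSystem I ∷ encVec encFormula D) ⇓ encVec encFormula D′
      × (∀ i → lookup D′ i Describes 𝐗 i)

{-# OPTIONS --safe #-}
module Submission where

-- Up to positive factors and convex hulls of the parameters, a monomial
-- g₁ ⋆ … ⋆ gᵣ says that the system is closed under every combination with
-- coefficient vector Σ wᵢ gᵢ, wᵢ > 0.  The variables are eliminated one by one.
-- For convex X, closure of X under x ↦ (l x + q) / (l + β) is equivalent, by
-- iteration and completeness of ℝ, to closure under all positive mixtures of X
-- and q / β.  Hence if the A are the monomials of φ without X and the M all its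
-- monomials, the smallest X ≥ φ is the hull of the A and of the A ⋆ M′, where M′
-- is M with X deleted; a single step suffices because mixtures of several M′
-- with A are convex combinations of mixtures with one M′ each.  Substituting
-- these monomials for X in the other inequalities leaves an equivalent system
-- with one variable less.  All steps except the final evaluation manipulate
-- lists of coefficients, so a program only consults the algorithm for the
-- family of sets when it substitutes back.

open import Defs
open import Level using (Level; 0ℓ; Lift; lift; lower; _⊔_) renaming (suc to lsuc)
open import Algebra.Bundles using (CommutativeRing)
open import Algebra.Module.Structures using (module IsLeftModule)
import Algebra.Properties.Ring as RingProperties
import Algebra.Solver.Ring.NaturalCoefficients.Default as SemiringSolver
open import Axiom.ExcludedMiddle using (ExcludedMiddle)
open import Data.Bool.Base using (Bool; true; false; if_then_else_)
open import Data.Empty using (⊥-elim)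
open import Data.Fin.Base using (Fin; zero; suc)
open import Data.List.Base as List using (List; []; _∷_; _++_; cartesianProductWith; reverse)
open import Data.List.Membership.Propositional using () renaming (_∈_ to _∈ˡ_)
open import Data.List.Membership.Propositional.Properties
  using (∈-++⁺ˡ; ∈-++⁺ʳ; ∈-++⁻; ∈-cartesianProductWith⁺; ∈-cartesianProductWith⁻; ∈-map⁻; ∈-map⁺)
open import Data.List.NonEmpty.Base as List⁺ using (_∷_)
open import Data.List.Properties using (reverse-foldl; reverse-involutive; map-is-foldr; ++-is-foldr)
open import Data.List.Relation.Unary.All as ListAll using ([]; _∷_)
import Data.List.Relation.Unary.All.Properties as ListAll
open import Data.List.Relation.Unary.Any using (here; there)
open import Data.Maybe.Base using (Maybe; just; nothing; maybe′)
open import Data.Nat.Base using (ℕ; zero; suc) renaming (_+_ to _+ⁿ_)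
open import Data.Product.Base using (Σ; ∃; _×_; _,_; proj₁; proj₂; uncurry)
open import Data.Sum.Base using (_⊎_; inj₁; inj₂; [_,_]′)
open import Data.Unit.Base using (⊤; tt)
open import Data.Vec.Base as Vec using (Vec; []; _∷_; lookup; tabulate; head; tail; toList)
open import Data.Vec.Properties
  using (map-++; lookup-map; lookup∘tabulate; tabulate∘lookup; tabulate-∘; toList-map; toList-++)
open import Data.Vec.Relation.Binary.Pointwise.Inductive using (Pointwise; []; _∷_)
open import Data.Vec.Relation.Unary.All as VecAll using ([]; _∷_)
import Data.Vec.Relation.Unary.All.Properties as VecAll
open import Function.Base using (_∘_; flip)
open import Relation.Binary.PropositionalEquality
  using (_≡_; _≢_; refl; sym; trans; cong; cong₂; subst; subst₂; module ≡-Reasoning)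
open import Relation.Binary.Structures using (IsTotalOrder)
open import Relation.Nullary using (¬_; Dec; yes; no; does)
open import Relation.Nullary.Decidable using (map′)
open import Relation.Unary using (Pred; _∈_; _⊆_; _≐_; ∅; _∪_; ｛_｝)
open import Relation.Unary.Properties using (≐-trans)

-- The law λA + μA = (λ + μ)A for λ, μ ≥ 0 requires A to be convex. This is why parameters are
-- replaced by their hulls before anything else: afterwards coefficient vectors add and scale as in
-- linear algebra, and the elimination never looks at the sets. Values are homogenised to pairs of a
-- weight s and a vector in s times the set; joins become sums, and substitution needs no division.
-- Two degeneracies shape the definitions. A zero coefficient contributes {0} even if its set is
-- empty, but {0} need not belong to the family; it is represented by the absence of a value. And M′
-- may keep no weight at all (M = X), so it appears only joined with some A. Such an A also starts
-- the iteration, by providing a point x ∈ X; if every monomial of φ contains X, the smallest X is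
-- empty. The solution is one term in the operations of the family. It is interpreted among the
-- members for the first claim, and among members with descriptions for the algorithm.

-- Arithmetic in a complete ordered field

module OrderedField (em : ExcludedMiddle (lsuc 0ℓ)) (ℝ : RealNumbers) where
  open RealNumbers ℝ
  open IsTotalOrder isTotalOrder public
    using () renaming (refl to ≤-refl; reflexive to ≤-reflexive; trans to ≤-trans;
                       antisym to ≤-antisym; total to ≤-total)
  open CommutativeRing commutativeRing public
    using (+-comm; +-assoc; +-identityˡ; +-identityʳ; *-comm; *-assoc; *-identityˡ; *-identityʳ;
           zeroˡ; zeroʳ; -‿inverseʳ; distribˡ; distribʳ)
  open CommutativeRing commutativeRing using (commutativeSemiring)
  open RingProperties ring using (-‿distribˡ-*; -‿distribʳ-*; -‿involutive)
  module Scalar = SemiringSolver commutativeSemiring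
  open Scalar using (solve; con; _:+_; _:*_; _:=_)

  abstract
    decide : (P : Set) → Dec P
    decide P = map′ lower lift (em {Lift (lsuc 0ℓ) P})

  0≤∧≢0⇒0< : ∀ {x} → 0# ≤ x → x ≢ 0# → 0# < x
  0≤∧≢0⇒0< 0≤x x≢0 = 0≤x , x≢0 ∘ sym

  0≤⇒≡0⊎0< : ∀ {x} → 0# ≤ x → x ≡ 0# ⊎ 0# < x
  0≤⇒≡0⊎0< {x} 0≤x with decide (x ≡ 0#)
  ... | yes x≡0 = inj₁ x≡0
  ... | no  x≢0 = inj₂ (0≤∧≢0⇒0< 0≤x x≢0)

  0≮0 : ¬ 0# < 0#
  0≮0 (_ , 0≢0) = 0≢0 refl

  ≰⇒> : ∀ {x y} → ¬ x ≤ y → y < x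
  ≰⇒> {x} {y} x≰y with ≤-total x y
  ... | inj₁ x≤y = ⊥-elim (x≰y x≤y)
  ... | inj₂ y≤x = y≤x , λ y≡x → x≰y (≤-reflexive (sym y≡x))

  <⇒≱ : ∀ {x y} → x < y → ¬ y ≤ x
  <⇒≱ (x≤y , x≢y) y≤x = x≢y (≤-antisym x≤y y≤x)

  x+[y-x]≡y : ∀ x y → x + (y - x) ≡ y
  x+[y-x]≡y x y = begin
    x + (y - x)   ≡⟨ cong (x +_) (+-comm y (- x)) ⟩
    x + (- x + y) ≡⟨ +-assoc x (- x) y ⟨
    (x - x) + y   ≡⟨ cong (_+ y) (-‿inverseʳ x) ⟩
    0# + y        ≡⟨ +-identityˡ y ⟩
    y             ∎
    where open ≡-Reasoning

  ≤⇒0≤- : ∀ {x y} → x ≤ y → 0# ≤ y - x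
  ≤⇒0≤- {x} {y} x≤y = subst (_≤ y - x) (-‿inverseʳ x) (+-monoˡ-≤ (- x) x≤y)

  x≤x+y : ∀ x {y} → 0# ≤ y → x ≤ x + y
  x≤x+y x {y} 0≤y = subst₂ _≤_ (+-identityˡ x) (+-comm y x) (+-monoˡ-≤ x 0≤y)

  +-nonneg : ∀ {x y} → 0# ≤ x → 0# ≤ y → 0# ≤ x + y
  +-nonneg {x} 0≤x 0≤y = ≤-trans 0≤x (x≤x+y x 0≤y)

  +-posˡ : ∀ {x y} → 0# < x → 0# ≤ y → 0# < x + y
  +-posˡ {x} (0≤x , 0≢x) 0≤y =
    +-nonneg 0≤x 0≤y , λ 0≡x+y → 0≢x (≤-antisym 0≤x (subst (x ≤_) (sym 0≡x+y) (x≤x+y x 0≤y)))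

  +-posʳ : ∀ {x y} → 0# ≤ x → 0# < y → 0# < x + y
  +-posʳ {x} {y} 0≤x 0<y = subst (0# <_) (+-comm y x) (+-posˡ 0<y 0≤x)

  +-≡0ˡ : ∀ {x y} → 0# ≤ x → 0# ≤ y → x + y ≡ 0# → x ≡ 0#
  +-≡0ˡ {x} 0≤x 0≤y x+y≡0 with 0≤⇒≡0⊎0< 0≤x
  ... | inj₁ x≡0 = x≡0
  ... | inj₂ 0<x = ⊥-elim (proj₂ (+-posˡ 0<x 0≤y) (sym x+y≡0))

  +-≡0ʳ : ∀ {x y} → 0# ≤ x → 0# ≤ y → x + y ≡ 0# → y ≡ 0#
  +-≡0ʳ {x} {y} 0≤x 0≤y x+y≡0 = +-≡0ˡ 0≤y 0≤x (trans (+-comm y x) x+y≡0)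

  0≤1 : 0# ≤ 1#
  0≤1 with ≤-total 0# 1#
  ... | inj₁ 0≤1 = 0≤1
  ... | inj₂ 1≤0 = subst (0# ≤_) [-1][-1]≡1 (*-nonneg 0≤-1 0≤-1)
    where
    0≤-1 : 0# ≤ - 1#
    0≤-1 = subst (0# ≤_) (+-identityˡ _) (≤⇒0≤- 1≤0)
    [-1][-1]≡1 : - 1# * - 1# ≡ 1#
    [-1][-1]≡1 = trans (sym (-‿distribˡ-* 1# (- 1#)))
                       (trans (cong -_ (*-identityˡ (- 1#))) (-‿involutive 1#))

  0<1 : 0# < 1#
  0<1 = 0≤1 , 0≢1

  reciprocal : ∀ {x} → 0# < x → ∃ λ y → x * y ≡ 1# × 0# < y
  reciprocal {x} (0≤x , 0≢x) with inverse x (0≢x ∘ sym)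
  ... | y , xy≡1 = y , xy≡1 , 0≤∧≢0⇒0< 0≤y y≢0
    where
    y≢0 : y ≢ 0#
    y≢0 y≡0 = 0≢1 (trans (sym (zeroʳ x)) (trans (cong (x *_) (sym y≡0)) xy≡1))
    0≤y : 0# ≤ y
    0≤y with ≤-total 0# y
    ... | inj₁ 0≤y = 0≤y
    ... | inj₂ y≤0 = ⊥-elim (0≢1 (sym (+-≡0ˡ 0≤1 0≤-1 (-‿inverseʳ 1#))))
      where
      0≤-y : 0# ≤ - y
      0≤-y = subst (0# ≤_) (+-identityˡ _) (≤⇒0≤- y≤0)
      0≤-1 : 0# ≤ - 1#
      0≤-1 = subst (0# ≤_) (trans (sym (-‿distribʳ-* x y)) (cong -_ xy≡1)) (*-nonneg 0≤x 0≤-y)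

  *-pos : ∀ {x y} → 0# < x → 0# < y → 0# < x * y
  *-pos {x} {y} 0<x 0<y = 0≤∧≢0⇒0< (*-nonneg (proj₁ 0<x) (proj₁ 0<y)) xy≢0
    where
    xy≢0 : x * y ≢ 0#
    xy≢0 xy≡0 with reciprocal 0<x
    ... | x⁻¹ , xx⁻¹≡1 , _ = proj₂ 0<y (sym (begin
      y              ≡⟨ *-identityˡ y ⟨
      1# * y         ≡⟨ cong (_* y) xx⁻¹≡1 ⟨
      x * x⁻¹ * y    ≡⟨ solve 3 (λ x x⁻¹ y → x :* x⁻¹ :* y := x⁻¹ :* (x :* y)) refl x x⁻¹ y ⟩
      x⁻¹ * (x * y)  ≡⟨ cong (x⁻¹ *_) xy≡0 ⟩
      x⁻¹ * 0#       ≡⟨ zeroʳ x⁻¹ ⟩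
      0#             ∎))
      where open ≡-Reasoning

  *-monoˡ-≤ : ∀ z {x y} → 0# ≤ z → x ≤ y → z * x ≤ z * y
  *-monoˡ-≤ z {x} {y} 0≤z x≤y = subst (z * x ≤_)
    (trans (sym (distribˡ z x (y - x))) (cong (z *_) (x+[y-x]≡y x y)))
    (x≤x+y (z * x) (*-nonneg 0≤z (≤⇒0≤- x≤y)))

  half : ∃ λ h → h + h ≡ 1# × 0# < h
  half with reciprocal (+-posˡ 0<1 0≤1)
  ... | h , 2h≡1 , 0<h = h , trans (solve 1 (λ h → h :+ h := (con 1 :+ con 1) :* h) refl h) 2h≡1 , 0<h

  sum-nonneg : ∀ {m} {c : Vec Carrier m} → VecAll.All (0# ≤_) c → 0# ≤ sum c
  sum-nonneg VecAll.[]         = ≤-refl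
  sum-nonneg (p VecAll.∷ ps) = +-nonneg p (sum-nonneg ps)

  -- The infimum is the least upper bound of the lower bounds: 0 is one of them, and any element of
  -- `S` bounds them from above.
  infimum : (S : Pred Carrier 0ℓ) → ∃ S → (∀ x → x ∈ S → 0# ≤ x) →
            ∃ λ s → 0# ≤ s × (∀ x → x ∈ S → s ≤ x) × (∀ l → (∀ x → x ∈ S → l ≤ x) → l ≤ s)
  infimum S (x₀ , x₀∈S) 0≤S
    with complete (λ l → ∀ x → x ∈ S → l ≤ x) (0# , 0≤S) (x₀ , λ l l≤S → l≤S x₀ x₀∈S)
  ... | s , s-bound , s-least =
    s , s-bound 0# 0≤S , (λ x x∈S → s-least x (λ l l≤S → l≤S x x∈S)) , s-bound

-- Linear identities: both sides have the same coefficient, a polynomial in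
-- the scalars, at every vector.
module LinearSolver (em : ExcludedMiddle (lsuc 0ℓ)) (ℝ : RealNumbers)
                    (V : FiniteDimensionalVectorSpace ℝ) where
  open RealNumbers ℝ
  open FiniteDimensionalVectorSpace V
  open OrderedField em ℝ
  open IsLeftModule isLeftModule public
    using (+ᴹ-comm; +ᴹ-assoc; +ᴹ-identityˡ; +ᴹ-identityʳ; *ₗ-zeroˡ; *ₗ-zeroʳ; *ₗ-identityˡ;
           *ₗ-assoc; *ₗ-distribˡ; *ₗ-distribʳ)
  open Scalar using (Polynomial; con; var; _:+_; _:*_; ⟦_⟧; ⟦_⟧↓; prove)

  infixr 7 _⊡_
  infixl 6 _⊞_
  data Term (k n : ℕ) : Set where
    vec : Fin n → Term k n
    𝟘   : Term k n
    _⊞_ : (s t : Term k n) → Term k n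
    _⊡_ : (p : Polynomial k) (t : Term k n) → Term k n

  ⟦_⟧ᵗ : ∀ {k n} → Term k n → Vec Carrier k → Vec Carrierᴹ n → Carrierᴹ
  ⟦ vec i ⟧ᵗ ρ x = lookup x i
  ⟦ 𝟘     ⟧ᵗ ρ x = 0ᴹ
  ⟦ s ⊞ t ⟧ᵗ ρ x = ⟦ s ⟧ᵗ ρ x +ᴹ ⟦ t ⟧ᵗ ρ x
  ⟦ p ⊡ t ⟧ᵗ ρ x = ⟦ p ⟧ ρ *ₗ ⟦ t ⟧ᵗ ρ x

  δ : ∀ {k n} → Fin n → Fin n → Polynomial k
  δ zero    zero    = con 1
  δ zero    (suc j) = con 0
  δ (suc i) zero    = con 0
  δ (suc i) (suc j) = δ i j

  coefficient : ∀ {k n} → Term k n → Fin n → Polynomial k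
  coefficient (vec i) j = δ i j
  coefficient 𝟘       j = con 0
  coefficient (s ⊞ t) j = coefficient s j :+ coefficient t j
  coefficient (p ⊡ t) j = p :* coefficient t j

  linear : ∀ {n} → (Fin n → Carrier) → Vec Carrierᴹ n → Carrierᴹ
  linear c []      = 0ᴹ
  linear c (x ∷ v) = c zero *ₗ x +ᴹ linear (c ∘ suc) v

  linear-cong : ∀ {n} {c d : Fin n → Carrier} v → (∀ j → c j ≡ d j) → linear c v ≡ linear d v
  linear-cong []      c≗d = refl
  linear-cong (x ∷ v) c≗d = cong₂ (λ a y → a *ₗ x +ᴹ y) (c≗d zero) (linear-cong v (c≗d ∘ suc))

  linear-0 : ∀ {n} (v : Vec Carrierᴹ n) → linear (λ _ → 0#) v ≡ 0ᴹ
  linear-0 []      = refl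
  linear-0 (x ∷ v) = trans (cong₂ _+ᴹ_ (*ₗ-zeroˡ x) (linear-0 v)) (+ᴹ-identityˡ 0ᴹ)

  interchange : ∀ a b c d → (a +ᴹ b) +ᴹ (c +ᴹ d) ≡ (a +ᴹ c) +ᴹ (b +ᴹ d)
  interchange a b c d = begin
    (a +ᴹ b) +ᴹ (c +ᴹ d) ≡⟨ +ᴹ-assoc a b (c +ᴹ d) ⟩
    a +ᴹ (b +ᴹ (c +ᴹ d)) ≡⟨ cong (a +ᴹ_) (+ᴹ-assoc b c d) ⟨
    a +ᴹ ((b +ᴹ c) +ᴹ d) ≡⟨ cong (λ z → a +ᴹ (z +ᴹ d)) (+ᴹ-comm b c) ⟩
    a +ᴹ ((c +ᴹ b) +ᴹ d) ≡⟨ cong (a +ᴹ_) (+ᴹ-assoc c b d) ⟩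
    a +ᴹ (c +ᴹ (b +ᴹ d)) ≡⟨ +ᴹ-assoc a c (b +ᴹ d) ⟨
    (a +ᴹ c) +ᴹ (b +ᴹ d) ∎
    where open ≡-Reasoning

  linear-+ : ∀ {n} (c d : Fin n → Carrier) v →
             linear c v +ᴹ linear d v ≡ linear (λ j → c j + d j) v
  linear-+ c d []      = +ᴹ-identityˡ 0ᴹ
  linear-+ c d (x ∷ v) = trans (interchange _ _ _ _)
    (cong₂ _+ᴹ_ (sym (*ₗ-distribʳ x _ _)) (linear-+ (c ∘ suc) (d ∘ suc) v))

  linear-* : ∀ {n} a (c : Fin n → Carrier) v → a *ₗ linear c v ≡ linear (λ j → a * c j) v
  linear-* a c []      = *ₗ-zeroʳ a
  linear-* a c (x ∷ v) = trans (*ₗ-distribˡ a _ _)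
    (cong₂ _+ᴹ_ (sym (*ₗ-assoc a _ x)) (linear-* a (c ∘ suc) v))

  linear-δ : ∀ {k n} (i : Fin n) (ρ : Vec Carrier k) v → linear (λ j → ⟦ δ i j ⟧ ρ) v ≡ lookup v i
  linear-δ zero    ρ (x ∷ v) = trans (cong₂ _+ᴹ_ (*ₗ-identityˡ x) (linear-0 v)) (+ᴹ-identityʳ x)
  linear-δ (suc i) ρ (x ∷ v) = trans (cong₂ _+ᴹ_ (*ₗ-zeroˡ x) (linear-δ i ρ v)) (+ᴹ-identityˡ _)

  expand : ∀ {k n} (t : Term k n) ρ v → linear (λ j → ⟦ coefficient t j ⟧ ρ) v ≡ ⟦ t ⟧ᵗ ρ v
  expand (vec i) ρ v = linear-δ i ρ v
  expand 𝟘       ρ v = linear-0 v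
  expand (s ⊞ t) ρ v = trans (sym (linear-+ _ _ v)) (cong₂ _+ᴹ_ (expand s ρ v) (expand t ρ v))
  expand (p ⊡ t) ρ v = trans (sym (linear-* _ _ v)) (cong (_ *ₗ_) (expand t ρ v))

  -- The normal forms of all coefficients are gathered in one vector per side, so that a single
  -- `refl` settles a call.
  solveᴹ : ∀ {k n} (ρ : Vec Carrier k) (v : Vec Carrierᴹ n)
           (f : Vec (Polynomial k) k → Vec (Term k n) n → Term k n × Term k n) →
           let (s , t) = f (tabulate var) (tabulate vec) in
           tabulate (λ j → ⟦ coefficient s j ⟧↓ ρ) ≡ tabulate (λ j → ⟦ coefficient t j ⟧↓ ρ) →
           ⟦ s ⟧ᵗ ρ v ≡ ⟦ t ⟧ᵗ ρ v
  solveᴹ ρ v f same = begin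
    ⟦ s ⟧ᵗ ρ v                             ≡⟨ expand s ρ v ⟨
    linear (λ j → ⟦ coefficient s j ⟧ ρ) v ≡⟨ linear-cong v same-at ⟩
    linear (λ j → ⟦ coefficient t j ⟧ ρ) v ≡⟨ expand t ρ v ⟩
    ⟦ t ⟧ᵗ ρ v                             ∎
    where
    open ≡-Reasoning
    s = proj₁ (f (tabulate var) (tabulate vec))
    t = proj₂ (f (tabulate var) (tabulate vec))
    same-at : ∀ j → ⟦ coefficient s j ⟧ ρ ≡ ⟦ coefficient t j ⟧ ρ
    same-at j = prove ρ (coefficient s j) (coefficient t j)
      (trans (sym (lookup∘tabulate (λ i → ⟦ coefficient s i ⟧↓ ρ) j))
        (trans (cong (λ w → lookup w j) same) (lookup∘tabulate (λ i → ⟦ coefficient t i ⟧↓ ρ) j)))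

-- Addition and scaling of coefficient vectors

module CoefficientVectors (em : ExcludedMiddle (lsuc 0ℓ)) (ℝ : RealNumbers) where
  open RealNumbers ℝ
  open OrderedField em ℝ
  open Scalar using (solve; con; _:+_; _:*_; _:=_)

  infixl 6 _⊹_
  infixr 7 _∙_
  _⊹_ : ∀ {m} → Vec Carrier m → Vec Carrier m → Vec Carrier m
  _⊹_ = Vec.zipWith _+_

  _∙_ : ∀ {m} → Carrier → Vec Carrier m → Vec Carrier m
  s ∙ c = Vec.map (s *_) c

  NonNegative : ∀ {m} → Vec Carrier m → Set
  NonNegative = VecAll.All (0# ≤_)

  ⊹-nonneg : ∀ {m} {c d : Vec Carrier m} → NonNegative c → NonNegative d → NonNegative (c ⊹ d)
  ⊹-nonneg []       []       = []
  ⊹-nonneg (p ∷ ps) (q ∷ qs) = +-nonneg p q ∷ ⊹-nonneg ps qs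

  ∙-nonneg : ∀ {m s} {c : Vec Carrier m} → 0# ≤ s → NonNegative c → NonNegative (s ∙ c)
  ∙-nonneg 0≤s []       = []
  ∙-nonneg 0≤s (p ∷ ps) = *-nonneg 0≤s p ∷ ∙-nonneg 0≤s ps

  sum-⊹ : ∀ {m} (c d : Vec Carrier m) → sum (c ⊹ d) ≡ sum c + sum d
  sum-⊹ []      []      = sym (+-identityˡ 0#)
  sum-⊹ (a ∷ c) (b ∷ d) = trans (cong (a + b +_) (sum-⊹ c d))
    (solve 4 (λ a b c d → a :+ b :+ (c :+ d) := a :+ c :+ (b :+ d)) refl a b (sum c) (sum d))

  sum-∙ : ∀ {m} s (c : Vec Carrier m) → sum (s ∙ c) ≡ s * sum c
  sum-∙ s []      = sym (zeroʳ s)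
  sum-∙ s (a ∷ c) = trans (cong (s * a +_) (sum-∙ s c)) (sym (distribˡ s a (sum c)))

  ∙-assoc : ∀ {m} s t (c : Vec Carrier m) → s ∙ t ∙ c ≡ (s * t) ∙ c
  ∙-assoc s t []      = refl
  ∙-assoc s t (a ∷ c) = cong₂ _∷_ (sym (*-assoc s t a)) (∙-assoc s t c)

  ∙-identityˡ : ∀ {m} (c : Vec Carrier m) → 1# ∙ c ≡ c
  ∙-identityˡ []      = refl
  ∙-identityˡ (a ∷ c) = cong₂ _∷_ (*-identityˡ a) (∙-identityˡ c)

  ∙-distribʳ : ∀ {m} s t (c : Vec Carrier m) → (s + t) ∙ c ≡ s ∙ c ⊹ t ∙ c
  ∙-distribʳ s t []      = refl
  ∙-distribʳ s t (a ∷ c) = cong₂ _∷_ (distribʳ a s t) (∙-distribʳ s t c)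

  ∙-distribˡ : ∀ {m} s (c d : Vec Carrier m) → s ∙ (c ⊹ d) ≡ s ∙ c ⊹ s ∙ d
  ∙-distribˡ s []      []      = refl
  ∙-distribˡ s (a ∷ c) (b ∷ d) = cong₂ _∷_ (distribˡ s a b) (∙-distribˡ s c d)

-- Weighted sums of convex sets, affine maps on hulls, and the pumping argument

module ConvexSets (em : ExcludedMiddle (lsuc 0ℓ)) (ℝ : RealNumbers)
                  (V : FiniteDimensionalVectorSpace ℝ) where
  open import Function.Base using (id)
  open RealNumbers ℝ
  open FiniteDimensionalVectorSpace V
  open OrderedField em ℝ
  open CoefficientVectors em ℝ
  open LinearSolver em ℝ V
  open Geometry ℝ V
  open Scalar using (solve; con; _:+_; _:*_; _:=_)

  convex-mix : ∀ {A} → Convex A → ∀ {x y α β} → 0# ≤ α → 0# ≤ β → α + β ≡ 1# →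
               x ∈ A → y ∈ A → α *ₗ x +ᴹ β *ₗ y ∈ A
  convex-mix {A} convex {x} {y} {α} {β} 0≤α 0≤β α+β≡1 x∈A y∈A =
    subst (λ γ → α *ₗ x +ᴹ γ *ₗ y ∈ A) 1-α≡β
      (convex 0≤α (subst (α ≤_) α+β≡1 (x≤x+y α 0≤β)) x∈A y∈A)
    where
    open ≡-Reasoning
    1-α≡β : 1# - α ≡ β
    1-α≡β = begin
      1# - α         ≡⟨ cong (_- α) α+β≡1 ⟨
      (α + β) - α    ≡⟨ +-assoc α β (- α) ⟩
      α + (β - α)    ≡⟨ x+[y-x]≡y α β ⟩
      β              ∎

  summand-mono : ∀ {λᵢ A B} → A ⊆ B → summand λᵢ A ⊆ summand λᵢ B
  summand-mono A⊆B (inj₁ (0<λ , a , a∈A , v≡λa)) = inj₁ (0<λ , a , A⊆B a∈A , v≡λa)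
  summand-mono A⊆B (inj₂ zero-summand)           = inj₂ zero-summand

  summand-nonneg : ∀ {λᵢ A v} → v ∈ summand λᵢ A → 0# ≤ λᵢ
  summand-nonneg (inj₁ ((0≤λ , _) , _)) = 0≤λ
  summand-nonneg (inj₂ (refl , _))      = ≤-refl

  *ₗ-∈-summand : ∀ {s A x} → 0# < s → x ∈ A → s *ₗ x ∈ summand s A
  *ₗ-∈-summand 0<s x∈A = inj₁ (0<s , _ , x∈A , refl)

  summand-0⁺ : ∀ {A} → 0ᴹ ∈ summand 0# A
  summand-0⁺ = inj₂ (refl , refl)

  summand-0⁻ : ∀ {A v} → v ∈ summand 0# A → v ≡ 0ᴹ
  summand-0⁻ (inj₁ (0<0 , _)) = ⊥-elim (0≮0 0<0)
  summand-0⁻ (inj₂ (_ , v≡0)) = v≡0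

  summand-pos⁻ : ∀ {s A v} → 0# < s → v ∈ summand s A → ∃ λ x → x ∈ A × v ≡ s *ₗ x
  summand-pos⁻ 0<s (inj₁ (_ , x∈))     = x∈
  summand-pos⁻ 0<s (inj₂ (refl , _))   = ⊥-elim (0≮0 0<s)

  summand-1⁻ : ∀ {A} → summand 1# A ⊆ A
  summand-1⁻ {A} v∈ with summand-pos⁻ 0<1 v∈
  ... | x , x∈A , refl = subst A (sym (*ₗ-identityˡ x)) x∈A

  summand-scale : ∀ {s λᵢ A v} → 0# < s → v ∈ summand λᵢ A → s *ₗ v ∈ summand (s * λᵢ) A
  summand-scale {s} 0<s (inj₁ (0<λ , x , x∈A , refl)) =
    inj₁ (*-pos 0<s 0<λ , x , x∈A , sym (*ₗ-assoc s _ x))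
  summand-scale {s} 0<s (inj₂ (refl , refl)) = inj₂ (zeroʳ s , *ₗ-zeroʳ s)

  -- With κ = 1 / (λ + μ), the point λ x + μ y is λ + μ times the mixture of x and y with weights κ
  -- λ and κ μ. This is the step by which convexity makes coefficients additive.
  summand-+ : ∀ {A λᵢ μᵢ u v} → Convex A → u ∈ summand λᵢ A → v ∈ summand μᵢ A →
              u +ᴹ v ∈ summand (λᵢ + μᵢ) A
  summand-+ {A} {λᵢ} {μᵢ} convex (inj₁ (0<λ , x , x∈A , refl)) (inj₁ (0<μ , y , y∈A , refl)) =
    mixed (reciprocal (+-posˡ 0<λ (proj₁ 0<μ)))
    where
    mixed : (∃ λ κ → (λᵢ + μᵢ) * κ ≡ 1# × 0# < κ) → λᵢ *ₗ x +ᴹ μᵢ *ₗ y ∈ summand (λᵢ + μᵢ) A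
    mixed (κ , inv , 0<κ) =
      inj₁ (+-posˡ 0<λ (proj₁ 0<μ) , _ ,
            convex-mix {A} convex (proj₁ (*-pos 0<κ 0<λ)) (proj₁ (*-pos 0<κ 0<μ))
              (trans (solve 3 (λ κ l m → κ :* l :+ κ :* m := (l :+ m) :* κ) refl κ λᵢ μᵢ) inv) x∈A y∈A ,
            (begin
              λᵢ *ₗ x +ᴹ μᵢ *ₗ y                     ≡⟨ *ₗ-identityˡ _ ⟨
              1# *ₗ (λᵢ *ₗ x +ᴹ μᵢ *ₗ y)             ≡⟨ cong (_*ₗ _) inv ⟨
              ((λᵢ + μᵢ) * κ) *ₗ (λᵢ *ₗ x +ᴹ μᵢ *ₗ y) ≡⟨ solveᴹ (λᵢ ∷ μᵢ ∷ κ ∷ []) (x ∷ y ∷ [])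
                (λ { (l ∷ m ∷ k ∷ []) (x ∷ y ∷ []) →
                  ((l :+ m) :* k) ⊡ (l ⊡ x ⊞ m ⊡ y) ,
                  (l :+ m) ⊡ ((k :* l) ⊡ x ⊞ (k :* m) ⊡ y) }) refl ⟩
              (λᵢ + μᵢ) *ₗ ((κ * λᵢ) *ₗ x +ᴹ (κ * μᵢ) *ₗ y) ∎))
      where open ≡-Reasoning
  summand-+ {A} {λᵢ} {u = u} convex u∈ (inj₂ (refl , refl)) =
    subst₂ (λ s v → v ∈ summand s A) (sym (+-identityʳ λᵢ)) (sym (+ᴹ-identityʳ u)) u∈
  summand-+ {A} {μᵢ = μᵢ} {v = v} convex (inj₂ (refl , refl)) v∈@(inj₁ _) =
    subst₂ (λ s w → w ∈ summand s A) (sym (+-identityˡ μᵢ)) (sym (+ᴹ-identityˡ v)) v∈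

  -- Both shares use the same point: (λ + μ) x = λ x + μ x. A vanishing coefficient takes the share
  -- 0, as prescribed by `summand`.
  summand-split : ∀ {A λᵢ μᵢ v} → 0# ≤ λᵢ → 0# ≤ μᵢ → v ∈ summand (λᵢ + μᵢ) A →
                  (summand λᵢ A ⊕ summand μᵢ A) v
  summand-split 0≤λ 0≤μ v∈ with 0≤⇒≡0⊎0< 0≤λ | 0≤⇒≡0⊎0< 0≤μ
  summand-split {A} {μᵢ = μᵢ} {v} _ _ v∈ | inj₁ refl | _ =
    0ᴹ , v , summand-0⁺ , subst (λ s → v ∈ summand s A) (+-identityˡ μᵢ) v∈ , sym (+ᴹ-identityˡ v)
  summand-split {A} {λᵢ} {v = v} _ _ v∈ | inj₂ _ | inj₁ refl =
    v , 0ᴹ , subst (λ s → v ∈ summand s A) (+-identityʳ λᵢ) v∈ , summand-0⁺ , sym (+ᴹ-identityʳ v)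
  summand-split _ 0≤μ v∈ | inj₂ 0<λ | inj₂ 0<μ with summand-pos⁻ (+-posˡ 0<λ 0≤μ) v∈
  ... | x , x∈A , refl =
    _ , _ , *ₗ-∈-summand 0<λ x∈A , *ₗ-∈-summand 0<μ x∈A , *ₗ-distribʳ x _ _

  ⨁-mono : ∀ {m} (c : Vec Carrier m) {𝐀 𝐁 : Fin m → Subset} → (∀ i → 𝐀 i ⊆ 𝐁 i) → ⨁ c 𝐀 ⊆ ⨁ c 𝐁
  ⨁-mono []      𝐀⊆𝐁 v∈ = v∈
  ⨁-mono (a ∷ c) 𝐀⊆𝐁 (u , v , u∈ , v∈ , eq) =
    u , v , summand-mono (𝐀⊆𝐁 zero) u∈ , ⨁-mono c (𝐀⊆𝐁 ∘ suc) v∈ , eq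

  ⨁-scale : ∀ {m s} (c : Vec Carrier m) {𝐀 v} → 0# < s → v ∈ ⨁ c 𝐀 → s *ₗ v ∈ ⨁ (s ∙ c) 𝐀
  ⨁-scale {s = s} []      0<s refl = sym (*ₗ-zeroʳ s)
  ⨁-scale {s = s} (a ∷ c) 0<s (u , v , u∈ , v∈ , refl) =
    _ , _ , summand-scale 0<s u∈ , ⨁-scale c 0<s v∈ , *ₗ-distribˡ s u v

  ⨁-unscale : ∀ {m s} (c : Vec Carrier m) {𝐀 v} → 0# < s → v ∈ ⨁ (s ∙ c) 𝐀 →
              ∃ λ u → u ∈ ⨁ c 𝐀 × v ≡ s *ₗ u
  ⨁-unscale {s = s} c {𝐀} {v} 0<s v∈ with reciprocal 0<s
  ... | κ , sκ≡1 , 0<κ =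
    κ *ₗ v ,
    subst (λ d → κ *ₗ v ∈ ⨁ d 𝐀)
      (trans (∙-assoc κ s c) (trans (cong (_∙ c) (trans (*-comm κ s) sκ≡1)) (∙-identityˡ c)))
      (⨁-scale (s ∙ c) 0<κ v∈) ,
    trans (sym (*ₗ-identityˡ v)) (trans (cong (_*ₗ v) (sym sκ≡1)) (*ₗ-assoc s κ v))

  ⨁-+ : ∀ {m} (c d : Vec Carrier m) {𝐀 u v} → (∀ i → Convex (𝐀 i)) →
        u ∈ ⨁ c 𝐀 → v ∈ ⨁ d 𝐀 → u +ᴹ v ∈ ⨁ (c ⊹ d) 𝐀
  ⨁-+ []      []      convex refl refl = sym (+ᴹ-identityˡ 0ᴹ)
  ⨁-+ (a ∷ c) (b ∷ d) convex (u , u′ , u∈ , u′∈ , refl) (v , v′ , v∈ , v′∈ , refl) =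
    _ , _ , summand-+ (convex zero) u∈ v∈ , ⨁-+ c d (convex ∘ suc) u′∈ v′∈ , interchange u u′ v v′

  ⨁-split : ∀ {m} (c d : Vec Carrier m) {𝐀 v} → NonNegative c → NonNegative d →
            v ∈ ⨁ (c ⊹ d) 𝐀 → (⨁ c 𝐀 ⊕ ⨁ d 𝐀) v
  ⨁-split []      []      []       []       refl = 0ᴹ , 0ᴹ , refl , refl , sym (+ᴹ-identityˡ 0ᴹ)
  ⨁-split (a ∷ c) (b ∷ d) (p ∷ ps) (q ∷ qs) (u , v , u∈ , v∈ , refl)
    with summand-split p q u∈ | ⨁-split c d ps qs v∈
  ... | u₁ , u₂ , u₁∈ , u₂∈ , refl | v₁ , v₂ , v₁∈ , v₂∈ , refl =
    u₁ +ᴹ v₁ , u₂ +ᴹ v₂ , (u₁ , v₁ , u₁∈ , v₁∈ , refl) , (u₂ , v₂ , u₂∈ , v₂∈ , refl) ,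
    interchange u₁ u₂ v₁ v₂

  0∙-∈ : ∀ {m} (c : Vec Carrier m) {𝐀} → 0ᴹ ∈ ⨁ (0# ∙ c) 𝐀
  0∙-∈ []      = refl
  0∙-∈ (a ∷ c) = 0ᴹ , 0ᴹ , inj₂ (zeroˡ a , refl) , 0∙-∈ c , sym (+ᴹ-identityˡ 0ᴹ)

  -- Nonnegative coefficients with sum zero all vanish, so each summand is {0}, whatever the sets
  -- are.
  ⨁-null : ∀ {m} (c : Vec Carrier m) {𝐀 v} → NonNegative c → sum c ≡ 0# → v ∈ ⨁ c 𝐀 → v ≡ 0ᴹ
  ⨁-null []      []       sum≡0 v∈ = sym v∈
  ⨁-null (a ∷ c) {𝐀} (p ∷ ps) sum≡0 (u , v , u∈ , v∈ , refl) =
    trans (cong₂ _+ᴹ_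
      (summand-0⁻ (subst (λ s → u ∈ summand s (𝐀 zero)) (+-≡0ˡ p (sum-nonneg ps) sum≡0) u∈))
      (⨁-null c ps (+-≡0ʳ p (sum-nonneg ps) sum≡0) v∈)) (+ᴹ-identityˡ 0ᴹ)

  ⨁-null⁺ : ∀ {m} (c : Vec Carrier m) {𝐀} → NonNegative c → sum c ≡ 0# → 0ᴹ ∈ ⨁ c 𝐀
  ⨁-null⁺ []      []       sum≡0 = refl
  ⨁-null⁺ (a ∷ c) (p ∷ ps) sum≡0 =
    0ᴹ , 0ᴹ , inj₂ (+-≡0ˡ p (sum-nonneg ps) sum≡0 , refl) ,
    ⨁-null⁺ c ps (+-≡0ʳ p (sum-nonneg ps) sum≡0) , sym (+ᴹ-identityˡ 0ᴹ)

  -- The preimage of a convex set under the affine map a ↦ k a + q is convex. Hence a closure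
  -- condition on a hull needs checking only on the points that generate it.
  conv-affine : ∀ {A X k q s} → Convex X → 0# ≤ s →
                (∀ {a} → a ∈ A → k *ₗ a +ᴹ q ∈ summand s X) →
                ∀ {a} → a ∈ conv A → k *ₗ a +ᴹ q ∈ summand s X
  conv-affine convex 0≤s onA (incl a∈A) = onA a∈A
  conv-affine {X = X} {k} {q} {s} convex 0≤s onA (mix {x} {y} {t} 0≤t t≤1 x∈ y∈) =
    subst₂ (λ r v → v ∈ summand r X) weight point
      (summand-+ convex (scale 0≤t (conv-affine convex 0≤s onA x∈))
                        (scale (≤⇒0≤- t≤1) (conv-affine convex 0≤s onA y∈)))
    where
    open ≡-Reasoning
    β = 1# - t
    -- One of the weights t and 1 - t may be 0; its summand is then {0} by convention.
    scale : ∀ {r v} → 0# ≤ r → v ∈ summand s X → r *ₗ v ∈ summand (r * s) X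
    scale {v = v} 0≤r v∈ with 0≤⇒≡0⊎0< 0≤r
    ... | inj₁ refl = inj₂ (zeroˡ s , *ₗ-zeroˡ v)
    ... | inj₂ 0<r  = summand-scale 0<r v∈
    weight : t * s + β * s ≡ s
    weight = begin
      t * s + β * s ≡⟨ distribʳ s t β ⟨
      (t + β) * s   ≡⟨ cong (_* s) (x+[y-x]≡y t 1#) ⟩
      1# * s        ≡⟨ *-identityˡ s ⟩
      s             ∎
    point : t *ₗ (k *ₗ x +ᴹ q) +ᴹ β *ₗ (k *ₗ y +ᴹ q) ≡ k *ₗ (t *ₗ x +ᴹ β *ₗ y) +ᴹ q
    point = begin
      t *ₗ (k *ₗ x +ᴹ q) +ᴹ β *ₗ (k *ₗ y +ᴹ q)
        ≡⟨ solveᴹ (t ∷ β ∷ k ∷ []) (x ∷ y ∷ q ∷ []) (λ { (t ∷ b ∷ k ∷ []) (x ∷ y ∷ q ∷ []) →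
             t ⊡ (k ⊡ x ⊞ q) ⊞ b ⊡ (k ⊡ y ⊞ q) , k ⊡ (t ⊡ x ⊞ b ⊡ y) ⊞ (t :+ b) ⊡ q }) refl ⟩
      k *ₗ (t *ₗ x +ᴹ β *ₗ y) +ᴹ (t + β) *ₗ q
        ≡⟨ cong (λ r → k *ₗ (t *ₗ x +ᴹ β *ₗ y) +ᴹ r *ₗ q) (x+[y-x]≡y t 1#) ⟩
      k *ₗ (t *ₗ x +ᴹ β *ₗ y) +ᴹ 1# *ₗ q
        ≡⟨ cong (k *ₗ (t *ₗ x +ᴹ β *ₗ y) +ᴹ_) (*ₗ-identityˡ q) ⟩
      k *ₗ (t *ₗ x +ᴹ β *ₗ y) +ᴹ q ∎

  -- Iterating x ↦ (l x + q) / (l + β) moves the weight α of x towards 0; the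
  -- infimum of the weights that are reached is 0.
  pump : ∀ {X x q l β} → Convex X → x ∈ X → 0# < l → 0# ≤ β →
         (∀ {y} → y ∈ X → l *ₗ y +ᴹ q ∈ summand (l + β) X) →
         ∀ {α} → 0# < α → α *ₗ x +ᴹ q ∈ summand (α + β) X
  pump {X} {x} {q} {l} {β} convex x∈X 0<l 0≤β closed {α} 0<α = result
    where
    Reached : Pred Carrier 0ℓ
    Reached α = 0# < α × α *ₗ x +ᴹ q ∈ summand (α + β) X

    -- If (α + β) y = α x + q, then l y + q multiplied by τ (α + β) equals l α τ x + q: the
    -- coefficient of q is again 1, and the weight of x has become l α / (l + α + β).
    iterate : ∀ {α τ} → (l + α + β) * τ ≡ 1# → 0# < τ → α ∈ Reached → l * α * τ ∈ Reached
    iterate {α} {τ} inv 0<τ (0<α , ∈X) with summand-pos⁻ (+-posˡ 0<α 0≤β) ∈X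
    ... | y , y∈X , eq =
      *-pos (*-pos 0<l 0<α) 0<τ ,
      subst₂ (λ r v → v ∈ summand r X) weight point
        (summand-scale (*-pos 0<τ (+-posˡ 0<α 0≤β)) (closed y∈X))
      where
      open ≡-Reasoning
      weight : τ * (α + β) * (l + β) ≡ l * α * τ + β
      weight = begin
        τ * (α + β) * (l + β)
          ≡⟨ solve 4 (λ t a b l → t :* (a :+ b) :* (l :+ b) :=
                                  l :* a :* t :+ (l :+ a :+ b) :* t :* b) refl τ α β l ⟩
        l * α * τ + (l + α + β) * τ * β ≡⟨ cong (λ r → l * α * τ + r * β) inv ⟩
        l * α * τ + 1# * β              ≡⟨ cong (l * α * τ +_) (*-identityˡ β) ⟩
        l * α * τ + β                   ∎
      point : (τ * (α + β)) *ₗ (l *ₗ y +ᴹ q) ≡ (l * α * τ) *ₗ x +ᴹ q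
      point = begin
        (τ * (α + β)) *ₗ (l *ₗ y +ᴹ q)
          ≡⟨ solveᴹ (τ ∷ α ∷ β ∷ l ∷ []) (y ∷ q ∷ []) (λ { (t ∷ a ∷ b ∷ l ∷ []) (y ∷ q ∷ []) →
               (t :* (a :+ b)) ⊡ (l ⊡ y ⊞ q) ,
               (t :* l) ⊡ ((a :+ b) ⊡ y) ⊞ (t :* (a :+ b)) ⊡ q }) refl ⟩
        (τ * l) *ₗ ((α + β) *ₗ y) +ᴹ (τ * (α + β)) *ₗ q
          ≡⟨ cong (λ v → (τ * l) *ₗ v +ᴹ (τ * (α + β)) *ₗ q) eq ⟨
        (τ * l) *ₗ (α *ₗ x +ᴹ q) +ᴹ (τ * (α + β)) *ₗ q
          ≡⟨ solveᴹ (τ ∷ α ∷ β ∷ l ∷ []) (x ∷ q ∷ []) (λ { (t ∷ a ∷ b ∷ l ∷ []) (x ∷ q ∷ []) →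
               (t :* l) ⊡ (a ⊡ x ⊞ q) ⊞ (t :* (a :+ b)) ⊡ q ,
               (l :* a :* t) ⊡ x ⊞ ((l :+ a :+ b) :* t) ⊡ q }) refl ⟩
        (l * α * τ) *ₗ x +ᴹ ((l + α + β) * τ) *ₗ q
          ≡⟨ cong (λ r → (l * α * τ) *ₗ x +ᴹ r *ₗ q) inv ⟩
        (l * α * τ) *ₗ x +ᴹ 1# *ₗ q
          ≡⟨ cong ((l * α * τ) *ₗ x +ᴹ_) (*ₗ-identityˡ q) ⟩
        (l * α * τ) *ₗ x +ᴹ q ∎

    inf = infimum Reached (l , 0<l , closed x∈X) (λ _ → proj₁ ∘ proj₁)
    s = proj₁ inf
    0≤s = proj₁ (proj₂ inf)
    s≤ = proj₁ (proj₂ (proj₂ inf))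
    greatest = proj₂ (proj₂ (proj₂ inf))

    -- The infimum s is at most l α / (l + α + β) for every reached α, so s (l + s) ≤ s (l + α + β)
    -- ≤ l α. Division by l makes s + s² / l a lower bound, which exceeds s if s > 0.
    s≮ : ¬ 0# < s
    s≮ 0<s with reciprocal 0<l
    ... | κ , lκ≡1 , 0<κ = <⇒≱ s<s+ssκ (greatest (s + s * s * κ) lower-bound)
      where
      s<s+ssκ : s < s + s * s * κ
      s<s+ssκ = ≰⇒> λ le → proj₂ (*-pos (*-pos 0<s 0<s) 0<κ)
        (≤-antisym (proj₁ (*-pos (*-pos 0<s 0<s) 0<κ)) (cancel le))
        where
        cancel : s + s * s * κ ≤ s → s * s * κ ≤ 0#
        cancel le = subst₂ _≤_ (trans (cong (_- s) (+-comm s _)) (trans (+-assoc _ s (- s))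
            (trans (cong (s * s * κ +_) (-‿inverseʳ s)) (+-identityʳ _)))) (-‿inverseʳ s)
          (+-monoˡ-≤ (- s) le)
      lower-bound : ∀ α → α ∈ Reached → s + s * s * κ ≤ α
      lower-bound α α∈@(0<α , _) with reciprocal (+-posˡ (+-posˡ 0<l (proj₁ 0<α)) 0≤β)
      ... | τ , inv , 0<τ = subst₂ _≤_ eqˡ eqʳ (*-monoˡ-≤ κ (proj₁ 0<κ) (≤-trans le₁ le₂))
        where
        open ≡-Reasoning
        T = l + α + β
        le₂ : T * s ≤ l * α
        le₂ = subst (T * s ≤_) (begin
            T * (l * α * τ)   ≡⟨ solve 4 (λ T l a t → T :* (l :* a :* t) := T :* t :* (l :* a)) refl T l α τ ⟩
            T * τ * (l * α)   ≡⟨ cong (_* (l * α)) inv ⟩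
            1# * (l * α)      ≡⟨ *-identityˡ _ ⟩
            l * α             ∎)
          (*-monoˡ-≤ T (proj₁ (+-posˡ (+-posˡ 0<l (proj₁ 0<α)) 0≤β)) (s≤ _ (iterate inv 0<τ α∈)))
        le₁ : s * (l + s) ≤ T * s
        le₁ = ≤-trans (*-monoˡ-≤ s 0≤s l+s≤T) (≤-reflexive (*-comm s T))
          where
          l+s≤T : l + s ≤ T
          l+s≤T = ≤-trans (subst₂ _≤_ (+-comm s l) (+-comm α l) (+-monoˡ-≤ l (s≤ α α∈))) (x≤x+y _ 0≤β)
        eqˡ : κ * (s * (l + s)) ≡ s + s * s * κ
        eqˡ = begin
          κ * (s * (l + s))       ≡⟨ solve 3 (λ k s l → k :* (s :* (l :+ s)) :=
                                                  (l :* k) :* s :+ s :* s :* k) refl κ s l ⟩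
          l * κ * s + s * s * κ   ≡⟨ cong (λ r → r * s + s * s * κ) lκ≡1 ⟩
          1# * s + s * s * κ      ≡⟨ cong (_+ s * s * κ) (*-identityˡ s) ⟩
          s + s * s * κ           ∎
        eqʳ : κ * (l * α) ≡ α
        eqʳ = begin
          κ * (l * α) ≡⟨ solve 3 (λ k l a → k :* (l :* a) := l :* k :* a) refl κ l α ⟩
          l * κ * α   ≡⟨ cong (_* α) lκ≡1 ⟩
          1# * α      ≡⟨ *-identityˡ α ⟩
          α           ∎

    α≰s : ¬ α ≤ s
    α≰s α≤s = s≮ (≤-trans (proj₁ 0<α) α≤s ,
      λ 0≡s → <⇒≱ 0<α (subst (α ≤_) (sym 0≡s) α≤s))

    -- If no reached weight were at most α, then α would be a lower bound and hence at most s, which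
    -- is not positive. From a reached α′ ≤ α, convexity allows the missing multiple (α - α′) x to
    -- be added.
    result : α *ₗ x +ᴹ q ∈ summand (α + β) X
    result with decide (∃ λ α′ → α′ ∈ Reached × α′ ≤ α)
    ... | no none = ⊥-elim (α≰s (greatest α λ α′ α′∈ →
            [ id , (λ α′≤α → ⊥-elim (none (α′ , α′∈ , α′≤α))) ]′ (≤-total α α′)))
    ... | yes (α′ , (_ , α′∈) , α′≤α) =
      subst₂ (λ r v → v ∈ summand r X)
        (trans (sym (+-assoc ε α′ β)) (cong (_+ β) ε+α′≡α))
        (trans (solveᴹ (ε ∷ α′ ∷ []) (x ∷ q ∷ []) (λ { (d ∷ a ∷ []) (x ∷ q ∷ []) →
                  d ⊡ x ⊞ (a ⊡ x ⊞ q) , (d :+ a) ⊡ x ⊞ q }) refl)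
               (cong (λ r → r *ₗ x +ᴹ q) ε+α′≡α))
        (summand-+ convex εx∈ α′∈)
      where
      ε = α - α′
      ε+α′≡α : ε + α′ ≡ α
      ε+α′≡α = trans (+-comm ε α′) (x+[y-x]≡y α′ α)
      εx∈ : ε *ₗ x ∈ summand ε X
      εx∈ with 0≤⇒≡0⊎0< (≤⇒0≤- α′≤α)
      ... | inj₁ ε≡0 = inj₂ (ε≡0 , trans (cong (_*ₗ x) ε≡0) (*ₗ-zeroˡ x))
      ... | inj₂ 0<ε = *ₗ-∈-summand 0<ε x∈X

-- Elimination of the first indeterminate

module Elimination (em : ExcludedMiddle (lsuc 0ℓ)) (ℝ : RealNumbers) where
  open import Function.Base using (id)
  open RealNumbers ℝ
  open OrderedField em ℝ
  open CoefficientVectors em ℝ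
  open Scalar using (solve; con; _:+_; _:*_; _:=_)

  -- A generator is a vector of coefficients up to a positive factor, and
  -- generators g₁, …, gᵣ stand for all Σ wᵢ gᵢ with wᵢ > 0.
  Generators Disjunction : ℕ → Set
  Generators m  = List (Vec Carrier m)
  Disjunction m = List (Generators m)

  -- Decided here by excluded middle; a program decides the same proposition by the single
  -- instruction `less`.
  isPositive : Carrier → Bool
  isPositive x = does (decide (0# < x))

  occurs : ∀ {m} → Generators (suc m) → Bool
  occurs = List.foldr (λ g b → if isPositive (head g) then true else b) false

  tails : ∀ {m} → Generators (suc m) → Generators m
  tails = List.map tail

  withoutFirst : ∀ {m} → Disjunction (suc m) → Disjunction m
  withoutFirst = List.foldr (λ M ψ → if occurs M then ψ else tails M ∷ ψ) []

  _joinTails_ : ∀ {m} → Generators m → Generators (suc m) → Generators m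
  A joinTails M = A ++ tails M

  -- No monomials result when all of φ contain the first indeterminate; the hull is then empty, as
  -- is the smallest solution. For M consisting of that indeterminate alone, `tails M` is a null
  -- vector and the join repeats A up to weight zero, which is harmless.
  eliminant : ∀ {m} → Disjunction (suc m) → Disjunction m
  eliminant φ = withoutFirst φ ++ cartesianProductWith _joinTails_ (withoutFirst φ) φ

  -- (sum g)⁻¹ times the result is the value of the generator E when its first
  -- indeterminate is replaced by the convex combination (sum g)⁻¹ ∙ g.
  plug : ∀ {m} → Vec Carrier (suc m) → Vec Carrier m → Vec Carrier m
  plug E g = head E ∙ g ⊹ sum g ∙ tail E

  -- Replacing X in a X + c by a convex mixture Σ ω g of normalised generators gives Σ ω (a g + c),
  -- so one factor turns into one factor per generator of `N`.
  substitute : ∀ {m} → Generators m → Generators (suc m) → Generators m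
  substitute N M = cartesianProductWith plug M N

  -- The monomials free of the eliminated indeterminate are listed separately because they have to
  -- survive when `Y` is empty, that is, when the eliminated set is empty.
  reduce : ∀ {m} → Disjunction m → Disjunction (suc m) → Disjunction m
  reduce Y φ = withoutFirst φ ++ cartesianProductWith substitute Y φ

  Total : ∀ {m} → Generators m → Pred Carrier 0ℓ
  Total []      s = s ≡ 0#
  Total (g ∷ M) s = ∃ λ w → ∃ λ s′ → 0# < w × s′ ∈ Total M × s ≡ w * sum g + s′

  NonNegativeᴳ : ∀ {m} → Generators m → Set
  NonNegativeᴳ = ListAll.All NonNegative

  -- Excludes the empty list and lists of zero vectors. They have only the apex of the cone as value
  -- and could not be rescaled to weight 1.
  record Proper {m} (M : Generators m) : Set where
    field
      nonneg   : NonNegativeᴳ M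
      positive : ∀ {s} → s ∈ Total M → 0# < s
  open Proper public

  Properᴰ : ∀ {m} → Disjunction m → Set
  Properᴰ φ = ∀ {M} → M ∈ˡ φ → Proper M

  Total-++⁻ : ∀ {m} (M N : Generators m) {s} → s ∈ Total (M ++ N) →
              ∃ λ a → ∃ λ b → a ∈ Total M × b ∈ Total N × s ≡ a + b
  Total-++⁻ []      N {s} s∈ = 0# , s , refl , s∈ , sym (+-identityˡ s)
  Total-++⁻ (g ∷ M) N (w , _ , 0<w , s∈ , refl) with Total-++⁻ M N s∈
  ... | a , b , a∈ , b∈ , refl = _ , b , (w , a , 0<w , a∈ , refl) , b∈ , sym (+-assoc _ a b)

  Total-nonneg : ∀ {m} {M : Generators m} {s} → NonNegativeᴳ M → s ∈ Total M → 0# ≤ s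
  Total-nonneg []       refl                      = ≤-refl
  Total-nonneg (p ∷ ps) (w , s , 0<w , s∈ , refl) =
    +-nonneg (*-nonneg (proj₁ 0<w) (sum-nonneg p)) (Total-nonneg ps s∈)

  occurs-∷-false : ∀ {m} (g : Vec Carrier (suc m)) M → occurs (g ∷ M) ≡ false →
                   ¬ 0# < head g × occurs M ≡ false
  occurs-∷-false g M eq with decide (0# < head g)
  ... | no ¬p = ¬p , eq

  occurs-∷-true : ∀ {m} (g : Vec Carrier (suc m)) M → occurs (g ∷ M) ≡ true →
                  0# < head g ⊎ occurs M ≡ true
  occurs-∷-true g M eq with decide (0# < head g)
  ... | yes p = inj₁ p
  ... | no _  = inj₂ eq

  0≤∧≯0⇒≡0 : ∀ {x} → 0# ≤ x → ¬ 0# < x → x ≡ 0#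
  0≤∧≯0⇒≡0 0≤x ≯0 = [ id , (λ 0<x → ⊥-elim (≯0 0<x)) ]′ (0≤⇒≡0⊎0< 0≤x)

  ∈-withoutFirst⁺ : ∀ {m} {φ : Disjunction (suc m)} {M} → M ∈ˡ φ → occurs M ≡ false →
                    tails M ∈ˡ withoutFirst φ
  ∈-withoutFirst⁺ {φ = M ∷ φ} (here refl) eq rewrite eq = here refl
  ∈-withoutFirst⁺ {φ = N ∷ φ} (there M∈)  eq with occurs N
  ... | true  = ∈-withoutFirst⁺ M∈ eq
  ... | false = there (∈-withoutFirst⁺ M∈ eq)

  ∈-withoutFirst⁻ : ∀ {m} (φ : Disjunction (suc m)) {N} → N ∈ˡ withoutFirst φ →
                    ∃ λ M → M ∈ˡ φ × occurs M ≡ false × N ≡ tails M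
  ∈-withoutFirst⁻ (M ∷ φ) N∈ with occurs M in eq
  ∈-withoutFirst⁻ (M ∷ φ) N∈ | true with ∈-withoutFirst⁻ φ N∈
  ... | M′ , M′∈ , eqs = M′ , there M′∈ , eqs
  ∈-withoutFirst⁻ (M ∷ φ) (here refl) | false = M , here refl , eq , refl
  ∈-withoutFirst⁻ (M ∷ φ) (there N∈)  | false with ∈-withoutFirst⁻ φ N∈
  ... | M′ , M′∈ , eqs = M′ , there M′∈ , eqs

  tails-nonneg : ∀ {m} {M : Generators (suc m)} → NonNegativeᴳ M → NonNegativeᴳ (tails M)
  tails-nonneg []                       = []
  tails-nonneg {M = (_ ∷ _) ∷ _} ((_ ∷ p) ∷ ps) = p ∷ tails-nonneg ps

  Total-tails : ∀ {m} {M : Generators (suc m)} {s} → NonNegativeᴳ M → occurs M ≡ false →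
                s ∈ Total (tails M) → s ∈ Total M
  Total-tails []             eq s∈ = s∈
  Total-tails {M = (a ∷ c) ∷ M} ((0≤a ∷ _) ∷ ps) eq (w , s , 0<w , s∈ , refl)
    with occurs-∷-false (a ∷ c) M eq
  ... | ≯0 , eq′ = w , s , 0<w , Total-tails ps eq′ s∈ ,
    cong (λ r → w * r + s) (trans (sym (+-identityˡ _)) (cong (_+ sum c) (sym (0≤∧≯0⇒≡0 0≤a ≯0))))

  tails-proper : ∀ {m} {M : Generators (suc m)} → Proper M → occurs M ≡ false → Proper (tails M)
  tails-proper pM eq = record
    { nonneg   = tails-nonneg (nonneg pM)
    ; positive = positive pM ∘ Total-tails (nonneg pM) eq }

  withoutFirst-proper : ∀ {m} {φ : Disjunction (suc m)} → Properᴰ φ → Properᴰ (withoutFirst φ)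
  withoutFirst-proper {φ = φ} pφ N∈ with ∈-withoutFirst⁻ φ N∈
  ... | M , M∈ , eq , refl = tails-proper (pφ M∈) eq

  joinTails-proper : ∀ {m} {A : Generators m} {M} → Proper A → Proper M → Proper (A joinTails M)
  joinTails-proper {A = A} {M} pA pM = record
    { nonneg   = ListAll.++⁺ (nonneg pA) (tails-nonneg (nonneg pM))
    ; positive = λ s∈ → pos (Total-++⁻ A (tails M) s∈) }
    where
    pos : ∀ {s} → (∃ λ a → ∃ λ b → a ∈ Total A × b ∈ Total (tails M) × s ≡ a + b) → 0# < s
    pos (a , b , a∈ , b∈ , refl) =
      +-posˡ (positive pA a∈) (Total-nonneg (tails-nonneg (nonneg pM)) b∈)

  eliminant-proper : ∀ {m} {φ : Disjunction (suc m)} → Properᴰ φ → Properᴰ (eliminant φ)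
  eliminant-proper {φ = φ} pφ N∈ with ∈-++⁻ (withoutFirst φ) N∈
  ... | inj₁ N∈ˡ = withoutFirst-proper pφ N∈ˡ
  ... | inj₂ N∈ʳ with ∈-cartesianProductWith⁻ _joinTails_ (withoutFirst φ) φ N∈ʳ
  ... | A , M , A∈ , M∈ , refl = joinTails-proper (withoutFirst-proper pφ A∈) (pφ M∈)

  plug-nonneg : ∀ {m} {E : Vec Carrier (suc m)} {g} → NonNegative E → NonNegative g →
                NonNegative (plug E g)
  plug-nonneg {E = _ ∷ _} (0≤a ∷ ps) qs =
    ⊹-nonneg (∙-nonneg 0≤a qs) (∙-nonneg (sum-nonneg qs) ps)

  sum-plug : ∀ {m} (E : Vec Carrier (suc m)) g → sum (plug E g) ≡ sum g * sum E
  sum-plug (a ∷ c) g = begin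
    sum (a ∙ g ⊹ sum g ∙ c)         ≡⟨ sum-⊹ (a ∙ g) (sum g ∙ c) ⟩
    sum (a ∙ g) + sum (sum g ∙ c)   ≡⟨ cong₂ _+_ (sum-∙ a g) (sum-∙ (sum g) c) ⟩
    a * sum g + sum g * sum c       ≡⟨ solve 3 (λ a g c → a :* g :+ g :* c := g :* (a :+ c))
                                         refl a (sum g) (sum c) ⟩
    sum g * (a + sum c)             ∎
    where open ≡-Reasoning

  Total-plug : ∀ {m} (E : Vec Carrier (suc m)) N {s} → s ∈ Total (List.map (plug E) N) →
               ∃ λ y → y ∈ Total N × s ≡ y * sum E
  Total-plug E []      refl = 0# , refl , sym (zeroˡ (sum E))
  Total-plug E (g ∷ N) (w , _ , 0<w , s∈ , refl) with Total-plug E N s∈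
  ... | y , y∈ , refl = _ , (w , y , 0<w , y∈ , refl) ,
    trans (cong (λ r → w * r + y * sum E) (sum-plug E g))
      (solve 4 (λ w g e y → w :* (g :* e) :+ y :* e := (w :* g :+ y) :* e) refl w (sum g) (sum E) y)

  -- By `sum-plug`, the generators stemming from one factor E contribute y · sum E in total, where y
  -- is a total of `N`. Properness of `N` makes y positive, so it can serve as the weight of E.
  Total-substitute : ∀ {m} {N : Generators m} M {s} → Proper N → s ∈ Total (substitute N M) →
                     s ∈ Total M
  Total-substitute []      pN s∈ = s∈
  Total-substitute {N = N} (E ∷ M) pN s∈
    with Total-++⁻ (List.map (plug E) N) (substitute N M) s∈
  ... | _ , b , a∈ , b∈ , refl with Total-plug E N a∈
  ... | y , y∈ , refl = y , b , positive pN y∈ , Total-substitute M pN b∈ , refl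

  substitute-nonneg : ∀ {m} {N : Generators m} {M} → NonNegativeᴳ N → NonNegativeᴳ M →
                      NonNegativeᴳ (substitute N M)
  substitute-nonneg pN []       = []
  substitute-nonneg pN (p ∷ ps) =
    ListAll.++⁺ (ListAll.map⁺ (ListAll.map (plug-nonneg p) pN)) (substitute-nonneg pN ps)

  reduce-proper : ∀ {m} {Y} {φ : Disjunction (suc m)} → Properᴰ Y → Properᴰ φ → Properᴰ (reduce Y φ)
  reduce-proper {Y = Y} {φ} pY pφ N∈ with ∈-++⁻ (withoutFirst φ) N∈
  ... | inj₁ N∈ˡ = withoutFirst-proper pφ N∈ˡ
  ... | inj₂ N∈ʳ with ∈-cartesianProductWith⁻ substitute Y φ N∈ʳ
  ... | N , M , N∈ , M∈ , refl = record
    { nonneg   = substitute-nonneg (nonneg (pY N∈)) (nonneg (pφ M∈))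
    ; positive = positive (pφ M∈) ∘ Total-substitute M (pY N∈) }

-- Correctness of the elimination step

module EliminationCorrectness (em : ExcludedMiddle (lsuc 0ℓ)) (ℝ : RealNumbers)
                              (V : FiniteDimensionalVectorSpace ℝ) where
  open import Function.Base using (id)
  open RealNumbers ℝ
  open FiniteDimensionalVectorSpace V
  open OrderedField em ℝ
  open CoefficientVectors em ℝ
  open LinearSolver em ℝ V
  open Geometry ℝ V
  open ConvexSets em ℝ V
  open Elimination em ℝ
  open Scalar using (solve; con; _:+_; _:*_; _:=_)

  Convexᵛ : ∀ {m} → Vec Subset m → Set
  Convexᵛ As = ∀ i → Convex (lookup As i)

  -- The cone over the value of M, with s the total weight, so that generators
  -- need not be normalised.
  Value : ∀ {m} → Generators m → Vec Subset m → Carrier → Subset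
  Value []      As s v = s ≡ 0# × v ≡ 0ᴹ
  Value (g ∷ M) As s v = ∃ λ w → ∃ λ u → ∃ λ s′ → ∃ λ v′ →
    0# < w × u ∈ ⨁ (w ∙ g) (lookup As) × v′ ∈ Value M As s′ × s ≡ w * sum g + s′ × v ≡ u +ᴹ v′

  Satisfies : ∀ {m} → Generators m → Subset → Vec Subset m → Set
  Satisfies M X As = ∀ {s v} → v ∈ Value M As s → v ∈ summand s X

  Satisfiesᴰ : ∀ {m} → Disjunction m → Subset → Vec Subset m → Set
  Satisfiesᴰ φ X As = ∀ {M} → M ∈ˡ φ → Satisfies M X As

  Value-mono : ∀ {m} (M : Generators m) {As Bs s} → (∀ i → lookup As i ⊆ lookup Bs i) →
               Value M As s ⊆ Value M Bs s
  Value-mono []      As⊆Bs v∈ = v∈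
  Value-mono (g ∷ M) As⊆Bs (w , u , s , v , 0<w , u∈ , v∈ , eqs) =
    w , u , s , v , 0<w , ⨁-mono (w ∙ g) As⊆Bs u∈ , Value-mono M As⊆Bs v∈ , eqs

  Value⇒Total : ∀ {m} (M : Generators m) {As s v} → v ∈ Value M As s → s ∈ Total M
  Value⇒Total []      (s≡0 , _) = s≡0
  Value⇒Total (g ∷ M) (w , _ , s , _ , 0<w , _ , v∈ , eq , _) = w , s , 0<w , Value⇒Total M v∈ , eq

  Value-scale : ∀ {m} (M : Generators m) {As s v k} → 0# < k → v ∈ Value M As s →
                k *ₗ v ∈ Value M As (k * s)
  Value-scale [] {k = k} 0<k (refl , refl) = zeroʳ k , *ₗ-zeroʳ k
  Value-scale (g ∷ M) {As} {k = k} 0<k (w , u , s , v , 0<w , u∈ , v∈ , refl , refl) =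
    k * w , k *ₗ u , k * s , k *ₗ v , *-pos 0<k 0<w ,
    subst (λ c → k *ₗ u ∈ ⨁ c (lookup As)) (∙-assoc k w g) (⨁-scale (w ∙ g) 0<k u∈) ,
    Value-scale M 0<k v∈ ,
    solve 4 (λ k w g s → k :* (w :* g :+ s) := k :* w :* g :+ k :* s) refl k w (sum g) s ,
    *ₗ-distribˡ k u v

  Value-++⁺ : ∀ {m} (M N : Generators m) {As s t u v} → u ∈ Value M As s → v ∈ Value N As t →
              u +ᴹ v ∈ Value (M ++ N) As (s + t)
  Value-++⁺ []      N {As} {t = t} {v = v} (refl , refl) v∈ =
    subst₂ (λ r x → x ∈ Value N As r) (sym (+-identityˡ t)) (sym (+ᴹ-identityˡ v)) v∈
  Value-++⁺ (g ∷ M) N (w , u , s , v , 0<w , u∈ , v∈ , refl , refl) v′∈ =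
    w , u , _ , _ , 0<w , u∈ , Value-++⁺ M N v∈ v′∈ , +-assoc _ s _ , +ᴹ-assoc u v _

  Value-++⁻ : ∀ {m} (M N : Generators m) {As s v} → v ∈ Value (M ++ N) As s →
              ∃ λ a → ∃ λ b → ∃ λ x → ∃ λ y →
              x ∈ Value M As a × y ∈ Value N As b × s ≡ a + b × v ≡ x +ᴹ y
  Value-++⁻ []      N {s = s} {v} v∈ =
    0# , s , 0ᴹ , v , (refl , refl) , v∈ , sym (+-identityˡ s) , sym (+ᴹ-identityˡ v)
  Value-++⁻ (g ∷ M) N (w , u , _ , _ , 0<w , u∈ , v∈ , refl , refl) with Value-++⁻ M N v∈
  ... | a , b , x , y , x∈ , y∈ , refl , refl =
    _ , b , _ , y , (w , u , a , x , 0<w , u∈ , x∈ , refl , refl) , y∈ ,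
    sym (+-assoc _ a b) , sym (+ᴹ-assoc u x y)

  *ₗ-∈-summand₀ : ∀ {s A x} → 0# ≤ s → x ∈ A → s *ₗ x ∈ summand s A
  *ₗ-∈-summand₀ {x = x} 0≤s x∈ with 0≤⇒≡0⊎0< 0≤s
  ... | inj₁ refl = inj₂ (refl , *ₗ-zeroˡ x)
  ... | inj₂ 0<s  = *ₗ-∈-summand 0<s x∈

  ⨁-scale₀ : ∀ {m s} (c : Vec Carrier m) {𝐀 v} → 0# ≤ s → v ∈ ⨁ c 𝐀 → s *ₗ v ∈ ⨁ (s ∙ c) 𝐀
  ⨁-scale₀ c {𝐀} {v} 0≤s v∈ with 0≤⇒≡0⊎0< 0≤s
  ... | inj₁ refl = subst (_∈ ⨁ (0# ∙ c) 𝐀) (sym (*ₗ-zeroˡ v)) (0∙-∈ c)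
  ... | inj₂ 0<s  = ⨁-scale c 0<s v∈

  Value-tails-free : ∀ {m} {M : Generators (suc m)} {X As s v} → NonNegativeᴳ M → occurs M ≡ false →
                     v ∈ Value (tails M) As s → v ∈ Value M (X ∷ As) s
  Value-tails-free []  eq v∈ = v∈
  Value-tails-free {M = (a ∷ c) ∷ M} {X} {As} ((0≤a ∷ _) ∷ ps) eq
    (w , u , s , v , 0<w , u∈ , v∈ , refl , refl) with occurs-∷-false (a ∷ c) M eq
  ... | ≯0 , eq′ with 0≤∧≯0⇒≡0 0≤a ≯0
  ... | refl = w , u , s , v , 0<w ,
    (0ᴹ , u , inj₂ (zeroʳ w , refl) , u∈ , sym (+ᴹ-identityˡ u)) ,
    Value-tails-free ps eq′ v∈ , cong (λ r → w * r + s) (sym (+-identityˡ (sum c))) , refl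

  -- The weights w hidden in `q` determine l = Σ w a, a being the deleted coefficients, and the same
  -- x is put into every factor. That l and q do not depend on x is what the hypothesis of `pump`
  -- demands.
  Value-tails⁺ : ∀ {m} {M : Generators (suc m)} {X As s q} → NonNegativeᴳ M →
                 q ∈ Value (tails M) As s →
                 ∃ λ l → 0# ≤ l × (∀ {x} → x ∈ X → l *ₗ x +ᴹ q ∈ Value M (X ∷ As) (l + s))
  Value-tails⁺ [] (refl , refl) =
    0# , ≤-refl , λ {x} _ → +-identityˡ 0# , trans (+ᴹ-identityʳ _) (*ₗ-zeroˡ x)
  Value-tails⁺ {M = (a ∷ c) ∷ M} {X} ((0≤a ∷ _) ∷ ps)
    (w , u , s , q , 0<w , u∈ , q∈ , refl , refl) with Value-tails⁺ {X = X} ps q∈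
  ... | l , 0≤l , rest =
    w * a + l , +-nonneg (*-nonneg (proj₁ 0<w) 0≤a) 0≤l , λ {x} x∈ →
    w , (w * a) *ₗ x +ᴹ u , _ , _ , 0<w ,
    (_ , u , *ₗ-∈-summand₀ (*-nonneg (proj₁ 0<w) 0≤a) x∈ , u∈ , refl) , rest x∈ ,
    solve 5 (λ w a c l s → w :* a :+ l :+ (w :* c :+ s) := w :* (a :+ c) :+ (l :+ s))
      refl w a (sum c) l s ,
    solveᴹ (w ∷ a ∷ l ∷ []) (x ∷ u ∷ q ∷ []) (λ { (w ∷ a ∷ l ∷ []) (x ∷ u ∷ q ∷ []) →
      (w :* a :+ l) ⊡ x ⊞ (u ⊞ q) , (w :* a) ⊡ x ⊞ u ⊞ (l ⊡ x ⊞ q) }) refl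

  -- Every generator w (a g + sum g · c) is split into its two parts; convexity collects the c-parts
  -- into one point of weight vector y c, and the g-parts form a times a point of `N`. If a = 0, the
  -- g-parts are all zero and yield no point of `N`, whose value may be empty; hence the two cases.
  Value-plug⁻ : ∀ {m} a (c : Vec Carrier m) {N As s v} → Convexᵛ As → 0# ≤ a → NonNegative c →
                NonNegativeᴳ N → v ∈ Value (List.map (plug (a ∷ c)) N) As s →
                ∃ λ y → ∃ λ p → ∃ λ q →
                y ∈ Total N × s ≡ y * (a + sum c) × v ≡ p +ᴹ q × q ∈ ⨁ (y ∙ c) (lookup As) ×
                (a ≡ 0# × p ≡ 0ᴹ ⊎ 0# < a × ∃ λ p′ → p′ ∈ Value N As y × p ≡ a *ₗ p′)
  Value-plug⁻ a c cvx 0≤a 0≤c [] (refl , refl) =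
    0# , 0ᴹ , 0ᴹ , refl , sym (zeroˡ _) , sym (+ᴹ-identityˡ 0ᴹ) , 0∙-∈ c ,
    [ (λ a≡0 → inj₁ (a≡0 , refl)) , (λ 0<a → inj₂ (0<a , 0ᴹ , (refl , refl) , sym (*ₗ-zeroʳ a))) ]′
      (0≤⇒≡0⊎0< 0≤a)
  Value-plug⁻ a c {g ∷ N} {As} cvx 0≤a 0≤c (0≤g ∷ ps) (w , u , _ , _ , 0<w , u∈ , v∈ , refl , refl)
    with Value-plug⁻ a c cvx 0≤a 0≤c ps v∈
       | ⨁-split (w ∙ a ∙ g) (w ∙ sum g ∙ c)
           (∙-nonneg (proj₁ 0<w) (∙-nonneg 0≤a 0≤g)) (∙-nonneg (proj₁ 0<w) (∙-nonneg (sum-nonneg 0≤g) 0≤c))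
           (subst (λ d → u ∈ ⨁ d (lookup As)) (∙-distribˡ w (a ∙ g) (sum g ∙ c)) u∈)
  ... | y , p , q , y∈ , refl , refl , q∈ , cases | u₁ , u₂ , u₁∈ , u₂∈ , refl =
    w * sum g + y , u₁ +ᴹ p , u₂ +ᴹ q , (w , y , 0<w , y∈ , refl) ,
    trans (cong (λ r → w * r + y * (a + sum c)) (sum-plug (a ∷ c) g))
      (solve 4 (λ w g e y → w :* (g :* e) :+ y :* e := (w :* g :+ y) :* e)
        refl w (sum g) (a + sum c) y) ,
    interchange u₁ u₂ p q ,
    subst (λ d → u₂ +ᴹ q ∈ ⨁ d (lookup As))
      (trans (cong (_⊹ y ∙ c) (∙-assoc w (sum g) c)) (sym (∙-distribʳ (w * sum g) y c)))
      (⨁-+ (w ∙ sum g ∙ c) (y ∙ c) cvx u₂∈ q∈) ,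
    first cases
    where
    first : (a ≡ 0# × p ≡ 0ᴹ ⊎ 0# < a × ∃ λ p′ → p′ ∈ Value N As y × p ≡ a *ₗ p′) →
            a ≡ 0# × u₁ +ᴹ p ≡ 0ᴹ ⊎
            0# < a × ∃ λ p′ → p′ ∈ Value (g ∷ N) As (w * sum g + y) × u₁ +ᴹ p ≡ a *ₗ p′
    first (inj₁ (refl , refl)) = inj₁ (refl , trans (+ᴹ-identityʳ u₁)
      (⨁-null (w ∙ 0# ∙ g) (∙-nonneg (proj₁ 0<w) (∙-nonneg 0≤a 0≤g))
        (trans (sum-∙ w (0# ∙ g)) (trans (cong (w *_) (trans (sum-∙ 0# g) (zeroˡ _))) (zeroʳ w))) u₁∈))
    first (inj₂ (0<a , p′ , p′∈ , refl))
      with ⨁-unscale (w ∙ g) {lookup As} {u₁} 0<a (subst (λ d → u₁ ∈ ⨁ d (lookup As))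
             (trans (∙-assoc w a g) (trans (cong (_∙ g) (*-comm w a)) (sym (∙-assoc a w g)))) u₁∈)
    ... | u′ , u′∈ , refl =
      inj₂ (0<a , u′ +ᴹ p′ , (w , u′ , y , p′ , 0<w , u′∈ , p′∈ , refl , refl) , sym (*ₗ-distribˡ a u′ p′))

  -- The point x is a sum of shares z, one for each generator g of `N` with weight ω. Every share
  -- receives the multiple ω sum g of one and the same u, and these multiples add up to y u.
  Value-plug⁺ : ∀ {m} a (c : Vec Carrier m) {N As y x w u} → Convexᵛ As → 0# ≤ a → 0# < w →
                NonNegativeᴳ N → u ∈ ⨁ (w ∙ c) (lookup As) → x ∈ Value N As y →
                (w * a) *ₗ x +ᴹ y *ₗ u ∈ Value (List.map (plug (a ∷ c)) N) As (w * (a + sum c) * y)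
  Value-plug⁺ a c {w = w} {u} cvx 0≤a 0<w [] u∈ (refl , refl) =
    zeroʳ _ , trans (cong₂ _+ᴹ_ (*ₗ-zeroʳ _) (*ₗ-zeroˡ u)) (+ᴹ-identityˡ 0ᴹ)
  Value-plug⁺ a c {g ∷ N} {As} {w = w} {u} cvx 0≤a 0<w (0≤g ∷ ps) u∈
    (ω , z , y , x , 0<ω , z∈ , x∈ , refl , refl) =
    ω * w , (w * a) *ₗ z +ᴹ (ω * sum g) *ₗ u , _ , _ , *-pos 0<ω 0<w ,
    subst (λ d → (w * a) *ₗ z +ᴹ (ω * sum g) *ₗ u ∈ ⨁ d (lookup As)) coefficients
      (⨁-+ ((w * a) ∙ ω ∙ g) ((ω * sum g) ∙ w ∙ c) cvx
        (⨁-scale₀ (ω ∙ g) (*-nonneg (proj₁ 0<w) 0≤a) z∈)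
        (⨁-scale₀ (w ∙ c) (*-nonneg (proj₁ 0<ω) (sum-nonneg 0≤g)) u∈)) ,
    Value-plug⁺ a c cvx 0≤a 0<w ps u∈ x∈ ,
    trans (solve 5 (λ w ω e g y → w :* e :* (ω :* g :+ y) := ω :* w :* (g :* e) :+ w :* e :* y)
            refl w ω (a + sum c) (sum g) y)
          (cong (λ r → ω * w * r + w * (a + sum c) * y) (sym (sum-plug (a ∷ c) g))) ,
    solveᴹ (w ∷ a ∷ ω ∷ sum g ∷ y ∷ []) (z ∷ x ∷ u ∷ [])
      (λ { (w ∷ a ∷ ω ∷ g ∷ y ∷ []) (z ∷ x ∷ u ∷ []) →
        (w :* a) ⊡ (z ⊞ x) ⊞ (ω :* g :+ y) ⊡ u ,
        (w :* a) ⊡ z ⊞ (ω :* g) ⊡ u ⊞ ((w :* a) ⊡ x ⊞ y ⊡ u) }) refl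
    where
    open ≡-Reasoning
    coefficients : (w * a) ∙ ω ∙ g ⊹ (ω * sum g) ∙ w ∙ c ≡ (ω * w) ∙ plug (a ∷ c) g
    coefficients = begin
      (w * a) ∙ ω ∙ g ⊹ (ω * sum g) ∙ w ∙ c
        ≡⟨ cong₂ _⊹_ (∙-assoc (w * a) ω g) (∙-assoc (ω * sum g) w c) ⟩
      (w * a * ω) ∙ g ⊹ (ω * sum g * w) ∙ c
        ≡⟨ cong₂ (λ r t → r ∙ g ⊹ t ∙ c)
             (solve 3 (λ w a o → w :* a :* o := o :* w :* a) refl w a ω)
             (solve 3 (λ o g w → o :* g :* w := o :* w :* g) refl ω (sum g) w) ⟩
      (ω * w * a) ∙ g ⊹ (ω * w * sum g) ∙ c
        ≡⟨ cong₂ _⊹_ (∙-assoc (ω * w) a g) (∙-assoc (ω * w) (sum g) c) ⟨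
      (ω * w) ∙ a ∙ g ⊹ (ω * w) ∙ sum g ∙ c
        ≡⟨ ∙-distribˡ (ω * w) (a ∙ g) (sum g ∙ c) ⟨
      (ω * w) ∙ plug (a ∷ c) g ∎

  -- `Value-plug⁻` exhibits in each factor a multiple a p′ with p′ in the cone of `N` at weight y.
  -- As X satisfies `N`, p′ lies in y X, so a p′ is the summand of X that the original factor
  -- requires at weight y.
  Value-substitute⁻ : ∀ {m} {N : Generators m} {M X As s v} → Convex X → Convexᵛ As → Proper N →
                      NonNegativeᴳ M → Satisfies N X As → v ∈ Value (substitute N M) As s →
                      v ∈ Value M (X ∷ As) s
  Value-substitute⁻ cX cvx pN [] sat v∈ = v∈
  Value-substitute⁻ {N = N} {(a ∷ c) ∷ M} {X} {As} cX cvx pN ((0≤a ∷ 0≤c) ∷ ps) sat v∈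
    with Value-++⁻ (List.map (plug (a ∷ c)) N) (substitute N M) v∈
  ... | _ , b , _ , z , x∈ , z∈ , refl , refl with Value-plug⁻ a c cvx 0≤a 0≤c (nonneg pN) x∈
  ... | y , p , q , y∈ , refl , refl , q∈ , cases =
    y , _ , b , z , positive pN y∈ , (p , q , p∈ cases , q∈ , refl) ,
    Value-substitute⁻ cX cvx pN ps sat z∈ , refl , refl
    where
    p∈ : (a ≡ 0# × p ≡ 0ᴹ ⊎ 0# < a × ∃ λ p′ → p′ ∈ Value N As y × p ≡ a *ₗ p′) →
         p ∈ summand (y * a) X
    p∈ (inj₁ (refl , refl))            = inj₂ (zeroʳ y , refl)
    p∈ (inj₂ (0<a , p′ , p′∈ , refl)) =
      subst (λ r → a *ₗ p′ ∈ summand r X) (*-comm a y) (summand-scale 0<a (sat p′∈))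

  -- By convexity, all occurrences of the first indeterminate are gathered in one point `p` of
  -- weight `l`. The field `replace` belongs to the record because it reuses the weights from which
  -- `l` and `q` arose, and these are not recoverable from the two.
  record Split {m} (M : Generators (suc m)) (X : Subset) (As : Vec Subset m) s v : Set where
    field
      l σ       : Carrier
      p q       : Carrierᴹ
      s≡l+σ     : s ≡ l + σ
      v≡p+q     : v ≡ p +ᴹ q
      p∈        : p ∈ summand l X
      q∈        : q ∈ Value (tails M) As σ
      occurring : occurs M ≡ true → 0# < l
      replace   : ∀ {N x} → NonNegativeᴳ N → x ∈ Value N As 1# →
                  l *ₗ x +ᴹ q ∈ Value (substitute N M) As (l + σ)

  split : ∀ {m} {M : Generators (suc m)} {X As s v} → Convex X → Convexᵛ As → NonNegativeᴳ M →
          v ∈ Value M (X ∷ As) s → Split M X As s v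
  split cX cvx [] (refl , refl) = record
    { l = 0# ; σ = 0# ; p = 0ᴹ ; q = 0ᴹ ; s≡l+σ = sym (+-identityˡ 0#) ; v≡p+q = sym (+ᴹ-identityˡ 0ᴹ)
    ; p∈ = inj₂ (refl , refl) ; q∈ = refl , refl ; occurring = λ ()
    ; replace = λ {_} {x} _ _ → +-identityˡ 0# , trans (+ᴹ-identityʳ _) (*ₗ-zeroˡ x) }
  split {M = (a ∷ c) ∷ M} {X} {As} cX cvx ((0≤a ∷ 0≤c) ∷ ps)
    (w , _ , _ , _ , 0<w , (u₁ , u₂ , u₁∈ , u₂∈ , refl) , v∈ , refl , refl)
    with split {X = X} cX cvx ps v∈
  ... | record { l = l ; σ = σ ; p = p ; q = q ; s≡l+σ = refl ; v≡p+q = refl ; p∈ = p∈ ; q∈ = q∈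
               ; occurring = occurring ; replace = replace } = record
    { l = w * a + l ; σ = w * sum c + σ ; p = u₁ +ᴹ p ; q = u₂ +ᴹ q
    ; s≡l+σ = solve 5 (λ w a c l s → w :* (a :+ c) :+ (l :+ s) := w :* a :+ l :+ (w :* c :+ s))
                refl w a (sum c) l σ
    ; v≡p+q = interchange u₁ u₂ p q
    ; p∈ = summand-+ cX u₁∈ p∈
    ; q∈ = w , u₂ , σ , q , 0<w , u₂∈ , q∈ , refl , refl
    ; occurring = λ eq → [ (λ 0<a → +-posˡ (*-pos 0<w 0<a) (summand-nonneg p∈)) ,
                           (λ eq′ → +-posʳ (*-nonneg (proj₁ 0<w) 0≤a) (occurring eq′)) ]′
                         (occurs-∷-true (a ∷ c) M eq)
    ; replace = λ {N} {x} 0≤N x∈ → subst₂ (λ r z → z ∈ Value (substitute N ((a ∷ c) ∷ M)) As r)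
        (solve 5 (λ w a c l s → w :* (a :+ c) :* con 1 :+ (l :+ s) := w :* a :+ l :+ (w :* c :+ s))
          refl w a (sum c) l σ)
        (solveᴹ (w ∷ a ∷ l ∷ []) (x ∷ u₂ ∷ q ∷ []) (λ { (w ∷ a ∷ l ∷ []) (x ∷ u ∷ q ∷ []) →
          ((w :* a) ⊡ x ⊞ con 1 ⊡ u) ⊞ (l ⊡ x ⊞ q) , (w :* a :+ l) ⊡ x ⊞ (u ⊞ q) }) refl)
        (Value-++⁺ (List.map (plug (a ∷ c)) N) (substitute N M)
          (Value-plug⁺ a c cvx 0≤a 0<w 0≤N u₂∈ x∈) (replace 0≤N x∈)) }

  -- A point of A with weight α is α x for some x ∈ X. Closure under M, applied repeatedly, then
  -- allows x to be mixed with M′ in any positive proportion.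
  eliminant-necessary : ∀ {m} {φ : Disjunction (suc m)} {X As} → Convex X → Convexᵛ As → Properᴰ φ →
                        Satisfiesᴰ φ X (X ∷ As) → Satisfiesᴰ (eliminant φ) X As
  eliminant-necessary {φ = φ} {X} {As} cX cvx pφ sat N∈ = [ free , joined ]′ (∈-++⁻ (withoutFirst φ) N∈)
    where
    free : ∀ {N} → N ∈ˡ withoutFirst φ → Satisfies N X As
    free N∈ v∈ with ∈-withoutFirst⁻ φ N∈
    ... | M , M∈ , eq , refl = sat M∈ (Value-tails-free (nonneg (pφ M∈)) eq v∈)

    -- For l > 0 this is `pump`. For l = 0 the monomial places q in β X at once, and convexity adds
    -- α x.
    extend : ∀ {M x q α β} → M ∈ˡ φ → x ∈ X → 0# < α → q ∈ Value (tails M) As β →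
             α *ₗ x +ᴹ q ∈ summand (α + β) X
    extend {M} {x} {q} {α} {β} M∈ x∈ 0<α q∈ with Value-tails⁺ {X = X} (nonneg (pφ M∈)) q∈
    ... | l , 0≤l , along = [ none , some ]′ (0≤⇒≡0⊎0< 0≤l)
      where
      some : 0# < l → α *ₗ x +ᴹ q ∈ summand (α + β) X
      some 0<l = pump cX x∈ 0<l
        (Total-nonneg (tails-nonneg (nonneg (pφ M∈))) (Value⇒Total (tails M) q∈))
        (λ y∈ → sat M∈ (along y∈)) 0<α
      none : l ≡ 0# → α *ₗ x +ᴹ q ∈ summand (α + β) X
      none refl = summand-+ cX (*ₗ-∈-summand 0<α x∈)
        (subst₂ (λ r v → v ∈ summand r X) (+-identityˡ β)
          (trans (cong (_+ᴹ q) (*ₗ-zeroˡ x)) (+ᴹ-identityˡ q)) (sat M∈ (along x∈)))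

    joined : ∀ {N} → N ∈ˡ cartesianProductWith _joinTails_ (withoutFirst φ) φ → Satisfies N X As
    joined N∈ v∈ with ∈-cartesianProductWith⁻ _joinTails_ (withoutFirst φ) φ N∈
    ... | A , M , A∈ , M∈ , refl with Value-++⁻ A (tails M) v∈
    ... | α , β , p , q , p∈ , q∈ , refl , refl
      with positive (withoutFirst-proper pφ A∈) (Value⇒Total A p∈)
    ... | 0<α with summand-pos⁻ 0<α (free A∈ p∈)
    ... | x , x∈ , refl = extend M∈ x∈ 0<α q∈

  -- A point of a substituted monomial is a point of the original monomial, because X contains
  -- whatever was substituted for it.
  reduce-necessary : ∀ {m} {Y} {φ : Disjunction (suc m)} {X Z As} → Convex X → Convexᵛ As →
                     Properᴰ Y → Properᴰ φ → Satisfiesᴰ Y X As → Satisfiesᴰ φ Z (X ∷ As) →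
                     Satisfiesᴰ (reduce Y φ) Z As
  reduce-necessary {Y = Y} {φ} cX cvx pY pφ satY sat N∈ v∈ with ∈-++⁻ (withoutFirst φ) N∈
  ... | inj₁ N∈ˡ with ∈-withoutFirst⁻ φ N∈ˡ
  ... | M , M∈ , eq , refl = sat M∈ (Value-tails-free (nonneg (pφ M∈)) eq v∈)
  reduce-necessary {Y = Y} {φ} cX cvx pY pφ satY sat N∈ v∈ | inj₂ N∈ʳ
    with ∈-cartesianProductWith⁻ substitute Y φ N∈ʳ
  ... | N , M , N∈Y , M∈ , refl =
    sat M∈ (Value-substitute⁻ cX cvx (pY N∈Y) (nonneg (pφ M∈)) (satY N∈Y) v∈)

  Valueᴰ : ∀ {m} → Disjunction m → Vec Subset m → Subset
  Valueᴰ Y As x = ∃ λ N → N ∈ˡ Y × x ∈ Value N As 1#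

  module _ {m} {As : Vec Subset m} {X} (Y : Disjunction m) (cX : Convex X) (cvx : Convexᵛ As)
           (pY : Properᴰ Y) (X≐ : X ≐ conv (Valueᴰ Y As)) where

    satisfies-hull : Satisfiesᴰ Y X As
    satisfies-hull {N} N∈ {s} {v} v∈ with reciprocal (positive (pY N∈) (Value⇒Total N v∈))
    ... | κ , sκ≡1 , 0<κ = inj₁ (positive (pY N∈) (Value⇒Total N v∈) , κ *ₗ v ,
      proj₂ X≐ (incl (N , N∈ , subst (λ r → κ *ₗ v ∈ Value N As r) (trans (*-comm κ s) sκ≡1)
                                 (Value-scale N 0<κ v∈))) ,
      trans (sym (*ₗ-identityˡ v)) (trans (cong (_*ₗ v) (sym sκ≡1)) (*ₗ-assoc s κ v)))

    -- Write the share of X in a point of M as l x with x in the hull. As x ↦ l x + q is affine, x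
    -- may be assumed to lie in a single monomial of `Y`. If l = 0, then M does not contain X and
    -- its tails suffice. `Z` is X itself for the inequality of X, and another variable for the
    -- remaining inequalities.
    satisfies-by-replacing : ∀ {M Z} → Convex Z → NonNegativeᴳ M →
      (occurs M ≡ false → Satisfies (tails M) Z As) →
      (∀ {N x q l σ} → N ∈ˡ Y → x ∈ Value N As 1# → 0# < l → q ∈ Value (tails M) As σ →
        l *ₗ x +ᴹ q ∈ Value (substitute N M) As (l + σ) → l *ₗ x +ᴹ q ∈ summand (l + σ) Z) →
      Satisfies M Z (X ∷ As)
    satisfies-by-replacing {M} {Z} cZ 0≤M free replaced v∈ with split {X = X} cX cvx 0≤M v∈
    ... | record { l = l ; σ = σ ; p = p ; q = q ; s≡l+σ = refl ; v≡p+q = refl ; p∈ = p∈ ; q∈ = q∈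
                 ; occurring = occurring ; replace = replace } =
      [ none , some ]′ (0≤⇒≡0⊎0< (summand-nonneg p∈))
      where
      not-occurring : l ≡ 0# → occurs M ≡ false
      not-occurring l≡0 with occurs M
      ... | false = refl
      ... | true  = ⊥-elim (proj₂ (occurring refl) (sym l≡0))
      none : l ≡ 0# → p +ᴹ q ∈ summand (l + σ) Z
      none l≡0 = subst₂ (λ r v → v ∈ summand r Z)
        (trans (sym (+-identityˡ σ)) (cong (_+ σ) (sym l≡0)))
        (trans (sym (+ᴹ-identityˡ q))
          (cong (_+ᴹ q) (sym (summand-0⁻ (subst (λ r → p ∈ summand r X) l≡0 p∈)))))
        (free (not-occurring l≡0) q∈)
      some : 0# < l → p +ᴹ q ∈ summand (l + σ) Z
      some 0<l with summand-pos⁻ 0<l p∈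
      ... | x , x∈ , refl = conv-affine cZ
        (+-nonneg (proj₁ 0<l) (Total-nonneg (tails-nonneg 0≤M) (Value⇒Total (tails M) q∈)))
        (λ (N , N∈ , y∈) → replaced N∈ y∈ 0<l q∈ (replace (nonneg (pY N∈)) y∈))
        (proj₁ X≐ x∈)

    reduce-sufficient : ∀ {φ Z} → Convex Z → Properᴰ φ → Satisfiesᴰ (reduce Y φ) Z As →
                        Satisfiesᴰ φ Z (X ∷ As)
    reduce-sufficient {φ} cZ pφ sat M∈ = satisfies-by-replacing cZ (nonneg (pφ M∈))
      (λ eq → sat (∈-++⁺ˡ (∈-withoutFirst⁺ M∈ eq)))
      (λ N∈ x∈ 0<l q∈ v∈ → sat (∈-++⁺ʳ (withoutFirst φ) (∈-cartesianProductWith⁺ substitute N∈ M∈)) v∈)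

  eliminant-sufficient : ∀ {m} {φ : Disjunction (suc m)} {X As} → Convex X → Convexᵛ As → Properᴰ φ →
                         X ≐ conv (Valueᴰ (eliminant φ) As) → Satisfiesᴰ φ X (X ∷ As)
  eliminant-sufficient {φ = φ} {X} {As} cX cvx pφ X≐ M∈ =
    satisfies-by-replacing Y cX cvx pY X≐ cX (nonneg (pφ M∈))
      (λ eq → sat (∈-++⁺ˡ (∈-withoutFirst⁺ M∈ eq)))
      -- Here l x + q has to be found in X again: for x in A it is a point of A ⋆ M′, and for x in a
      -- join it is a sum of two points of joins.
      (λ N∈ x∈ 0<l q∈ _ → [ (λ A∈ → free A∈ M∈ 0<l x∈ q∈) , (λ N∈ʳ → joined N∈ʳ M∈ 0<l x∈ q∈) ]′
                           (∈-++⁻ (withoutFirst φ) N∈))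
    where
    Y   = eliminant φ
    pY  = eliminant-proper pφ
    sat : Satisfiesᴰ Y X As
    sat = satisfies-hull Y cX cvx pY X≐

    mixed : ∀ {A M x q l σ} → A ∈ˡ withoutFirst φ → M ∈ˡ φ → x ∈ Value A As l →
            q ∈ Value (tails M) As σ → x +ᴹ q ∈ summand (l + σ) X
    mixed {A} {M} A∈ M∈ x∈ q∈ =
      sat (∈-++⁺ʳ (withoutFirst φ) (∈-cartesianProductWith⁺ _joinTails_ A∈ M∈)) (Value-++⁺ A (tails M) x∈ q∈)

    free : ∀ {A M x q l σ} → A ∈ˡ withoutFirst φ → M ∈ˡ φ → 0# < l → x ∈ Value A As 1# →
           q ∈ Value (tails M) As σ → l *ₗ x +ᴹ q ∈ summand (l + σ) X
    free {A} {l = l} A∈ M∈ 0<l x∈ q∈ = mixed A∈ M∈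
      (subst (λ r → l *ₗ _ ∈ Value A As r) (*-identityʳ l) (Value-scale A 0<l x∈)) q∈

    -- With x = p + r split along A ++ tails M′, half of p accompanies r and the
    -- other half accompanies q.
    joined : ∀ {N M x q l σ} → N ∈ˡ cartesianProductWith _joinTails_ (withoutFirst φ) φ → M ∈ˡ φ →
             0# < l → x ∈ Value N As 1# → q ∈ Value (tails M) As σ → l *ₗ x +ᴹ q ∈ summand (l + σ) X
    joined {q = q} {l} {σ} N∈ M∈ 0<l x∈ q∈ with ∈-cartesianProductWith⁻ _joinTails_ (withoutFirst φ) φ N∈
    ... | A , M′ , A∈ , M′∈ , refl with Value-++⁻ A (tails M′) x∈ | half
    ... | a , b , p , r , p∈ , r∈ , a+b≡1 , refl | h , h+h≡1 , 0<h =
      subst₂ (λ s v → v ∈ summand s X) weight point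
        (summand-+ cX
          (mixed A∈ M′∈ (Value-scale A (*-pos 0<h 0<l) p∈) (Value-scale (tails M′) 0<l r∈))
          (mixed A∈ M∈ (Value-scale A (*-pos 0<h 0<l) p∈) q∈))
      where
      open ≡-Reasoning
      weight : h * l * a + l * b + (h * l * a + σ) ≡ l + σ
      weight = begin
        h * l * a + l * b + (h * l * a + σ)
          ≡⟨ solve 5 (λ h l a b s → h :* l :* a :+ l :* b :+ (h :* l :* a :+ s) :=
                                    (h :+ h) :* (l :* a) :+ l :* b :+ s) refl h l a b σ ⟩
        (h + h) * (l * a) + l * b + σ ≡⟨ cong (λ t → t * (l * a) + l * b + σ) h+h≡1 ⟩
        1# * (l * a) + l * b + σ      ≡⟨ solve 4 (λ l a b s → con 1 :* (l :* a) :+ l :* b :+ s :=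
                                                              l :* (a :+ b) :+ s) refl l a b σ ⟩
        l * (a + b) + σ               ≡⟨ cong (λ t → l * t + σ) a+b≡1 ⟨
        l * 1# + σ                    ≡⟨ cong (_+ σ) (*-identityʳ l) ⟩
        l + σ                         ∎
      point : (h * l) *ₗ p +ᴹ l *ₗ r +ᴹ ((h * l) *ₗ p +ᴹ q) ≡ l *ₗ (p +ᴹ r) +ᴹ q
      point = begin
        (h * l) *ₗ p +ᴹ l *ₗ r +ᴹ ((h * l) *ₗ p +ᴹ q)
          ≡⟨ solveᴹ (h ∷ l ∷ []) (p ∷ r ∷ q ∷ []) (λ { (h ∷ l ∷ []) (p ∷ r ∷ q ∷ []) →
               (h :* l) ⊡ p ⊞ l ⊡ r ⊞ ((h :* l) ⊡ p ⊞ q) ,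
               ((h :+ h) :* l) ⊡ p ⊞ l ⊡ r ⊞ q }) refl ⟩
        ((h + h) * l) *ₗ p +ᴹ l *ₗ r +ᴹ q
          ≡⟨ cong (λ t → (t * l) *ₗ p +ᴹ l *ₗ r +ᴹ q) h+h≡1 ⟩
        (1# * l) *ₗ p +ᴹ l *ₗ r +ᴹ q
          ≡⟨ solveᴹ (l ∷ []) (p ∷ r ∷ q ∷ []) (λ { (l ∷ []) (p ∷ r ∷ q ∷ []) →
               (con 1 :* l) ⊡ p ⊞ l ⊡ r ⊞ q , l ⊡ (p ⊞ r) ⊞ q }) refl ⟩
        l *ₗ (p +ᴹ r) +ᴹ q ∎

-- Evaluation and back-substitution

module Solving (em : ExcludedMiddle (lsuc 0ℓ)) (ℝ : RealNumbers)
               (V : FiniteDimensionalVectorSpace ℝ) where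
  open import Function.Base using (id)
  open RealNumbers ℝ
  open FiniteDimensionalVectorSpace V
  open OrderedField em ℝ
  open CoefficientVectors em ℝ
  open LinearSolver em ℝ V
  open Geometry ℝ V
  open Syntax ℝ
  open ConvexSets em ℝ V
  open Elimination em ℝ
  open EliminationCorrectness em ℝ V
  open Scalar using (solve; con; _:+_; _:*_; _:=_)

  -- Abstract carrier of the solution term, interpreted by `⟪_⟫`. The laws are propositional
  -- equalities because in both instances the interpretation commutes with the operations
  -- definitionally. There is no object for {0}, since the family need not contain it.
  record SetAlgebra o : Set (lsuc 0ℓ ⊔ lsuc o) where
    infixr 6 _∪ᵒ_ _⊕ᵒ_ _⋆ᵒ_
    field
      Obj            : Set o
      ⟪_⟫            : Obj → Subset
      ∅ᵒ             : Obj
      _∪ᵒ_ _⊕ᵒ_ _⋆ᵒ_ : Obj → Obj → Obj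
      scaleᵒ         : ∀ ρ → 0# ≤ ρ → Obj → Obj
      convᵒ          : Obj → Obj
      ⟪∅⟫            : ⟪ ∅ᵒ ⟫ ≡ ∅
      ⟪∪⟫            : ∀ a b → ⟪ a ∪ᵒ b ⟫ ≡ ⟪ a ⟫ ∪ ⟪ b ⟫
      ⟪⊕⟫            : ∀ a b → ⟪ a ⊕ᵒ b ⟫ ≡ ⟪ a ⟫ ⊕ ⟪ b ⟫
      ⟪⋆⟫            : ∀ a b → ⟪ a ⋆ᵒ b ⟫ ≡ ⟪ a ⟫ ⋆ ⟪ b ⟫
      ⟪scale⟫        : ∀ ρ 0≤ρ a → ⟪ scaleᵒ ρ 0≤ρ a ⟫ ≡ ρ · ⟪ a ⟫
      ⟪conv⟫         : ∀ a → ⟪ convᵒ a ⟫ ≡ conv ⟪ a ⟫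

  Cone : Subset → Carrier → Subset
  Cone A s v = 0# < s × v ∈ s · A

  -- The positive join is addition of open cones: s a + t b is s + t times the mixture of a and b
  -- with parameter s / (s + t), which lies strictly between 0 and 1.
  ⋆-cone⁺ : ∀ {A B s t x y} → x ∈ Cone A s → y ∈ Cone B t → x +ᴹ y ∈ Cone (A ⋆ B) (s + t)
  ⋆-cone⁺ {s = s} {t} (0<s , a , a∈ , refl) (0<t , b , b∈ , refl)
    with reciprocal (+-posˡ 0<s (proj₁ 0<t))
  ... | κ , inv , 0<κ =
    +-posˡ 0<s (proj₁ 0<t) , _ , (s * κ , a , b , *-pos 0<s 0<κ , sκ<1 , a∈ , b∈ , refl) , point
    where
    open ≡-Reasoning
    tκ : t * κ ≡ 1# - s * κ
    tκ = begin
      t * κ                       ≡⟨ x+[y-x]≡y (s * κ) (t * κ) ⟨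
      s * κ + (t * κ - s * κ)     ≡⟨ +-assoc (s * κ) (t * κ) _ ⟨
      s * κ + t * κ - s * κ       ≡⟨ cong (_- s * κ) (trans (sym (distribʳ κ s t)) inv) ⟩
      1# - s * κ                  ∎
    sκ<1 : s * κ < 1#
    sκ<1 = subst (s * κ ≤_) (trans (sym (distribʳ κ s t)) inv) (x≤x+y _ (proj₁ (*-pos 0<t 0<κ))) ,
      λ sκ≡1 → proj₂ (*-pos 0<t 0<κ) (sym (trans tκ (trans (cong (λ r → 1# - r) sκ≡1) (-‿inverseʳ 1#))))
    point : s *ₗ a +ᴹ t *ₗ b ≡ (s + t) *ₗ ((s * κ) *ₗ a +ᴹ (1# - s * κ) *ₗ b)
    point = begin
      s *ₗ a +ᴹ t *ₗ b                                        ≡⟨ *ₗ-identityˡ _ ⟨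
      1# *ₗ (s *ₗ a +ᴹ t *ₗ b)                                ≡⟨ cong (_*ₗ _) inv ⟨
      ((s + t) * κ) *ₗ (s *ₗ a +ᴹ t *ₗ b)
        ≡⟨ solveᴹ (s ∷ t ∷ κ ∷ []) (a ∷ b ∷ []) (λ { (s ∷ t ∷ k ∷ []) (a ∷ b ∷ []) →
             ((s :+ t) :* k) ⊡ (s ⊡ a ⊞ t ⊡ b) , (s :+ t) ⊡ ((s :* k) ⊡ a ⊞ (t :* k) ⊡ b) }) refl ⟩
      (s + t) *ₗ ((s * κ) *ₗ a +ᴹ (t * κ) *ₗ b)
        ≡⟨ cong (λ r → (s + t) *ₗ ((s * κ) *ₗ a +ᴹ r *ₗ b)) tκ ⟩
      (s + t) *ₗ ((s * κ) *ₗ a +ᴹ (1# - s * κ) *ₗ b)          ∎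

  ⋆-cone⁻ : ∀ {A B s v} → v ∈ Cone (A ⋆ B) s → ∃ λ a → ∃ λ b → ∃ λ x → ∃ λ y →
            x ∈ Cone A a × y ∈ Cone B b × s ≡ a + b × v ≡ x +ᴹ y
  ⋆-cone⁻ {s = s} (0<s , _ , (t , a , b , 0<t , t<1 , a∈ , b∈ , refl) , refl) =
    s * t , s * (1# - t) , (s * t) *ₗ a , (s * (1# - t)) *ₗ b ,
    (*-pos 0<s 0<t , a , a∈ , refl) , (*-pos 0<s 0<1-t , b , b∈ , refl) ,
    trans (sym (*-identityʳ s)) (trans (cong (s *_) (sym (x+[y-x]≡y t 1#))) (distribˡ s t (1# - t))) ,
    solveᴹ (s ∷ t ∷ 1# - t ∷ []) (a ∷ b ∷ []) (λ { (s ∷ t ∷ r ∷ []) (a ∷ b ∷ []) →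
      s ⊡ (t ⊡ a ⊞ r ⊡ b) , (s :* t) ⊡ a ⊞ (s :* r) ⊡ b }) refl
    where
    0<1-t : 0# < 1# - t
    0<1-t = ≤⇒0≤- (proj₁ t<1) , λ 0≡1-t → proj₂ t<1
      (trans (sym (+-identityʳ t)) (trans (cong (t +_) 0≡1-t) (x+[y-x]≡y t 1#)))

  merge : ∀ {a} {A : Set a} → (A → A → A) → Maybe A → Maybe A → Maybe A
  merge _∘_ x y = maybe′ (λ a → just (maybe′ (a ∘_) a y)) y x

  positiveInverse : Carrier → Carrier
  positiveInverse x with decide (0# < x)
  ... | yes 0<x = proj₁ (reciprocal 0<x)
  -- With the default 0, `scaled` answers `nothing`, which is the right value of a null generator.
  ... | no  _   = 0#

  module Evaluation {o} (𝒜 : SetAlgebra o) where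
    open SetAlgebra 𝒜

    scaled : Carrier → Obj → Maybe Obj
    scaled a A with decide (0# < a)
    ... | yes 0<a = just (scaleᵒ a (proj₁ 0<a) A)
    ... | no  _   = nothing

    combine : ∀ {m} → Vec Carrier m → Vec Obj m → Maybe Obj
    combine []      []       = nothing
    combine (a ∷ c) (A ∷ As) = merge _⊕ᵒ_ (scaled a A) (combine c As)

    -- The only place where generators are normalised; the elimination itself carries them up to
    -- positive factors.
    evalGenerator : ∀ {m} → Vec Obj m → Vec Carrier m → Maybe Obj
    evalGenerator As g = maybe′ (scaled (positiveInverse (sum g))) nothing (combine g As)

    evalGenerators : ∀ {m} → Vec Obj m → Generators m → Maybe Obj
    evalGenerators As = List.foldr (λ g → merge _⋆ᵒ_ (evalGenerator As g)) nothing

    evalDisjunction : ∀ {m} → Vec Obj m → Disjunction m → Obj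
    evalDisjunction As = List.foldr (λ M B → maybe′ (_∪ᵒ B) B (evalGenerators As M)) ∅ᵒ

    solveSystem : ∀ {n k} → Vec (Disjunction (n +ⁿ k)) n → Vec Obj k → Vec Obj n
    solveSystem []       Ps = []
    solveSystem (φ ∷ φs) Ps = convᵒ (evalDisjunction (Xs Vec.++ Ps) (eliminant φ)) ∷ Xs
      where Xs = solveSystem (Vec.map (reduce (eliminant φ)) φs) Ps

    ⟪_⟫ᵛ : ∀ {m} → Vec Obj m → Vec Subset m
    ⟪_⟫ᵛ = Vec.map ⟪_⟫

    -- The neutral element of Minkowski sums and of sums of cones need not
    -- belong to the algebra; nothing stands for it.
    Sumᴹ : Maybe Obj → Subset
    Sumᴹ nothing  = ｛ 0ᴹ ｝
    Sumᴹ (just A) = ⟪ A ⟫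

    Coneᴹ : Maybe Obj → Carrier → Subset
    Coneᴹ nothing  s v = s ≡ 0# × v ≡ 0ᴹ
    Coneᴹ (just A) s v = v ∈ Cone ⟪ A ⟫ s

    scaled-≐ : ∀ {a} A → 0# ≤ a → Sumᴹ (scaled a A) ≐ summand a ⟪ A ⟫
    scaled-≐ {a} A 0≤a with decide (0# < a)
    ... | yes 0<a rewrite ⟪scale⟫ a (proj₁ 0<a) A = (λ v∈ → inj₁ (0<a , v∈)) , summand-pos⁻ 0<a
    ... | no  a≯0 with 0≤∧≯0⇒≡0 0≤a a≯0
    ...   | refl = (λ 0≡v → inj₂ (refl , sym 0≡v)) , sym ∘ summand-0⁻

    merge-⊕ : ∀ a b → Sumᴹ (merge _⊕ᵒ_ a b) ≐ Sumᴹ a ⊕ Sumᴹ b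
    merge-⊕ nothing  b =
      (λ {v} v∈ → 0ᴹ , v , refl , v∈ , sym (+ᴹ-identityˡ v)) ,
      λ { (_ , v , refl , v∈ , refl) → subst (_∈ Sumᴹ b) (sym (+ᴹ-identityˡ v)) v∈ }
    merge-⊕ (just A) nothing =
      (λ {v} v∈ → v , 0ᴹ , v∈ , refl , sym (+ᴹ-identityʳ v)) ,
      λ { (v , _ , v∈ , refl , refl) → subst (_∈ ⟪ A ⟫) (sym (+ᴹ-identityʳ v)) v∈ }
    merge-⊕ (just A) (just B) rewrite ⟪⊕⟫ A B = id , id

    ⊕-cong : ∀ {A A′ B B′} → A ≐ A′ → B ≐ B′ → A ⊕ B ≐ A′ ⊕ B′
    ⊕-cong A≐ B≐ =
      (λ (a , b , a∈ , b∈ , eq) → a , b , proj₁ A≐ a∈ , proj₁ B≐ b∈ , eq) ,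
      (λ (a , b , a∈ , b∈ , eq) → a , b , proj₂ A≐ a∈ , proj₂ B≐ b∈ , eq)

    combine-≐ : ∀ {m} (c : Vec Carrier m) As → NonNegative c →
                Sumᴹ (combine c As) ≐ ⨁ c (lookup ⟪ As ⟫ᵛ)
    combine-≐ []      []       []       = id , id
    combine-≐ (a ∷ c) (A ∷ As) (p ∷ ps) =
      ≐-trans (merge-⊕ (scaled a A) (combine c As)) (⊕-cong (scaled-≐ A p) (combine-≐ c As ps))

    positiveInverse-pos : ∀ {x} → 0# < x → x * positiveInverse x ≡ 1# × 0# < positiveInverse x
    positiveInverse-pos {x} 0<x with decide (0# < x)
    ... | yes p = proj₂ (reciprocal p)
    ... | no ¬p = ⊥-elim (¬p 0<x)

    positiveInverse-0 : positiveInverse 0# ≡ 0#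
    positiveInverse-0 with decide (0# < 0#)
    ... | yes p = ⊥-elim (0≮0 p)
    ... | no _  = refl

    scaled-0 : ∀ A → scaled 0# A ≡ nothing
    scaled-0 A with decide (0# < 0#)
    ... | yes p = ⊥-elim (0≮0 p)
    ... | no _  = refl

    scaled-pos : ∀ {a} A → 0# < a → ∃ λ B → scaled a A ≡ just B × ⟪ B ⟫ ≡ a · ⟪ A ⟫
    scaled-pos {a} A 0<a with decide (0# < a)
    ... | yes p = _ , refl , ⟪scale⟫ a (proj₁ p) A
    ... | no ¬p = ⊥-elim (¬p 0<a)

    merge≡nothing : ∀ {f} {a b : Maybe Obj} → merge f a b ≡ nothing → a ≡ nothing × b ≡ nothing
    merge≡nothing {a = nothing} eq = refl , eq
    merge≡nothing {a = just _} {nothing} ()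
    merge≡nothing {a = just _} {just _} ()

    combine-nothing : ∀ {m} (c : Vec Carrier m) As → NonNegative c → combine c As ≡ nothing → sum c ≡ 0#
    combine-nothing []      []       []       eq = refl
    combine-nothing (a ∷ c) (A ∷ As) (p ∷ ps) eq with merge≡nothing {a = scaled a A} eq
    ... | eqˡ , eqʳ = trans (cong₂ _+_ (vanishes (0≤⇒≡0⊎0< p)) (combine-nothing c As ps eqʳ)) (+-identityˡ 0#)
      where
      vanishes : a ≡ 0# ⊎ 0# < a → a ≡ 0#
      vanishes (inj₁ a≡0) = a≡0
      vanishes (inj₂ 0<a) with scaled-pos A 0<a
      ... | B , eq′ , _ with trans (sym eqˡ) eq′
      ...   | ()

    module _ {m} (As : Vec Obj m) where

      private 𝐀 = lookup ⟪ As ⟫ᵛ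

      Multiple : Vec Carrier m → Carrier → Subset
      Multiple g s v = ∃ λ w → 0# < w × v ∈ ⨁ (w ∙ g) 𝐀 × s ≡ w * sum g

      evalGenerator-null : ∀ g → sum g ≡ 0# → evalGenerator As g ≡ nothing
      evalGenerator-null g sum≡0 with combine g As
      ... | nothing = refl
      ... | just A  = trans (cong (λ r → scaled r A) (trans (cong positiveInverse sum≡0) positiveInverse-0))
                            (scaled-0 A)

      evalGenerator-pos : ∀ g → NonNegative g → 0# < sum g → ∃ λ B →
                          evalGenerator As g ≡ just B × ⟪ B ⟫ ≐ (positiveInverse (sum g) · ⨁ g 𝐀)
      evalGenerator-pos g 0≤g 0<sum with combine g As in eq
      ... | nothing = ⊥-elim (proj₂ 0<sum (sym (combine-nothing g As 0≤g eq)))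
      ... | just A with scaled-pos A (proj₂ (positiveInverse-pos 0<sum))
                      | subst (λ c → Sumᴹ c ≐ ⨁ g 𝐀) eq (combine-≐ g As 0≤g)
      ...   | B , eq′ , set | A≐ = B , eq′ ,
        (λ b∈ → let (x , x∈ , v≡) = subst (_ ∈_) set b∈ in x , proj₁ A≐ x∈ , v≡) ,
        (λ { {v} (x , x∈ , v≡) → subst (λ S → v ∈ S) (sym set) (x , proj₂ A≐ x∈ , v≡) })

      -- A null generator leaves only the apex on either side. Otherwise the height s in the cone
      -- and the weight w of the generator determine each other by s = w · sum g.
      evalGenerator-cone : ∀ g → NonNegative g → ∀ {s} → Coneᴹ (evalGenerator As g) s ≐ Multiple g s
      evalGenerator-cone g 0≤g {s} with 0≤⇒≡0⊎0< (sum-nonneg 0≤g)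
      ... | inj₁ sum≡0 rewrite evalGenerator-null g sum≡0 =
        (λ { (refl , refl) → 1# , 0<1 , subst (λ c → 0ᴹ ∈ ⨁ c 𝐀) (sym (∙-identityˡ g)) (⨁-null⁺ g 0≤g sum≡0) ,
             sym (trans (cong (1# *_) sum≡0) (zeroʳ 1#)) }) ,
        (λ { (w , 0<w , v∈ , refl) → trans (cong (w *_) sum≡0) (zeroʳ w) ,
             ⨁-null (w ∙ g) (∙-nonneg (proj₁ 0<w) 0≤g)
               (trans (sum-∙ w g) (trans (cong (w *_) sum≡0) (zeroʳ w))) v∈ })
      ... | inj₂ 0<sum with evalGenerator-pos g 0≤g 0<sum | positiveInverse-pos 0<sum
      ...   | B , eq , B≐ | inv , 0<κ rewrite eq = to , from
        where
        κ = positiveInverse (sum g)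
        to : Cone ⟪ B ⟫ s ⊆ Multiple g s
        to (0<s , _ , b∈ , refl) with proj₁ B≐ b∈
        ... | y , y∈ , refl = s * κ , *-pos 0<s 0<κ ,
          subst (_∈ ⨁ ((s * κ) ∙ g) 𝐀) (*ₗ-assoc s κ y) (⨁-scale g (*-pos 0<s 0<κ) y∈) ,
          (begin
            s                 ≡⟨ *-identityʳ s ⟨
            s * 1#            ≡⟨ cong (s *_) inv ⟨
            s * (sum g * κ)   ≡⟨ solve 3 (λ s g k → s :* (g :* k) := s :* k :* g) refl s (sum g) κ ⟩
            s * κ * sum g     ∎)
          where open ≡-Reasoning
        from : Multiple g s ⊆ Cone ⟪ B ⟫ s
        from (w , 0<w , v∈ , refl) with ⨁-unscale g 0<w v∈
        ... | u , u∈ , refl = *-pos 0<w 0<sum , κ *ₗ u , proj₂ B≐ (u , u∈ , refl) , (begin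
            w *ₗ u                    ≡⟨ cong (_*ₗ u) (*-identityʳ w) ⟨
            (w * 1#) *ₗ u             ≡⟨ cong (λ r → (w * r) *ₗ u) inv ⟨
            (w * (sum g * κ)) *ₗ u    ≡⟨ cong (_*ₗ u) (*-assoc w (sum g) κ) ⟨
            (w * sum g * κ) *ₗ u      ≡⟨ *ₗ-assoc (w * sum g) κ u ⟩
            (w * sum g) *ₗ κ *ₗ u     ∎)
          where open ≡-Reasoning

    merge-⋆⁺ : ∀ a b {s t x y} → x ∈ Coneᴹ a s → y ∈ Coneᴹ b t → x +ᴹ y ∈ Coneᴹ (merge _⋆ᵒ_ a b) (s + t)
    merge-⋆⁺ nothing  b {t = t} {y = y} (refl , refl) y∈ =
      subst₂ (λ r v → v ∈ Coneᴹ b r) (sym (+-identityˡ t)) (sym (+ᴹ-identityˡ y)) y∈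
    merge-⋆⁺ (just A) nothing {s} {x = x} x∈ (refl , refl) =
      subst₂ (λ r v → v ∈ Cone ⟪ A ⟫ r) (sym (+-identityʳ s)) (sym (+ᴹ-identityʳ x)) x∈
    merge-⋆⁺ (just A) (just B) x∈ y∈ rewrite ⟪⋆⟫ A B = ⋆-cone⁺ x∈ y∈

    merge-⋆⁻ : ∀ a b {s v} → v ∈ Coneᴹ (merge _⋆ᵒ_ a b) s → ∃ λ r → ∃ λ t → ∃ λ x → ∃ λ y →
               x ∈ Coneᴹ a r × y ∈ Coneᴹ b t × s ≡ r + t × v ≡ x +ᴹ y
    merge-⋆⁻ nothing b {s} {v} v∈ =
      0# , s , 0ᴹ , v , (refl , refl) , v∈ , sym (+-identityˡ s) , sym (+ᴹ-identityˡ v)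
    merge-⋆⁻ (just A) nothing {s} {v} v∈ =
      s , 0# , v , 0ᴹ , v∈ , (refl , refl) , sym (+-identityʳ s) , sym (+ᴹ-identityʳ v)
    merge-⋆⁻ (just A) (just B) v∈ rewrite ⟪⋆⟫ A B = ⋆-cone⁻ v∈

    evalGenerators-cone : ∀ {m} (As : Vec Obj m) M → NonNegativeᴳ M → ∀ {s} →
                          Coneᴹ (evalGenerators As M) s ≐ Value M ⟪ As ⟫ᵛ s
    evalGenerators-cone As []      []       = id , id
    evalGenerators-cone As (g ∷ M) (p ∷ ps) = to , from
      where
      to : Coneᴹ (evalGenerators As (g ∷ M)) _ ⊆ Value (g ∷ M) ⟪ As ⟫ᵛ _
      to v∈ with merge-⋆⁻ (evalGenerator As g) (evalGenerators As M) v∈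
      ... | r , t , x , y , x∈ , y∈ , refl , refl with proj₁ (evalGenerator-cone As g p) x∈
      ... | w , 0<w , x∈′ , refl =
        w , x , t , y , 0<w , x∈′ , proj₁ (evalGenerators-cone As M ps) y∈ , refl , refl
      from : Value (g ∷ M) ⟪ As ⟫ᵛ _ ⊆ Coneᴹ (evalGenerators As (g ∷ M)) _
      from (w , u , t , y , 0<w , u∈ , y∈ , refl , refl) =
        merge-⋆⁺ (evalGenerator As g) (evalGenerators As M)
          (proj₂ (evalGenerator-cone As g p) (w , 0<w , u∈ , refl))
          (proj₂ (evalGenerators-cone As M ps) y∈)

    Cone-1 : ∀ {A : Subset} → Cone A 1# ≐ A
    Cone-1 {A} = (λ { (_ , x , x∈ , refl) → subst A (sym (*ₗ-identityˡ x)) x∈ }) ,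
                 (λ {x} x∈ → 0<1 , x , x∈ , sym (*ₗ-identityˡ x))

    evalDisjunction-≐ : ∀ {m} (As : Vec Obj m) φ → Properᴰ φ →
                        ⟪ evalDisjunction As φ ⟫ ≐ Valueᴰ φ ⟪ As ⟫ᵛ
    evalDisjunction-≐ As []      pφ rewrite ⟪∅⟫ = (λ ()) , λ { (_ , () , _) }
    evalDisjunction-≐ As (M ∷ φ) pφ
      with evalGenerators As M | evalGenerators-cone As M (nonneg (pφ (here refl))) {1#}
         | evalDisjunction-≐ As φ (pφ ∘ there)
    -- `nothing` represents weight 0 only, so M has no point of weight 1.
    ... | nothing | M≐ | φ≐ =
      (λ x∈ → let (N , N∈ , x∈′) = proj₁ φ≐ x∈ in N , there N∈ , x∈′) ,
      (λ { (_ , here refl , x∈) → ⊥-elim (0≢1 (sym (proj₁ (proj₂ M≐ x∈))))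
         ; (N , there N∈ , x∈)  → proj₂ φ≐ (N , N∈ , x∈) })
    ... | just A | M≐ | φ≐ rewrite ⟪∪⟫ A (evalDisjunction As φ) =
      [ (λ x∈ → M , here refl , proj₁ M≐ (proj₂ Cone-1 x∈)) ,
        (λ x∈ → let (N , N∈ , x∈′) = proj₁ φ≐ x∈ in N , there N∈ , x∈′) ]′ ,
      (λ { (_ , here refl , x∈) → inj₁ (proj₁ Cone-1 (proj₂ M≐ x∈))
         ; (N , there N∈ , x∈)  → inj₂ (proj₂ φ≐ (N , N∈ , x∈)) })

    record IsLeast {n k} (φs : Vec (Disjunction (n +ⁿ k)) n) (Ps : Vec Subset k) (Xs : Vec Subset n)
           : Set₁ where
      field
        convex   : Convexᵛ Xs
        solution : ∀ i → Satisfiesᴰ (lookup φs i) (lookup Xs i) (Xs Vec.++ Ps)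
        least    : ∀ Zs → Convexᵛ Zs → (∀ i → Satisfiesᴰ (lookup φs i) (lookup Zs i) (Zs Vec.++ Ps)) →
                   ∀ i → lookup Xs i ⊆ lookup Zs i

    Convex-++ : ∀ {n k} (Xs : Vec Subset n) {Ps : Vec Subset k} → Convexᵛ Xs → Convexᵛ Ps →
                Convexᵛ (Xs Vec.++ Ps)
    Convex-++ []       cX cP i       = cP i
    Convex-++ (X ∷ Xs) cX cP zero    = cX zero
    Convex-++ (X ∷ Xs) cX cP (suc i) = Convex-++ Xs (cX ∘ suc) cP i

    ++-mono : ∀ {n k} (Xs Ys : Vec Subset n) {Ps : Vec Subset k} →
              (∀ i → lookup Xs i ⊆ lookup Ys i) →
              ∀ i → lookup (Xs Vec.++ Ps) i ⊆ lookup (Ys Vec.++ Ps) i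
    ++-mono []       []       Xs⊆Ys i       = id
    ++-mono (X ∷ Xs) (Y ∷ Ys) Xs⊆Ys zero    = Xs⊆Ys zero
    ++-mono (X ∷ Xs) (Y ∷ Ys) Xs⊆Ys (suc i) = ++-mono Xs Ys (Xs⊆Ys ∘ suc) i

    conv-least : ∀ {A X} → Convex X → A ⊆ X → conv A ⊆ X
    conv-least cX A⊆X (incl a∈)               = A⊆X a∈
    conv-least cX A⊆X (mix 0≤t t≤1 x∈ y∈) =
      cX 0≤t t≤1 (conv-least cX A⊆X x∈) (conv-least cX A⊆X y∈)

    -- The sufficiency lemmas turn a solution of the reduced system into one of the full system. By
    -- the necessity lemmas, any full solution Z ∷ Zs solves the reduced system, whence Xs ⊆ Zs; it
    -- also satisfies the eliminant, which is monotone in Zs, so Z contains its hull X.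
    step-least : ∀ {n k} {φ : Disjunction (suc n +ⁿ k)} {φs : Vec (Disjunction (suc n +ⁿ k)) n}
                 {Ps : Vec Subset k} {X} {Xs : Vec Subset n} → Convexᵛ Ps →
                 Properᴰ φ → (∀ i → Properᴰ (lookup φs i)) →
                 X ≐ conv (Valueᴰ (eliminant φ) (Xs Vec.++ Ps)) → Convex X →
                 IsLeast (Vec.map (reduce (eliminant φ)) φs) Ps Xs → IsLeast (φ ∷ φs) Ps (X ∷ Xs)
    step-least {n} {k} {φ} {φs} {Ps} {X} {Xs} cP pφ pφs X≐ cX least-Xs = record
      { convex   = λ { zero → cX ; (suc i) → IsLeast.convex least-Xs i }
      ; solution = λ { zero    → eliminant-sufficient cX cvx pφ X≐
                     ; (suc i) → reduce-sufficient Y cX cvx pY X≐ (IsLeast.convex least-Xs i) (pφs i)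
                                   (subst (λ ψ → Satisfiesᴰ ψ _ _) (lookup-map i (reduce Y) φs)
                                     (IsLeast.solution least-Xs i)) }
      ; least    = least }
      where
      Y   = eliminant φ
      pY  = eliminant-proper pφ
      cvx = Convex-++ Xs (IsLeast.convex least-Xs) cP
      least : ∀ Zs → Convexᵛ Zs →
              (∀ i → Satisfiesᴰ (lookup (φ ∷ φs) i) (lookup Zs i) (Zs Vec.++ Ps)) →
              ∀ i → lookup (X ∷ Xs) i ⊆ lookup Zs i
      least (Z ∷ Zs) cZ sat = λ { zero → X⊆Z ; (suc i) → Xs⊆Zs i }
        where
        cvxZ = Convex-++ Zs (cZ ∘ suc) cP
        satY : Satisfiesᴰ Y Z (Zs Vec.++ Ps)
        satY = eliminant-necessary (cZ zero) cvxZ pφ (sat zero)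
        Xs⊆Zs : ∀ i → lookup Xs i ⊆ lookup Zs i
        Xs⊆Zs = IsLeast.least least-Xs Zs (cZ ∘ suc) λ i →
          subst (λ ψ → Satisfiesᴰ ψ _ _) (sym (lookup-map i (reduce Y) φs))
            (reduce-necessary (cZ zero) cvxZ pY (pφs i) satY (sat (suc i)))
        X⊆Z : X ⊆ Z
        X⊆Z x∈ = conv-least (cZ zero) (λ { (N , N∈ , x∈) → summand-1⁻ (satY N∈ (Value-mono N
          (++-mono Xs Zs {Ps} Xs⊆Zs) x∈)) }) (proj₁ X≐ x∈)

    conv-convex : ∀ A → Convex ⟪ convᵒ A ⟫
    conv-convex A rewrite ⟪conv⟫ A = mix

    solveSystem-least : ∀ {n k} (φs : Vec (Disjunction (n +ⁿ k)) n) Ps → Convexᵛ ⟪ Ps ⟫ᵛ →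
                        (∀ i → Properᴰ (lookup φs i)) →
                        IsLeast φs ⟪ Ps ⟫ᵛ ⟪ solveSystem φs Ps ⟫ᵛ
    solveSystem-least []       Ps cP pφs =
      record { convex = λ () ; solution = λ () ; least = λ _ _ _ () }
    solveSystem-least (φ ∷ φs) Ps cP pφs =
      step-least cP (pφs zero) (pφs ∘ suc) X≐ (conv-convex _)
        (solveSystem-least (Vec.map (reduce (eliminant φ)) φs) Ps cP λ i →
          subst Properᴰ (sym (lookup-map i (reduce (eliminant φ)) φs))
            (reduce-proper (eliminant-proper (pφs zero)) (pφs (suc i))))
      where
      Xs = solveSystem (Vec.map (reduce (eliminant φ)) φs) Ps
      conv-cong : ∀ {A B} → A ≐ B → conv A ≐ conv B
      conv-cong (A⊆B , B⊆A) = conv-least mix (incl ∘ A⊆B) , conv-least mix (incl ∘ B⊆A)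
      X≐ : ⟪ convᵒ (evalDisjunction (Xs Vec.++ Ps) (eliminant φ)) ⟫ ≐
           conv (Valueᴰ (eliminant φ) (⟪ Xs ⟫ᵛ Vec.++ ⟪ Ps ⟫ᵛ))
      X≐ rewrite ⟪conv⟫ (evalDisjunction (Xs Vec.++ Ps) (eliminant φ)) | sym (map-++ ⟪_⟫ Xs Ps) =
        conv-cong (evalDisjunction-≐ (Xs Vec.++ Ps) (eliminant φ) (eliminant-proper (pφs zero)))

  -- The sum is affine in each coordinate separately, so hulls are exchanged for the sets one
  -- coordinate at a time by `conv-affine`; `q` holds the summands that are kept fixed meanwhile.
  ⨁-conv : ∀ {m} (c : Vec Carrier m) {𝐀 𝐁 : Fin m → Subset} {X q s} → Convex X → 0# ≤ s →
           (∀ i → 𝐁 i ⊆ conv (𝐀 i)) → (∀ {u} → u ∈ ⨁ c 𝐀 → u +ᴹ q ∈ summand s X) →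
           ∀ {u} → u ∈ ⨁ c 𝐁 → u +ᴹ q ∈ summand s X
  ⨁-conv []      cX 0≤s 𝐁⊆ on𝐀 u∈ = on𝐀 u∈
  ⨁-conv (a ∷ c) {𝐀} {𝐁} {X} {q} {s} cX 0≤s 𝐁⊆ on𝐀 (u , v , u∈ , v∈ , refl) =
    subst (_∈ summand s X) (sym (+ᴹ-assoc u v q)) (first u∈)
    where
    rest : ∀ {u} → u ∈ summand a (𝐀 zero) → u +ᴹ (v +ᴹ q) ∈ summand s X
    rest {u} u∈ = subst (_∈ summand s X) (swap v u) (⨁-conv c cX 0≤s (𝐁⊆ ∘ suc)
      (λ {v} v∈ → subst (_∈ summand s X) (sym (swap′ v)) (on𝐀 (u , v , u∈ , v∈ , refl))) v∈)
      where
      swap : ∀ v u → v +ᴹ (u +ᴹ q) ≡ u +ᴹ (v +ᴹ q)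
      swap v u = solveᴹ [] (u ∷ v ∷ q ∷ []) (λ { [] (u ∷ v ∷ q ∷ []) → v ⊞ (u ⊞ q) , u ⊞ (v ⊞ q) }) refl
      swap′ : ∀ v → v +ᴹ (u +ᴹ q) ≡ (u +ᴹ v) +ᴹ q
      swap′ v = trans (swap v u) (sym (+ᴹ-assoc u v q))
    first : ∀ {u} → u ∈ summand a (𝐁 zero) → u +ᴹ (v +ᴹ q) ∈ summand s X
    first (inj₁ (0<a , x , x∈ , refl)) =
      conv-affine cX 0≤s (λ x∈ → rest (inj₁ (0<a , _ , x∈ , refl))) (𝐁⊆ zero x∈)
    first (inj₂ zero-summand) = rest (inj₂ zero-summand)

  -- Reason why hulls of parameters impose nothing new on a convex X. The exchange of `⨁-conv` is
  -- carried through all generators, with `t` and `q` accumulating the weight and the point of those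
  -- held fixed.
  Value-conv : ∀ {m} {M : Generators m} {As Bs X t q} → NonNegativeᴳ M → Convex X → 0# ≤ t →
               (∀ i → lookup Bs i ⊆ conv (lookup As i)) →
               (∀ {s v} → v ∈ Value M As s → v +ᴹ q ∈ summand (s + t) X) →
               ∀ {s v} → v ∈ Value M Bs s → v +ᴹ q ∈ summand (s + t) X
  Value-conv []       cX 0≤t Bs⊆ onAs v∈ = onAs v∈
  Value-conv {M = g ∷ M} {As} {X = X} {t} {q} (p ∷ ps) cX 0≤t Bs⊆ onAs
    (w , u , s , v , 0<w , u∈ , v∈ , refl , refl) =
    subst (_∈ summand (w * sum g + s + t) X) (sym (+ᴹ-assoc u v q))
      (⨁-conv (w ∙ g) cX
        (+-nonneg (+-nonneg 0≤wg (Total-nonneg ps (Value⇒Total M v∈))) 0≤t) Bs⊆ onGenerator u∈)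
    where
    0≤wg : 0# ≤ w * sum g
    0≤wg = *-nonneg (proj₁ 0<w) (sum-nonneg p)
    move : ∀ s → s + (w * sum g + t) ≡ w * sum g + s + t
    move s = solve 3 (λ s r t → s :+ (r :+ t) := r :+ s :+ t) refl s (w * sum g) t
    onGenerator : ∀ {u} → u ∈ ⨁ (w ∙ g) (lookup As) → u +ᴹ (v +ᴹ q) ∈ summand (w * sum g + s + t) X
    onGenerator {u} u∈ = subst₂ (λ r z → z ∈ summand r X) (move s) (swap v)
      (Value-conv ps cX (+-nonneg 0≤wg 0≤t) Bs⊆
        (λ {s} {v} v∈ → subst₂ (λ r z → z ∈ summand r X) (sym (move s)) (sym (swap′ v))
          (onAs (w , u , s , v , 0<w , u∈ , v∈ , refl , refl))) v∈)
      where
      swap : ∀ v → v +ᴹ (u +ᴹ q) ≡ u +ᴹ (v +ᴹ q)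
      swap v = solveᴹ [] (u ∷ v ∷ q ∷ []) (λ { [] (u ∷ v ∷ q ∷ []) → v ⊞ (u ⊞ q) , u ⊞ (v ⊞ q) }) refl
      swap′ : ∀ v → v +ᴹ (u +ᴹ q) ≡ (u +ᴹ v) +ᴹ q
      swap′ v = trans (swap v) (sym (+ᴹ-assoc u v q))

  coefficients : ∀ {n k} → ConvexCombination n k → Vec Carrier (n +ⁿ k)
  coefficients E = ConvexCombination.varCoeffs E Vec.++ ConvexCombination.parCoeffs E

  toGenerators : ∀ {n k} → Monomial n k → Generators (n +ⁿ k)
  toGenerators M = List.map coefficients (Monomial.factorList M)

  toDisjunction : ∀ {n k} → Polynomial n k → Disjunction (n +ⁿ k)
  toDisjunction φ = List.map toGenerators (Polynomial.monomials φ)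

  sum-++ : ∀ {n k} (c : Vec Carrier n) (d : Vec Carrier k) → sum (c Vec.++ d) ≡ sum c + sum d
  sum-++ []      d = sym (+-identityˡ (sum d))
  sum-++ (a ∷ c) d = trans (cong (a +_) (sum-++ c d)) (sym (+-assoc a (sum c) (sum d)))

  sum-coefficients : ∀ {n k} (E : ConvexCombination n k) → sum (coefficients E) ≡ 1#
  sum-coefficients E = trans (sum-++ varCoeffs parCoeffs) sumsToOne
    where open ConvexCombination E

  toGenerators-proper : ∀ {n k} (M : Monomial n k) → Proper (toGenerators M)
  toGenerators-proper M with Monomial.factors M
  ... | E ∷ Es = record { nonneg = nonnegs (E ∷ Es) ; positive = pos }
    where
    nonnegs : ∀ Es → NonNegativeᴳ (List.map coefficients Es)
    nonnegs []       = []
    nonnegs (E ∷ Es) = VecAll.++⁺ (ConvexCombination.varNonneg E) (ConvexCombination.parNonneg E) ∷ nonnegs Es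
    pos : ∀ {s} → s ∈ Total (List.map coefficients (E ∷ Es)) → 0# < s
    pos (w , s , 0<w , s∈ , refl) = +-posˡ
      (subst (0# <_) (sym (trans (cong (w *_) (sum-coefficients E)) (*-identityʳ w))) 0<w)
      (Total-nonneg (nonnegs Es) s∈)

  toDisjunction-proper : ∀ {n k} (φ : Polynomial n k) → Properᴰ (toDisjunction φ)
  toDisjunction-proper φ M∈ with ∈-map⁻ toGenerators M∈
  ... | M , _ , refl = toGenerators-proper M

  ⨁-++⁺ : ∀ {n k} (c : Vec Carrier n) (d : Vec Carrier k) {𝐗 𝐏} Xs Ps →
          (∀ i → 𝐗 i ⊆ lookup Xs i) → (∀ j → 𝐏 j ⊆ lookup Ps j) →
          ⨁ c 𝐗 ⊕ ⨁ d 𝐏 ⊆ ⨁ (c Vec.++ d) (lookup (Xs Vec.++ Ps))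
  ⨁-++⁺ []      d []       Ps 𝐗⊆ 𝐏⊆ (_ , v , refl , v∈ , refl) =
    subst (_∈ ⨁ d (lookup Ps)) (sym (+ᴹ-identityˡ v)) (⨁-mono d 𝐏⊆ v∈)
  ⨁-++⁺ (a ∷ c) d (X ∷ Xs) Ps 𝐗⊆ 𝐏⊆ (_ , v , (u , u′ , u∈ , u′∈ , refl) , v∈ , refl) =
    u , u′ +ᴹ v , summand-mono (𝐗⊆ zero) u∈ , ⨁-++⁺ c d Xs Ps (𝐗⊆ ∘ suc) 𝐏⊆ (u′ , v , u′∈ , v∈ , refl) ,
    +ᴹ-assoc u u′ v

  ⨁-++⁻ : ∀ {n k} (c : Vec Carrier n) (d : Vec Carrier k) {𝐗 𝐏} Xs Ps →
          (∀ i → lookup Xs i ⊆ 𝐗 i) → (∀ j → lookup Ps j ⊆ 𝐏 j) →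
          ⨁ (c Vec.++ d) (lookup (Xs Vec.++ Ps)) ⊆ ⨁ c 𝐗 ⊕ ⨁ d 𝐏
  ⨁-++⁻ []      d []       Ps ⊆𝐗 ⊆𝐏 {v} v∈ = 0ᴹ , v , refl , ⨁-mono d ⊆𝐏 v∈ , sym (+ᴹ-identityˡ v)
  ⨁-++⁻ (a ∷ c) d (X ∷ Xs) Ps ⊆𝐗 ⊆𝐏 (u , _ , u∈ , w∈ , refl) with ⨁-++⁻ c d Xs Ps (⊆𝐗 ∘ suc) ⊆𝐏 w∈
  ... | u′ , v , u′∈ , v∈ , refl =
    u +ᴹ u′ , v , (u , u′ , summand-mono (⊆𝐗 zero) u∈ , u′∈ , refl) , v∈ , sym (+ᴹ-assoc u u′ v)

  module _ {n k} {𝐗 : Fin n → Subset} {𝐏 : Fin k → Subset} {Xs : Vec Subset n} {Ps : Vec Subset k} where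

    private
      evalList : ConvexCombination n k → List (ConvexCombination n k) → Subset
      evalList E Es = List⁺.foldr₁ _⋆_ (List⁺.map (evalCombination 𝐗 𝐏) (E ∷ Es))

    factors⁺ : (∀ i → 𝐗 i ⊆ lookup Xs i) → (∀ j → 𝐏 j ⊆ lookup Ps j) → ∀ E Es {s v} →
               v ∈ Cone (evalList E Es) s → v ∈ Value (List.map coefficients (E ∷ Es)) (Xs Vec.++ Ps) s
    factors⁺ 𝐗⊆ 𝐏⊆ E [] {s} (0<s , x , x∈ , refl) =
      s , s *ₗ x , 0# , 0ᴹ , 0<s ,
      ⨁-scale (coefficients E) 0<s
        (⨁-++⁺ (ConvexCombination.varCoeffs E) (ConvexCombination.parCoeffs E) Xs Ps 𝐗⊆ 𝐏⊆ x∈) ,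
      (refl , refl) ,
      sym (trans (+-identityʳ _) (trans (cong (s *_) (sum-coefficients E)) (*-identityʳ s))) ,
      sym (+ᴹ-identityʳ _)
    factors⁺ 𝐗⊆ 𝐏⊆ E (F ∷ Es) v∈ with ⋆-cone⁻ v∈
    ... | a , b , _ , y , (0<a , x , x∈ , refl) , y∈ , refl , refl =
      a , a *ₗ x , b , y , 0<a ,
      ⨁-scale (coefficients E) 0<a
        (⨁-++⁺ (ConvexCombination.varCoeffs E) (ConvexCombination.parCoeffs E) Xs Ps 𝐗⊆ 𝐏⊆ x∈) ,
      factors⁺ 𝐗⊆ 𝐏⊆ F Es y∈ ,
      cong (_+ b) (sym (trans (cong (a *_) (sum-coefficients E)) (*-identityʳ a))) , refl

    factors⁻ : (∀ i → lookup Xs i ⊆ 𝐗 i) → (∀ j → lookup Ps j ⊆ 𝐏 j) → ∀ E Es {s v} →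
               v ∈ Value (List.map coefficients (E ∷ Es)) (Xs Vec.++ Ps) s → v ∈ Cone (evalList E Es) s
    factors⁻ ⊆𝐗 ⊆𝐏 E Es (w , u , s , v , 0<w , u∈ , v∈ , refl , refl)
      with ⨁-unscale (coefficients E) 0<w u∈
    ... | x , x∈ , refl = next Es v∈
      where
      x∈E : x ∈ evalCombination 𝐗 𝐏 E
      x∈E = ⨁-++⁻ (ConvexCombination.varCoeffs E) (ConvexCombination.parCoeffs E) Xs Ps ⊆𝐗 ⊆𝐏 x∈
      weight : w ≡ w * sum (coefficients E)
      weight = sym (trans (cong (w *_) (sum-coefficients E)) (*-identityʳ w))
      next : ∀ Es → v ∈ Value (List.map coefficients Es) (Xs Vec.++ Ps) s →
             w *ₗ x +ᴹ v ∈ Cone (evalList E Es) (w * sum (coefficients E) + s)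
      next []       (refl , refl) = subst₂ (λ r z → z ∈ Cone (evalList E []) r)
        (trans weight (sym (+-identityʳ _))) (sym (+ᴹ-identityʳ _)) (0<w , x , x∈E , refl)
      next (F ∷ Es) v∈ = subst (λ r → w *ₗ x +ᴹ v ∈ Cone (evalList E (F ∷ Es)) (r + s)) weight
        (⋆-cone⁺ (0<w , x , x∈E , refl) (factors⁻ ⊆𝐗 ⊆𝐏 F Es v∈))

  ∈-eval⁺ : ∀ {n k} {𝐗 : Fin n → Subset} {𝐏 : Fin k → Subset} {φ : Polynomial n k} {M} →
            M ∈ˡ Polynomial.monomials φ → evalMonomial 𝐗 𝐏 M ⊆ eval 𝐗 𝐏 φ
  ∈-eval⁺ {𝐗 = 𝐗} {𝐏} {φ} M∈ = go M∈
    where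
    go : ∀ {M Ms} → M ∈ˡ Ms → evalMonomial 𝐗 𝐏 M ⊆ List.foldr _∪_ ∅ (List.map (evalMonomial 𝐗 𝐏) Ms)
    go (here refl) v∈ = inj₁ v∈
    go (there M∈)  v∈ = inj₂ (go M∈ v∈)

  ∈-eval⁻ : ∀ {n k} {𝐗 : Fin n → Subset} {𝐏 : Fin k → Subset} {φ : Polynomial n k} {v} →
            v ∈ eval 𝐗 𝐏 φ → ∃ λ M → M ∈ˡ Polynomial.monomials φ × v ∈ evalMonomial 𝐗 𝐏 M
  ∈-eval⁻ {𝐗 = 𝐗} {𝐏} {φ} {v} = go (Polynomial.monomials φ)
    where
    go : ∀ Ms → v ∈ List.foldr _∪_ ∅ (List.map (evalMonomial 𝐗 𝐏) Ms) →
         ∃ λ M → M ∈ˡ Ms × v ∈ evalMonomial 𝐗 𝐏 M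
    go (M ∷ Ms) (inj₁ v∈) = M , here refl , v∈
    go (M ∷ Ms) (inj₂ v∈) with go Ms v∈
    ... | N , N∈ , v∈N = N , there N∈ , v∈N

  ++-conv : ∀ {n k} (Zs : Vec Subset n) {Ps Qs : Vec Subset k} →
            (∀ j → lookup Qs j ⊆ conv (lookup Ps j)) →
            ∀ i → lookup (Zs Vec.++ Qs) i ⊆ conv (lookup (Zs Vec.++ Ps) i)
  ++-conv []       Qs⊆ i       = Qs⊆ i
  ++-conv (Z ∷ Zs) Qs⊆ zero    = incl
  ++-conv (Z ∷ Zs) Qs⊆ (suc i) = ++-conv Zs Qs⊆ i

  module _ {o} (𝒜 : SetAlgebra o) where
    open SetAlgebra 𝒜
    open Evaluation 𝒜

    -- Taking hulls of the parameters makes every indeterminate convex, as the coefficient calculus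
    -- requires.
    solution : ∀ {n k} → System n k → Vec Obj k → Vec Obj n
    solution I Ps = solveSystem (Vec.map toDisjunction I) (Vec.map convᵒ Ps)

    -- The computed sets solve the original system because each parameter lies in its hull.
    -- Conversely, `Value-conv` shows that 𝐗 solves the system with hulls, whose least solution is
    -- the computed one.
    solution-smallest : ∀ {n k} (I : System n k) {𝐏 : Fin k → Subset} (Ps : Vec Obj k) →
                        (∀ j → ⟪ lookup Ps j ⟫ ≡ 𝐏 j) → ∀ {𝐗} → IsSmallestSolution I 𝐏 𝐗 →
                        ∀ i → ⟪ lookup (solution I Ps) i ⟫ ≐ 𝐗 i
    solution-smallest {n} {k} I {𝐏} Ps Ps≡𝐏 {𝐗} smallest i = Xs⊆𝐗 , 𝐗⊆Xs
      where
      open IsSmallestSolution smallest using (isSolution) renaming (smallest to 𝐗-smallest)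
      φs = Vec.map toDisjunction I
      Qs = Vec.map convᵒ Ps
      Xs = solution I Ps

      lookup-hull : ∀ j → lookup ⟪ Qs ⟫ᵛ j ≡ conv (𝐏 j)
      lookup-hull j = trans (lookup-map j ⟪_⟫ Qs) (trans (cong ⟪_⟫ (lookup-map j convᵒ Ps))
        (trans (⟪conv⟫ (lookup Ps j)) (cong conv (Ps≡𝐏 j))))

      hulls-convex : Convexᵛ ⟪ Qs ⟫ᵛ
      hulls-convex j = subst Convex (sym (lookup-hull j)) mix

      least : IsLeast φs ⟪ Qs ⟫ᵛ ⟪ Xs ⟫ᵛ
      least = solveSystem-least φs Qs hulls-convex λ i →
        subst Properᴰ (sym (lookup-map i toDisjunction I)) (toDisjunction-proper (lookup I i))

      Xs-solution : IsSolution I 𝐏 (lookup ⟪ Xs ⟫ᵛ)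
      Xs-solution = record
        { convex    = IsLeast.convex least
        ; satisfies = λ i v∈ → satisfied i (∈-eval⁻ {φ = lookup I i} v∈) }
        where
        satisfied : ∀ i {v} → (∃ λ M → M ∈ˡ Polynomial.monomials (lookup I i) ×
                    v ∈ evalMonomial (lookup ⟪ Xs ⟫ᵛ) 𝐏 M) → v ∈ lookup ⟪ Xs ⟫ᵛ i
        satisfied i {v} (M , M∈ , v∈) = summand-1⁻ (IsLeast.solution least i
          (subst (toGenerators M ∈ˡ_) (sym (lookup-map i toDisjunction I)) (∈-map⁺ toGenerators M∈))
          (factors⁺ {𝐗 = lookup ⟪ Xs ⟫ᵛ} {𝐏} {⟪ Xs ⟫ᵛ} {⟪ Qs ⟫ᵛ} (λ _ → id)
            (λ j {x} x∈ → subst (λ S → x ∈ S) (sym (lookup-hull j)) (incl x∈))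
            (List⁺.head (Monomial.factors M)) (List⁺.tail (Monomial.factors M))
            (proj₂ Cone-1 v∈)))

      𝐗⊆Xs : 𝐗 i ⊆ ⟪ lookup Xs i ⟫
      𝐗⊆Xs {x} x∈ = subst (λ S → x ∈ S) (lookup-map i ⟪_⟫ Xs) (𝐗-smallest (lookup ⟪ Xs ⟫ᵛ) Xs-solution i x∈)

      Zs = tabulate 𝐗

      Zs-satisfy : ∀ i → Satisfiesᴰ (lookup φs i) (𝐗 i) (Zs Vec.++ ⟪ Qs ⟫ᵛ)
      Zs-satisfy i M∈ v∈ with ∈-map⁻ toGenerators (subst (_ ∈ˡ_) (lookup-map i toDisjunction I) M∈)
      ... | M , M∈′ , refl = subst₂ (λ r z → z ∈ summand r (𝐗 i)) (+-identityʳ _) (+ᴹ-identityʳ _)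
        (Value-conv (nonneg (toGenerators-proper M)) (IsSolution.convex isSolution i) ≤-refl
          (++-conv Zs {⟪ Ps ⟫ᵛ} λ j {x} x∈ →
            subst (λ S → x ∈ conv S) (sym (trans (lookup-map j ⟪_⟫ Ps) (Ps≡𝐏 j)))
            (subst (λ S → x ∈ S) (lookup-hull j) x∈))
          (λ v∈ → subst₂ (λ r z → z ∈ summand r (𝐗 i)) (sym (+-identityʳ _)) (sym (+ᴹ-identityʳ _))
            (cone-summand (factors⁻ {𝐗 = 𝐗} {𝐏} {Zs} {⟪ Ps ⟫ᵛ}
              (λ i {x} → subst (λ S → x ∈ S) (lookup∘tabulate 𝐗 i))
              (λ j {x} → subst (λ S → x ∈ S) (trans (lookup-map j ⟪_⟫ Ps) (Ps≡𝐏 j)))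
              (List⁺.head (Monomial.factors M)) (List⁺.tail (Monomial.factors M)) v∈)))
          v∈)
        where
        cone-summand : ∀ {s v} → v ∈ Cone (evalMonomial 𝐗 𝐏 M) s → v ∈ summand s (𝐗 i)
        cone-summand (0<s , x , x∈ , eq) = inj₁ (0<s , x ,
          IsSolution.satisfies isSolution i (∈-eval⁺ {φ = lookup I i} M∈′ x∈) , eq)

      Xs⊆𝐗 : ⟪ lookup Xs i ⟫ ⊆ 𝐗 i
      Xs⊆𝐗 {x} x∈ = subst (λ S → x ∈ S) (lookup∘tabulate 𝐗 i)
        (IsLeast.least least Zs
          (λ i → subst Convex (sym (lookup∘tabulate 𝐗 i)) (IsSolution.convex isSolution i))
          (λ i → subst (λ S → Satisfiesᴰ (lookup φs i) S _) (sym (lookup∘tabulate 𝐗 i)) (Zs-satisfy i))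
          i (subst (λ S → x ∈ S) (sym (lookup-map i ⟪_⟫ Xs)) x∈))

-- Programs

module Computability (em : ExcludedMiddle (lsuc 0ℓ)) (ℝ : RealNumbers)
                     (K : Pred (RealNumbers.Carrier ℝ) 0ℓ) where
  open RealNumbers ℝ
  open Computation ℝ renaming (if_then_else_ to ifᵖ_then_else_; true to trueᵀ)
  open Encoding ℝ
  open OrderedField em ℝ
  open CoefficientVectors em ℝ
  open Elimination em ℝ

  private variable
    x : Level
    X : Set x
    Γ g h : X → Tree

  -- One program for all indices in `X`. The index keeps what the encoded trees do not show, such as
  -- lengths, dimensions and proofs.
  record Comp {x} {X : Set x} (Γ g : X → Tree) : Set x where
    constructor _runs_
    field
      program : Program K
      run     : ∀ x → program ∙ Γ x ⇓ g x
  open Comp public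

  idᶜ : Comp Γ Γ
  idᶜ = id runs λ _ → id

  infixr 9 _⨾ᶜ_
  _⨾ᶜ_ : Comp Γ g → Comp g h → Comp Γ h
  p ⨾ᶜ q = (program p ⨾ program q) runs λ x → seq (run p x) (run q x)

  infixr 5 _∷ᶜ_
  _∷ᶜ_ : Comp Γ g → Comp Γ h → Comp Γ (λ x → g x ∷ h x)
  p ∷ᶜ q = ⟨ program p , program q ⟩ runs λ x → pair (run p x) (run q x)

  fstᶜ : Comp (λ x → g x ∷ h x) g
  fstᶜ = fst runs λ _ → fst

  sndᶜ : Comp (λ x → g x ∷ h x) h
  sndᶜ = snd runs λ _ → snd

  nilᶜ : Comp Γ (λ _ → nil)
  nilᶜ = nil runs λ _ → nil

  infixr 4 _⟨_⟩ᶜ_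
  -- Composition with a change of index: `q`, specified over all of `Y`, is run at `f x` on the
  -- input prepared by `p`.
  _⟨_⟩ᶜ_ : ∀ {x y} {X : Set x} {Y : Set y} {Γ : X → Tree} {Δ h : Y → Tree} →
           Comp Δ h → (f : X → Y) → Comp Γ (Δ ∘ f) → Comp Γ (h ∘ f)
  q ⟨ f ⟩ᶜ p = (program p ⨾ program q) runs λ x → seq (run p x) (run q (f x))

  ≗ᶜ : (∀ x → g x ≡ h x) → Comp Γ g → Comp Γ h
  ≗ᶜ {Γ = Γ} eq p = program p runs λ x → subst (program p ∙ Γ x ⇓_) (eq x) (run p x)

  encBool : Bool → Tree
  encBool false = nil
  encBool true  = trueᵀ

  ifᶜ : ∀ {x c} {X : Set x} {C : X → Set c} {Γ : X → Tree} (enc : ∀ {x} → C x → Tree)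
        (t : X → Bool) {g h : ∀ x → C x} → Comp Γ (encBool ∘ t) → Comp Γ (λ x → enc (g x)) →
        Comp Γ (λ x → enc (h x)) → Comp Γ (λ x → enc (if t x then g x else h x))
  ifᶜ {Γ = Γ} enc t {g} {h} pt pg ph =
    (ifᵖ program pt then program pg else program ph) runs λ x → branch x (t x) (run pt x)
    where
    branch : ∀ x b → program pt ∙ Γ x ⇓ encBool b →
             (ifᵖ program pt then program pg else program ph) ∙ Γ x ⇓ enc (if b then g x else h x)
    branch x true  d = if-t d (λ ()) (run pg x)
    branch x false d = if-f d (run ph x)

  isPositiveᶜ : Comp num (encBool ∘ isPositive)
  isPositiveᶜ = (⟨ zero , id ⟩ ⨾ less) runs λ a → seq (pair zero id) (compare a)
    where
    compare : ∀ a → less ∙ (num 0# ∷ num a) ⇓ encBool (isPositive a)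
    compare a with decide (0# < a)
    ... | yes 0<a = less-t 0<a
    ... | no  0≮a = less-f 0≮a

  module _ {x a b} {X : Set x} {A : X → Set a} {B : X → Set b} {Γ : X → Tree}
           (encA : ∀ {x} → A x → Tree) (encB : ∀ {x} → B x → Tree)
           (f : ∀ x → B x → A x → B x) (base : ∀ x → B x) (list : ∀ x → List (A x)) where

    -- The loop state consists of the remaining list, the accumulator and the unchanged environment
    -- `Γ x`, which the body may consult at each element.
    foldlᶜ : Comp {X = Σ X λ x → A x × B x} (λ (x , a , b) → encA a ∷ encB b ∷ Γ x)
                  (λ (x , a , b) → encB (f x b a)) →
             Comp Γ (λ x → encB (base x)) → Comp Γ (λ x → encList encA (list x)) →
             Comp Γ (λ x → encB (List.foldl (f x) (base x) (list x)))
    foldlᶜ fᶜ baseᶜ listᶜ =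
      (⟨ program listᶜ , ⟨ program baseᶜ , id ⟩ ⟩ ⨾ (while test loop body) ⨾ snd ⨾ fst) runs λ x →
        seq (pair (run listᶜ x) (pair (run baseᶜ x) id)) (seq (iterate x (base x) (list x)) (seq snd fst))
      where
      test body : Program K
      test = fst ⨾ isPair
      body = ⟨ fst ⨾ snd , ⟨ ⟨ fst ⨾ fst , ⟨ snd ⨾ fst , snd ⨾ snd ⟩ ⟩ ⨾ program fᶜ , snd ⨾ snd ⟩ ⟩
      iterate : ∀ x b as → (while test loop body) ∙ (encList encA as ∷ encB b ∷ Γ x) ⇓
                           (nil ∷ encB (List.foldl (f x) b as) ∷ Γ x)
      iterate x b []       = stop (seq fst pair-n)
      iterate x b (a ∷ as) = step (seq fst pair-t) (λ ())
        (pair (seq fst snd)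
          (pair (seq (pair (seq fst fst) (pair (seq snd fst) (seq snd snd))) (run fᶜ (x , a , b)))
                (seq snd snd)))
        (iterate x _ as)

  reverseᶜ : ∀ {x a} {X : Set x} {A : X → Set a} {Γ : X → Tree} (enc : ∀ {x} → A x → Tree)
             (list : ∀ x → List (A x)) → Comp Γ (λ x → encList enc (list x)) →
             Comp Γ (λ x → encList enc (reverse (list x)))
  reverseᶜ enc list = foldlᶜ enc (encList enc) (λ _ → flip _∷_) (λ _ → []) list (fstᶜ ∷ᶜ sndᶜ ⨾ᶜ fstᶜ) nilᶜ

  -- Loops consume lists from the front, so a right fold is a left fold over the reversal. The other
  -- list operations are brought into this form by `≗ᶜ`.
  foldrᶜ : ∀ {x a b} {X : Set x} {A : X → Set a} {B : X → Set b} {Γ : X → Tree}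
           (encA : ∀ {x} → A x → Tree) (encB : ∀ {x} → B x → Tree)
           (f : ∀ x → A x → B x → B x) (base : ∀ x → B x) (list : ∀ x → List (A x)) →
           Comp {X = Σ X λ x → A x × B x} (λ (x , a , b) → encA a ∷ encB b ∷ Γ x)
                (λ (x , a , b) → encB (f x a b)) →
           Comp Γ (λ x → encB (base x)) → Comp Γ (λ x → encList encA (list x)) →
           Comp Γ (λ x → encB (List.foldr (f x) (base x) (list x)))
  foldrᶜ encA encB f base list fᶜ baseᶜ listᶜ =
    ≗ᶜ (λ x → cong encB (reverse-foldl (flip (f x)) (base x) (list x)))
      (foldlᶜ encA encB (λ x → flip (f x)) base (λ x → reverse (list x)) fᶜ baseᶜ
        (reverseᶜ encA list listᶜ))

  mapᶜ : ∀ {x a b} {X : Set x} {A : X → Set a} {B : X → Set b} {Γ : X → Tree}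
         (encA : ∀ {x} → A x → Tree) (encB : ∀ {x} → B x → Tree)
         (f : ∀ x → A x → B x) (list : ∀ x → List (A x)) →
         Comp {X = Σ X A} (λ (x , a) → encA a ∷ Γ x) (λ (x , a) → encB (f x a)) →
         Comp Γ (λ x → encList encA (list x)) → Comp Γ (λ x → encList encB (List.map (f x) (list x)))
  mapᶜ encA encB f list fᶜ listᶜ =
    ≗ᶜ (λ x → cong (encList encB) (sym (map-is-foldr (list x))))
      (foldrᶜ encA (encList encB) (λ x a → f x a ∷_) (λ _ → []) list
        ((fᶜ ⟨ (λ (x , a , _) → x , a) ⟩ᶜ fstᶜ ∷ᶜ sndᶜ ⨾ᶜ sndᶜ) ∷ᶜ sndᶜ ⨾ᶜ fstᶜ) nilᶜ listᶜ)

  ++ᶜ : ∀ {x a} {X : Set x} {A : X → Set a} {Γ : X → Tree} (enc : ∀ {x} → A x → Tree)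
        (xs ys : ∀ x → List (A x)) → Comp Γ (λ x → encList enc (xs x)) →
        Comp Γ (λ x → encList enc (ys x)) → Comp Γ (λ x → encList enc (xs x ++ ys x))
  ++ᶜ enc xs ys xsᶜ ysᶜ = ≗ᶜ (λ x → cong (encList enc) (sym (++-is-foldr (xs x) (ys x))))
    (foldrᶜ enc (encList enc) (λ _ → _∷_) ys xs (fstᶜ ∷ᶜ sndᶜ ⨾ᶜ fstᶜ) ysᶜ xsᶜ)

  cartesianProductWith-is-foldr : ∀ {a b c} {A : Set a} {B : Set b} {C : Set c} (f : A → B → C) xs ys →
    List.foldr (λ x zs → List.map (f x) ys ++ zs) [] xs ≡ cartesianProductWith f xs ys
  cartesianProductWith-is-foldr f []       ys = refl
  cartesianProductWith-is-foldr f (x ∷ xs) ys =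
    cong (List.map (f x) ys ++_) (cartesianProductWith-is-foldr f xs ys)

  cartesianProductWithᶜ : ∀ {x a b c} {X : Set x} {A : X → Set a} {B : X → Set b} {C : X → Set c}
    {Γ : X → Tree} (encA : ∀ {x} → A x → Tree) (encB : ∀ {x} → B x → Tree) (encC : ∀ {x} → C x → Tree)
    (f : ∀ x → A x → B x → C x) (xs : ∀ x → List (A x)) (ys : ∀ x → List (B x)) →
    Comp {X = Σ X λ x → A x × B x} (λ (x , a , b) → encA a ∷ encB b) (λ (x , a , b) → encC (f x a b)) →
    Comp Γ (λ x → encList encA (xs x)) → Comp Γ (λ x → encList encB (ys x)) →
    Comp Γ (λ x → encList encC (cartesianProductWith (f x) (xs x) (ys x)))
  cartesianProductWithᶜ {A = A} encA encB encC f xs ys fᶜ xsᶜ ysᶜ =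
    ≗ᶜ (λ x → cong (encList encC) (cartesianProductWith-is-foldr (f x) (xs x) (ys x)))
      (foldrᶜ encA (encList encC) (λ x a zs → List.map (f x a) (ys x) ++ zs) (λ _ → []) xs
        (++ᶜ encC (λ (x , a , _) → List.map (f x a) (ys x)) (λ (_ , _ , zs) → zs)
          (mapᶜ encB encC (λ (x , a , _) → f x a) (λ (x , _) → ys x)
            (fᶜ ⟨ (λ ((x , a , _) , b) → x , a , b) ⟩ᶜ (sndᶜ ⨾ᶜ fstᶜ) ∷ᶜ fstᶜ)
            (ysᶜ ⟨ proj₁ ⟩ᶜ sndᶜ ⨾ᶜ sndᶜ))
          (sndᶜ ⨾ᶜ fstᶜ))
        nilᶜ xsᶜ)

  module _ {x a b} {X : Set x} {A : X → Set a} {B : X → Set b} {Γ : X → Tree} {m : X → ℕ}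
           (encA : ∀ {x} → A x → Tree) (encB : ∀ {x} → B x → Tree)
           (u : ∀ x → Vec (A x) (m x)) (v : ∀ x → Vec (B x) (m x)) where

    encPair : ∀ {x} → A x × B x → Tree
    encPair (a , b) = encA a ∷ encB b

    -- The loop pushes pairs onto an accumulator, which the final reversal puts in order. Testing
    -- the first vector is enough, as both have the same length.
    zipᶜ : Comp Γ (λ x → encVec encA (u x)) → Comp Γ (λ x → encVec encB (v x)) →
           Comp Γ (λ x → encVec encPair (Vec.zip (u x) (v x)))
    zipᶜ uᶜ vᶜ = ≗ᶜ (λ x → cong (encList encPair) (reverse-involutive (toList (Vec.zip (u x) (v x)))))
      (reverseᶜ encPair (λ x → reverse (toList (Vec.zip (u x) (v x)))) (
        (⟨ program uᶜ , ⟨ program vᶜ , nil ⟩ ⟩ ⨾ (while test loop body) ⨾ snd ⨾ snd) runs λ x →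
          seq (pair (run uᶜ x) (pair (run vᶜ x) nil)) (seq (iterate (u x) (v x) []) (seq snd snd))))
      where
      test body : Program K
      test = fst ⨾ isPair
      body = ⟨ fst ⨾ snd , ⟨ snd ⨾ fst ⨾ snd , ⟨ ⟨ fst ⨾ fst , snd ⨾ fst ⨾ fst ⟩ , snd ⨾ snd ⟩ ⟩ ⟩
      iterate : ∀ {x m} (u : Vec (A x) m) (v : Vec (B x) m) zs →
                (while test loop body) ∙ (encVec encA u ∷ encVec encB v ∷ encList encPair zs) ⇓
                (nil ∷ nil ∷ encList encPair (toList (Vec.zip u v) List.ʳ++ zs))
      iterate []      []      zs = stop (seq fst pair-n)
      iterate (a ∷ u) (b ∷ v) zs = step (seq fst pair-t) (λ ())
        (pair (seq fst snd) (pair (seq snd (seq fst snd))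
          (pair (pair (seq fst fst) (seq snd (seq fst fst))) (seq snd snd))))
        (iterate u v ((a , b) ∷ zs))

  toList-zipWith : ∀ {a b c m} {A : Set a} {B : Set b} {C : Set c} (f : A → B → C)
                   (u : Vec A m) (v : Vec B m) →
                   List.map (uncurry f) (toList (Vec.zip u v)) ≡ toList (Vec.zipWith f u v)
  toList-zipWith f []      []      = refl
  toList-zipWith f (a ∷ u) (b ∷ v) = cong (f a b ∷_) (toList-zipWith f u v)

  encGenerators : ∀ {m} → Generators m → Tree
  encGenerators = encList (encVec num)

  encDisjunction : ∀ {m} → Disjunction m → Tree
  encDisjunction = encList encGenerators

  Vector : Set
  Vector = Σ ℕ (Vec Carrier)

  headᶜ : ∀ {A : Set} {enc : A → Tree} →
          Comp {X = Σ ℕ (Vec A ∘ suc)} (encVec enc ∘ proj₂) (enc ∘ head ∘ proj₂)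
  headᶜ = fst runs λ { (_ , _ ∷ _) → fst }

  tailᶜ : ∀ {A : Set} {enc : A → Tree} →
          Comp {X = Σ ℕ (Vec A ∘ suc)} (encVec enc ∘ proj₂) (encVec enc ∘ tail ∘ proj₂)
  tailᶜ = snd runs λ { (_ , _ ∷ _) → snd }

  sumᶜ : Comp {X = Vector} (encVec num ∘ proj₂) (num ∘ sum ∘ proj₂)
  sumᶜ = ≗ᶜ (λ (_ , c) → cong num (is-foldr c))
    (foldrᶜ num num (λ _ → _+_) (λ _ → 0#) (toList ∘ proj₂)
      ((⟨ fst , snd ⨾ fst ⟩ ⨾ add) runs λ _ → seq (pair fst (seq snd fst)) add) (zero runs λ _ → zero) idᶜ)
    where
    is-foldr : ∀ {m} (c : Vec Carrier m) → List.foldr _+_ 0# (toList c) ≡ sum c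
    is-foldr []      = refl
    is-foldr (a ∷ c) = cong (a +_) (is-foldr c)

  scaleᶜ : Comp {X = Carrier × Vector} (λ (s , _ , c) → num s ∷ encVec num c)
                (λ (s , _ , c) → encVec num (s ∙ c))
  scaleᶜ = ≗ᶜ (λ (s , _ , c) → cong (encList num) (sym (toList-map (s *_) c)))
    (mapᶜ num num (λ (s , _) → s *_) (λ (_ , _ , c) → toList c)
      ((⟨ snd ⨾ fst , fst ⟩ ⨾ mul) runs λ _ → seq (pair (seq snd fst) fst) mul) sndᶜ)

  ⊹ᶜ : Comp {X = Σ ℕ λ m → Vec Carrier m × Vec Carrier m} (λ (_ , c , d) → encVec num c ∷ encVec num d)
            (λ (_ , c , d) → encVec num (c ⊹ d))
  ⊹ᶜ = ≗ᶜ (λ (_ , c , d) → cong (encList num) (toList-zipWith _+_ c d))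
    (mapᶜ (λ (a , b) → num a ∷ num b) num (λ _ → uncurry _+_) (λ (_ , c , d) → toList (Vec.zip c d))
      ((fst ⨾ add) runs λ _ → seq fst add)
      (zipᶜ num num (λ (_ , c , _) → c) (λ (_ , _ , d) → d) fstᶜ sndᶜ))

  occursᶜ : Comp {X = Σ ℕ (Generators ∘ suc)} (encGenerators ∘ proj₂) (encBool ∘ occurs ∘ proj₂)
  occursᶜ = foldrᶜ (encVec num) encBool (λ _ g b → if isPositive (head g) then true else b) (λ _ → false) proj₂
    (ifᶜ encBool (λ (_ , g , _) → isPositive (head g))
      (isPositiveᶜ ⟨ (λ (_ , g , _) → head g) ⟩ᶜ headᶜ ⟨ (λ ((m , _) , g , _) → m , g) ⟩ᶜ fstᶜ)
      (⟨ nil , nil ⟩ runs λ _ → pair nil nil) (sndᶜ ⨾ᶜ fstᶜ))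
    nilᶜ idᶜ

  tailsᶜ : Comp {X = Σ ℕ (Generators ∘ suc)} (encGenerators ∘ proj₂) (encGenerators ∘ tails ∘ proj₂)
  tailsᶜ = mapᶜ (encVec num) (encVec num) (λ _ → tail) proj₂
    (tailᶜ ⟨ (λ ((m , _) , g) → m , g) ⟩ᶜ fstᶜ) idᶜ

  withoutFirstᶜ : Comp {X = Σ ℕ (Disjunction ∘ suc)} (encDisjunction ∘ proj₂)
                       (encDisjunction ∘ withoutFirst ∘ proj₂)
  withoutFirstᶜ = foldrᶜ encGenerators encDisjunction (λ _ M ψ → if occurs M then ψ else tails M ∷ ψ)
    (λ _ → []) proj₂
    (ifᶜ encDisjunction (λ (_ , M , _) → occurs M)
      (occursᶜ ⟨ (λ ((m , _) , M , _) → m , M) ⟩ᶜ fstᶜ) (sndᶜ ⨾ᶜ fstᶜ)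
      ((tailsᶜ ⟨ (λ ((m , _) , M , _) → m , M) ⟩ᶜ fstᶜ) ∷ᶜ sndᶜ ⨾ᶜ fstᶜ))
    nilᶜ idᶜ

  joinTailsᶜ : Comp {X = Σ ℕ λ m → Generators m × Generators (suc m)}
                    (λ (_ , A , M) → encGenerators A ∷ encGenerators M)
                    (λ (_ , A , M) → encGenerators (A joinTails M))
  joinTailsᶜ = ++ᶜ (encVec num) (λ (_ , A , _) → A) (λ (_ , _ , M) → tails M) fstᶜ
    (tailsᶜ ⟨ (λ (m , _ , M) → m , M) ⟩ᶜ sndᶜ)

  eliminantᶜ : Comp {X = Σ ℕ (Disjunction ∘ suc)} (encDisjunction ∘ proj₂)
                    (encDisjunction ∘ eliminant ∘ proj₂)
  eliminantᶜ = ++ᶜ encGenerators (withoutFirst ∘ proj₂)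
    (λ (_ , φ) → cartesianProductWith _joinTails_ (withoutFirst φ) φ) withoutFirstᶜ
    (cartesianProductWithᶜ encGenerators encGenerators encGenerators (λ _ → _joinTails_)
      (withoutFirst ∘ proj₂) proj₂
      (joinTailsᶜ ⟨ (λ ((m , _) , A , M) → m , A , M) ⟩ᶜ idᶜ) withoutFirstᶜ idᶜ)

  plugᶜ : Comp {X = Σ ℕ λ m → Vec Carrier (suc m) × Vec Carrier m}
               (λ (_ , E , g) → encVec num E ∷ encVec num g) (λ (_ , E , g) → encVec num (plug E g))
  plugᶜ = ⊹ᶜ ⟨ (λ (m , E , g) → m , head E ∙ g , sum g ∙ tail E) ⟩ᶜ
    ((scaleᶜ ⟨ (λ (m , E , g) → head E , m , g) ⟩ᶜ
       ((headᶜ ⟨ (λ (m , E , _) → m , E) ⟩ᶜ fstᶜ) ∷ᶜ sndᶜ)) ∷ᶜ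
     (scaleᶜ ⟨ (λ (m , E , g) → sum g , m , tail E) ⟩ᶜ
       ((sumᶜ ⟨ (λ (m , _ , g) → m , g) ⟩ᶜ sndᶜ) ∷ᶜ (tailᶜ ⟨ (λ (m , E , _) → m , E) ⟩ᶜ fstᶜ))))

  substituteᶜ : Comp {X = Σ ℕ λ m → Generators m × Generators (suc m)}
                     (λ (_ , N , M) → encGenerators N ∷ encGenerators M)
                     (λ (_ , N , M) → encGenerators (substitute N M))
  substituteᶜ = cartesianProductWithᶜ (encVec num) (encVec num) (encVec num) (λ _ → plug)
    (λ (_ , _ , M) → M) (λ (_ , N , _) → N)
    (plugᶜ ⟨ (λ ((m , _) , E , g) → m , E , g) ⟩ᶜ idᶜ) sndᶜ fstᶜ

  reduceᶜ : Comp {X = Σ ℕ λ m → Disjunction m × Disjunction (suc m)}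
                 (λ (_ , Y , φ) → encDisjunction Y ∷ encDisjunction φ)
                 (λ (_ , Y , φ) → encDisjunction (reduce Y φ))
  reduceᶜ = ++ᶜ encGenerators (λ (_ , _ , φ) → withoutFirst φ)
    (λ (_ , Y , φ) → cartesianProductWith substitute Y φ)
    (withoutFirstᶜ ⟨ (λ (m , _ , φ) → m , φ) ⟩ᶜ sndᶜ)
    (cartesianProductWithᶜ encGenerators encGenerators encGenerators (λ _ → substitute)
      (λ (_ , Y , _) → Y) (λ (_ , _ , φ) → φ)
      (substituteᶜ ⟨ (λ ((m , _) , N , M) → m , N , M) ⟩ᶜ idᶜ) fstᶜ sndᶜ)

  -- A stack with the eliminant of the last variable on top, the order in which back-substitution
  -- reads it. Its entries have different numbers of indeterminates, so it is kept as an untyped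
  -- tree.
  eliminants : ∀ {n k} → Vec (Disjunction (n +ⁿ k)) n → Tree → Tree
  eliminants []       st = st
  eliminants (φ ∷ φs) st =
    eliminants (Vec.map (reduce (eliminant φ)) φs) (encDisjunction (eliminant φ) ∷ st)

  Systems : Set
  Systems = Σ ℕ λ n → Σ ℕ λ k → Vec (Disjunction (n +ⁿ k)) n

  eliminantsᶜ : Comp {X = Systems} (λ (_ , _ , φs) → encVec encDisjunction φs)
                     (λ (_ , _ , φs) → eliminants φs nil)
  eliminantsᶜ = (⟨ id , nil ⟩ ⨾ (while test loop program bodyᶜ) ⨾ snd) runs λ (_ , _ , φs) →
    seq (pair id nil) (seq (iterate φs nil) snd)
    where
    test : Program K
    test = fst ⨾ isPair
    State : Set
    State = Σ ℕ λ n → Σ ℕ λ k → Disjunction (suc (n +ⁿ k)) × Vec (Disjunction (suc (n +ⁿ k))) n × Tree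
    Yᶜ : Comp {X = State} (λ (_ , _ , φ , φs , st) → encVec encDisjunction (φ ∷ φs) ∷ st)
              (λ (_ , _ , φ , _) → encDisjunction (eliminant φ))
    Yᶜ = eliminantᶜ ⟨ (λ (n , k , φ , _) → n +ⁿ k , φ) ⟩ᶜ fstᶜ ⨾ᶜ fstᶜ
    bodyᶜ : Comp {X = State} (λ (_ , _ , φ , φs , st) → encVec encDisjunction (φ ∷ φs) ∷ st)
                 (λ (_ , _ , φ , φs , st) → encVec encDisjunction (Vec.map (reduce (eliminant φ)) φs) ∷
                   encDisjunction (eliminant φ) ∷ st)
    bodyᶜ = ≗ᶜ (λ (_ , _ , φ , φs , _) → cong (encList encDisjunction)
                  (sym (toList-map (reduce (eliminant φ)) φs)))
        (mapᶜ encDisjunction encDisjunction (λ (_ , _ , φ , _) → reduce (eliminant φ))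
          (λ (_ , _ , _ , φs , _) → toList φs)
          (reduceᶜ ⟨ (λ ((n , k , φ , _) , ψ) → n +ⁿ k , eliminant φ , ψ) ⟩ᶜ
            ((Yᶜ ⟨ proj₁ ⟩ᶜ sndᶜ) ∷ᶜ fstᶜ))
          (fstᶜ ⨾ᶜ sndᶜ))
      ∷ᶜ Yᶜ ∷ᶜ sndᶜ
    iterate : ∀ {n k} (φs : Vec (Disjunction (n +ⁿ k)) n) st →
              (while test loop program bodyᶜ) ∙ (encVec encDisjunction φs ∷ st) ⇓ (nil ∷ eliminants φs st)
    iterate []                     st = stop (seq fst pair-n)
    iterate {suc n} {k} (φ ∷ φs) st = step (seq fst pair-t) (λ ()) (run bodyᶜ (n , k , φ , φs , st))
      (iterate (Vec.map (reduce (eliminant φ)) φs) _)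

-- A program computing the smallest solution over a computable set algebra

module SolvingProgram (em : ExcludedMiddle (lsuc 0ℓ)) (ℝ : RealNumbers)
                      (V : FiniteDimensionalVectorSpace ℝ) (K : Pred (RealNumbers.Carrier ℝ) 0ℓ) where
  open RealNumbers ℝ
  open Computation ℝ renaming (if_then_else_ to ifᵖ_then_else_)
  open Encoding ℝ
  open Syntax ℝ
  open OrderedField em ℝ
  open Elimination em ℝ
  open Solving em ℝ V
  open Computability em ℝ K

  record ComputableSetAlgebra {o} (𝒜 : SetAlgebra o) : Set (lsuc 0ℓ ⊔ o) where
    open SetAlgebra 𝒜
    field
      enc    : Obj → Tree
      ∅ᶜ     : Comp {X = ⊤} (λ _ → nil) (λ _ → enc ∅ᵒ)
      ∪ᶜ     : Comp {X = Obj × Obj} (λ (a , b) → enc a ∷ enc b) (λ (a , b) → enc (a ∪ᵒ b))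
      ⊕ᶜ     : Comp {X = Obj × Obj} (λ (a , b) → enc a ∷ enc b) (λ (a , b) → enc (a ⊕ᵒ b))
      ⋆ᶜ     : Comp {X = Obj × Obj} (λ (a , b) → enc a ∷ enc b) (λ (a , b) → enc (a ⋆ᵒ b))
      dilate : Comp {X = (∃ λ ρ → 0# ≤ ρ) × Obj} (λ ((ρ , _) , a) → num ρ ∷ enc a)
                    (λ ((ρ , 0≤ρ) , a) → enc (scaleᵒ ρ 0≤ρ a))
      convᶜ  : Comp enc (enc ∘ convᵒ)

  module _ {o} {𝒜 : SetAlgebra o} (computable : ComputableSetAlgebra 𝒜) where
    open SetAlgebra 𝒜
    open Evaluation 𝒜
    open ComputableSetAlgebra computable

    -- The extra pair keeps `just a` apart from `nothing` even if `enc a` is `nil`, and makes it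
    -- count as true in a test.
    encMaybe : Maybe Obj → Tree
    encMaybe nothing  = nil
    encMaybe (just a) = nil ∷ enc a

    justᶜ : ∀ {x} {X : Set x} {Γ : X → Tree} {f : X → Obj} → Comp Γ (enc ∘ f) → Comp Γ (encMaybe ∘ just ∘ f)
    justᶜ fᶜ = nilᶜ ∷ᶜ fᶜ

    maybeᶜ : ∀ {x c} {X : Set x} {C : Set c} {Γ : X → Tree} (encC : C → Tree) (m : X → Maybe Obj)
             {j : X → Obj → C} {n : X → C} →
             Comp {X = X × Obj} (λ (x , a) → enc a ∷ Γ x) (λ (x , a) → encC (j x a)) →
             Comp Γ (encC ∘ n) → Comp Γ (encMaybe ∘ m) →
             Comp Γ (λ x → encC (maybe′ (j x) (n x) (m x)))
    maybeᶜ {Γ = Γ} encC m {j} {n} jᶜ nᶜ mᶜ =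
      (ifᵖ program mᶜ then ⟨ program mᶜ ⨾ snd , id ⟩ ⨾ program jᶜ else program nᶜ) runs λ x →
        branch x (m x) (run mᶜ x)
      where
      branch : ∀ x m → program mᶜ ∙ Γ x ⇓ encMaybe m →
               (ifᵖ program mᶜ then ⟨ program mᶜ ⨾ snd , id ⟩ ⨾ program jᶜ else program nᶜ) ∙ Γ x ⇓
               encC (maybe′ (j x) (n x) m)
      branch x nothing  d = if-f d (run nᶜ x)
      branch x (just a) d = if-t d (λ ()) (seq (pair (seq d snd) id) (run jᶜ (x , a)))

    mergeᶜ : ∀ {f : Obj → Obj → Obj} →
             Comp {X = Obj × Obj} (λ (a , b) → enc a ∷ enc b) (λ (a , b) → enc (f a b)) →
             Comp {X = Maybe Obj × Maybe Obj} (λ (a , b) → encMaybe a ∷ encMaybe b)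
                  (λ (a , b) → encMaybe (merge f a b))
    mergeᶜ {f} fᶜ = maybeᶜ encMaybe proj₁
      (justᶜ (maybeᶜ enc (λ ((_ , b) , _) → b) {j = λ (_ , a) b → f a b} {n = proj₂}
        (fᶜ ⟨ (λ ((_ , a) , b) → a , b) ⟩ᶜ (sndᶜ ⨾ᶜ fstᶜ) ∷ᶜ fstᶜ) fstᶜ (sndᶜ ⨾ᶜ sndᶜ)))
      sndᶜ fstᶜ

    scaledᶜ : Comp {X = Carrier × Obj} (λ (a , A) → num a ∷ enc A) (λ (a , A) → encMaybe (scaled a A))
    scaledᶜ = (ifᵖ ⟨ zero , fst ⟩ ⨾ less then ⟨ nil , program dilate ⟩ else nil) runs λ (a , A) → compare a A
      where
      compare : ∀ a A → (ifᵖ ⟨ zero , fst ⟩ ⨾ less then ⟨ nil , program dilate ⟩ else nil) ∙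
                        (num a ∷ enc A) ⇓ encMaybe (scaled a A)
      compare a A with decide (0# < a)
      ... | yes 0<a = if-t (seq (pair zero fst) (less-t 0<a)) (λ ())
                           (pair nil (run dilate ((a , proj₁ 0<a) , A)))
      ... | no  0≮a = if-f (seq (pair zero fst) (less-f 0≮a)) nil

    positiveInverseᶜ : Comp num (num ∘ positiveInverse)
    positiveInverseᶜ = (ifᵖ ⟨ zero , id ⟩ ⨾ less then inv else zero) runs compare
      where
      compare : ∀ a → (ifᵖ ⟨ zero , id ⟩ ⨾ less then inv else zero) ∙ num a ⇓ num (positiveInverse a)
      compare a with decide (0# < a)
      ... | yes 0<a = if-t (seq (pair zero id) (less-t 0<a)) (λ ()) (inv (proj₁ (proj₂ (reciprocal 0<a))))
      ... | no  0≮a = if-f (seq (pair zero id) (less-f 0≮a)) zero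

    combine-is-foldr : ∀ {m} (c : Vec Carrier m) As →
      List.foldr (λ (a , A) → merge _⊕ᵒ_ (scaled a A)) nothing (toList (Vec.zip c As)) ≡ combine c As
    combine-is-foldr []      []       = refl
    combine-is-foldr (a ∷ c) (A ∷ As) = cong (merge _⊕ᵒ_ (scaled a A)) (combine-is-foldr c As)

    combineᶜ : Comp {X = Σ ℕ λ m → Vec Carrier m × Vec Obj m} (λ (_ , c , As) → encVec num c ∷ encVec enc As)
                    (λ (_ , c , As) → encMaybe (combine c As))
    combineᶜ = ≗ᶜ (λ (_ , c , As) → cong encMaybe (combine-is-foldr c As))
      (foldrᶜ (λ (a , A) → num a ∷ enc A) encMaybe (λ _ (a , A) → merge _⊕ᵒ_ (scaled a A))
        (λ _ → nothing) (λ (_ , c , As) → toList (Vec.zip c As))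
        (mergeᶜ ⊕ᶜ ⟨ (λ (_ , (a , A) , r) → scaled a A , r) ⟩ᶜ
          (scaledᶜ ⟨ (λ (_ , aA , _) → aA) ⟩ᶜ fstᶜ) ∷ᶜ sndᶜ ⨾ᶜ fstᶜ)
        nilᶜ (zipᶜ num enc (λ (_ , c , _) → c) (λ (_ , _ , As) → As) fstᶜ sndᶜ))

    evalGeneratorᶜ : Comp {X = Σ ℕ λ m → Vec Obj m × Vec Carrier m}
                          (λ (_ , As , g) → encVec enc As ∷ encVec num g)
                          (λ (_ , As , g) → encMaybe (evalGenerator As g))
    evalGeneratorᶜ = maybeᶜ encMaybe (λ (_ , As , g) → combine g As)
      {j = λ (_ , As , g) → scaled (positiveInverse (sum g))} {n = λ _ → nothing}
      (scaledᶜ ⟨ (λ ((_ , _ , g) , A) → positiveInverse (sum g) , A) ⟩ᶜ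
        (positiveInverseᶜ ⟨ (λ ((_ , _ , g) , _) → sum g) ⟩ᶜ
          sumᶜ ⟨ (λ ((m , _ , g) , _) → m , g) ⟩ᶜ sndᶜ ⨾ᶜ sndᶜ) ∷ᶜ fstᶜ)
      nilᶜ (combineᶜ ⟨ (λ (m , As , g) → m , g , As) ⟩ᶜ sndᶜ ∷ᶜ fstᶜ)

    evalGeneratorsᶜ : Comp {X = Σ ℕ λ m → Vec Obj m × Generators m}
                           (λ (_ , As , M) → encVec enc As ∷ encGenerators M)
                           (λ (_ , As , M) → encMaybe (evalGenerators As M))
    evalGeneratorsᶜ = foldrᶜ (encVec num) encMaybe
      (λ (_ , As , _) g → merge _⋆ᵒ_ (evalGenerator As g)) (λ _ → nothing) (λ (_ , _ , M) → M)
      (mergeᶜ ⋆ᶜ ⟨ (λ ((_ , As , _) , g , r) → evalGenerator As g , r) ⟩ᶜ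
        (evalGeneratorᶜ ⟨ (λ ((m , As , _) , g , _) → m , As , g) ⟩ᶜ
          (sndᶜ ⨾ᶜ sndᶜ ⨾ᶜ fstᶜ) ∷ᶜ fstᶜ) ∷ᶜ sndᶜ ⨾ᶜ fstᶜ)
      nilᶜ sndᶜ

    evalDisjunctionᶜ : Comp {X = Σ ℕ λ m → Vec Obj m × Disjunction m}
                            (λ (_ , As , φ) → encVec enc As ∷ encDisjunction φ)
                            (λ (_ , As , φ) → enc (evalDisjunction As φ))
    evalDisjunctionᶜ = foldrᶜ encGenerators enc
      (λ (_ , As , _) M B → maybe′ (_∪ᵒ B) B (evalGenerators As M)) (λ _ → ∅ᵒ) (λ (_ , _ , φ) → φ)
      (maybeᶜ enc (λ ((_ , As , _) , M , _) → evalGenerators As M)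
        {j = λ (_ , _ , B) A → A ∪ᵒ B} {n = λ (_ , _ , B) → B}
        (∪ᶜ ⟨ (λ ((_ , _ , B) , A) → A , B) ⟩ᶜ fstᶜ ∷ᶜ sndᶜ ⨾ᶜ sndᶜ ⨾ᶜ fstᶜ)
        (sndᶜ ⨾ᶜ fstᶜ)
        (evalGeneratorsᶜ ⟨ (λ ((m , As , _) , M , _) → m , As , M) ⟩ᶜ
          (sndᶜ ⨾ᶜ sndᶜ ⨾ᶜ fstᶜ) ∷ᶜ fstᶜ))
      (∅ᶜ ⟨ (λ _ → tt) ⟩ᶜ nilᶜ) sndᶜ

    -- A second loop empties the stack of eliminants. Its state holds the values known so far twice:
    -- once with the parameters, as arguments for the next evaluation, and once without them, as
    -- output.
    solveSystemᶜ : Comp {X = Σ ℕ λ n → Σ ℕ λ k → Vec (Disjunction (n +ⁿ k)) n × Vec Obj k}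
                        (λ (_ , _ , φs , Ps) → encVec encDisjunction φs ∷ encVec enc Ps)
                        (λ (_ , _ , φs , Ps) → encVec enc (solveSystem φs Ps))
    solveSystemᶜ =
      (⟨ fst ⨾ program eliminantsᶜ , ⟨ snd , nil ⟩ ⟩ ⨾ (while test loop program bodyᶜ) ⨾ snd ⨾ snd) runs
        λ (n , k , φs , Ps) → seq (pair (seq fst (run eliminantsᶜ (n , k , φs))) (pair snd nil))
          (seq (iterate φs Ps (stop (seq fst pair-n))) (seq snd snd))
      where
      test : Program K
      test = fst ⨾ isPair
      State : Set o
      State = Σ ℕ λ m → Disjunction m × Tree × Vec Obj m × Tree
      valueᶜ : Comp {X = State} (λ (_ , Y , st , As , out) → (encDisjunction Y ∷ st) ∷ encVec enc As ∷ out)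
                    (λ (_ , Y , _ , As , _) → enc (convᵒ (evalDisjunction As Y)))
      valueᶜ = convᶜ ⟨ (λ (_ , Y , _ , As , _) → evalDisjunction As Y) ⟩ᶜ
        evalDisjunctionᶜ ⟨ (λ (m , Y , _ , As , _) → m , As , Y) ⟩ᶜ (sndᶜ ⨾ᶜ fstᶜ) ∷ᶜ fstᶜ ⨾ᶜ fstᶜ
      bodyᶜ : Comp {X = State} (λ (_ , Y , st , As , out) → (encDisjunction Y ∷ st) ∷ encVec enc As ∷ out)
                   (λ (_ , Y , st , As , out) → let B = enc (convᵒ (evalDisjunction As Y)) in
                     st ∷ (B ∷ encVec enc As) ∷ B ∷ out)
      bodyᶜ = (fstᶜ ⨾ᶜ sndᶜ) ∷ᶜ (valueᶜ ∷ᶜ sndᶜ ⨾ᶜ fstᶜ) ∷ᶜ valueᶜ ∷ᶜ sndᶜ ⨾ᶜ sndᶜ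
      -- Built from the end of the run: the eliminant of the first variable lies deepest, so its
      -- round comes last, and `d` is the run after that round.
      iterate : ∀ {n k} (φs : Vec (Disjunction (n +ⁿ k)) n) (Ps : Vec Obj k) {st z} →
                (while test loop program bodyᶜ) ∙
                  (st ∷ encVec enc (solveSystem φs Ps Vec.++ Ps) ∷ encVec enc (solveSystem φs Ps)) ⇓ z →
                (while test loop program bodyᶜ) ∙ (eliminants φs st ∷ encVec enc Ps ∷ nil) ⇓ z
      iterate []       Ps d = d
      iterate {suc n} {k} (φ ∷ φs) Ps {st} d = iterate (Vec.map (reduce (eliminant φ)) φs) Ps
        (step (seq fst pair-t) (λ ())
          (run bodyᶜ (n +ⁿ k , eliminant φ , st ,
            solveSystem (Vec.map (reduce (eliminant φ)) φs) Ps Vec.++ Ps , _)) d)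

    encSystemᶜ : Comp {X = Σ ℕ λ n → Σ ℕ λ k → System n k} (λ (_ , _ , I) → encSystem I)
                      (λ (_ , _ , I) → encVec encDisjunction (Vec.map toDisjunction I))
    encSystemᶜ = ≗ᶜ (λ (_ , _ , I) → cong (encList encDisjunction) (sym (toList-map toDisjunction I)))
      (mapᶜ encPolynomial encDisjunction (λ _ → toDisjunction) (λ (_ , _ , I) → toList I)
        (mapᶜ encMonomial encGenerators (λ _ → toGenerators) (λ (_ , φ) → Polynomial.monomials φ)
          (mapᶜ encCombination (encVec num) (λ _ → coefficients) (λ (_ , M) → Monomial.factorList M)
            (≗ᶜ (λ (_ , E) → cong (encList num)
                  (sym (toList-++ (ConvexCombination.varCoeffs E) (ConvexCombination.parCoeffs E))))
              (++ᶜ num (λ (_ , E) → toList (ConvexCombination.varCoeffs E))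
                (λ (_ , E) → toList (ConvexCombination.parCoeffs E)) (fstᶜ ⨾ᶜ fstᶜ) (fstᶜ ⨾ᶜ sndᶜ)))
            fstᶜ)
          fstᶜ)
        idᶜ)

    solutionᶜ : Comp {X = Σ ℕ λ n → Σ ℕ λ k → System n k × Vec Obj k}
                     (λ (_ , _ , I , Ps) → encSystem I ∷ encVec enc Ps)
                     (λ (_ , _ , I , Ps) → encVec enc (solution 𝒜 I Ps))
    solutionᶜ = solveSystemᶜ ⟨ (λ (n , k , I , Ps) → n , k , Vec.map toDisjunction I , Vec.map convᵒ Ps) ⟩ᶜ
      (encSystemᶜ ⟨ (λ (n , k , I , _) → n , k , I) ⟩ᶜ fstᶜ) ∷ᶜ
      ≗ᶜ (λ (_ , _ , _ , Ps) → cong (encList enc) (sym (toList-map convᵒ Ps)))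
        (mapᶜ enc enc (λ _ → convᵒ) (λ (_ , _ , _ , Ps) → toList Ps) (convᶜ ⟨ proj₂ ⟩ᶜ fstᶜ) sndᶜ)

-- Families with the good closure property as set algebras

module ClosedFamilies (em : ExcludedMiddle (lsuc 0ℓ)) (ℝ : RealNumbers)
                      (V : FiniteDimensionalVectorSpace ℝ) {b} (𝓑 : Geometry.SetOfSubsets ℝ V b) where
  open RealNumbers ℝ
  open FiniteDimensionalVectorSpace V
  open Computation ℝ
  open Encoding ℝ
  open Formulas ℝ
  open Geometry ℝ V
  open Syntax ℝ
  open Effectivity ℝ V
  open OrderedField em ℝ
  open Solving em ℝ V

  module _ (closure : GoodClosureProperty 𝓑) where
    open GoodClosureProperty closure

    members : SetAlgebra (lsuc 0ℓ ⊔ b)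
    members = record
      { Obj     = Σ Subset (_∈ᴮ 𝓑)
      ; ⟪_⟫     = proj₁
      ; ∅ᵒ      = ∅ , empty
      ; _∪ᵒ_    = λ (_ , A∈) (_ , B∈) → _ , union A∈ B∈
      ; _⊕ᵒ_    = λ (_ , A∈) (_ , B∈) → _ , minkowski A∈ B∈
      ; _⋆ᵒ_    = λ (_ , A∈) (_ , B∈) → _ , join A∈ B∈
      ; scaleᵒ  = λ _ 0≤ρ (_ , A∈) → _ , scale 0≤ρ A∈
      ; convᵒ   = λ (_ , A∈) → _ , hull A∈
      ; ⟪∅⟫     = refl
      ; ⟪∪⟫     = λ _ _ → refl
      ; ⟪⊕⟫     = λ _ _ → refl
      ; ⟪⋆⟫     = λ _ _ → refl
      ; ⟪scale⟫ = λ _ _ _ → refl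
      ; ⟪conv⟫  = λ _ → refl }

    smallest-member : ∀ {n k} (I : System n k) (𝐏 : Fin k → Subset) → (∀ j → 𝐏 j ∈ᴮ 𝓑) →
                      ∀ (𝐗 : Fin n → Subset) → IsSmallestSolution I 𝐏 𝐗 → ∀ i → 𝐗 i ∈ᴮ 𝓑
    smallest-member I 𝐏 𝐏∈ 𝐗 smallest i = SetOfSubsets.resp 𝓑
      (solution-smallest members I Ps (λ j → cong proj₁ (lookup∘tabulate _ j)) smallest i)
      (proj₂ (lookup (solution members I Ps) i))
      where Ps = tabulate λ j → 𝐏 j , 𝐏∈ j

  module _ {K : Pred Carrier 0ℓ} (effective : EffectiveGoodClosureProperty K 𝓑) where
    open EffectiveGoodClosureProperty effective
    open GoodClosureProperty goodClosure
    open Computability em ℝ K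
    open SolvingProgram em ℝ V K

    record Described : Set (lsuc 0ℓ ⊔ b) where
      field
        set         : Subset
        member      : set ∈ᴮ 𝓑
        description : Description
        describes   : description Describes set
    open Described

    private
      oracle : Program K
      oracle = proj₁ algorithm

      Results : ∀ {m} → Vec Subset (suc m) → Vec Description (suc m) → Vec Carrier (suc m) → Set₁
      Results {m} B D ρ =
        Σ Description λ D-union →
        Σ Description λ D-sum →
        Σ (Vec Description (suc m)) λ D-scaled →
        Σ Description λ D-join →
        Σ Description λ D-hull →
          oracle ∙ (encVec encFormula D ∷ encVec num ρ) ⇓
            (encFormula D-union ∷ encFormula D-sum ∷ encVec encFormula D-scaled
              ∷ encFormula D-join ∷ encFormula D-hull)
          × D-union Describes Vec.foldr₁ _∪_ B
          × D-sum   Describes Vec.foldr₁ _⊕_ B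
          × Pointwise _Describes_ D-scaled (Vec.zipWith _·_ ρ B)
          × D-join  Describes Vec.foldr₁ _⋆_ B
          × D-hull  Describes conv (Vec.foldr₁ _∪_ B)

      unary : ∀ ρ → 0# ≤ ρ → (A : Described) → Results (set A ∷ []) (description A ∷ []) (ρ ∷ [])
      unary ρ 0≤ρ A = proj₂ algorithm (set A ∷ []) (description A ∷ []) (ρ ∷ [])
        (member A ∷ []) (describes A ∷ []) (0≤ρ ∷ [])

      -- The closure algorithm expects as many scalars as sets. Union, sum and join do not depend on
      -- them, so zeros are supplied.
      binary : (A B : Described) →
               Results (set A ∷ set B ∷ []) (description A ∷ description B ∷ []) (0# ∷ 0# ∷ [])
      binary A B = proj₂ algorithm (set A ∷ set B ∷ []) (description A ∷ description B ∷ []) (0# ∷ 0# ∷ [])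
        (member A ∷ member B ∷ []) (describes A ∷ describes B ∷ []) (≤-refl ∷ ≤-refl ∷ [])

      Pointwise-head : ∀ {m} {D : Vec Description (suc m)} {A} {As : Vec Subset m} →
                       Pointwise _Describes_ D (A ∷ As) → head D Describes A
      Pointwise-head (d ∷ _) = d

      unaryᵖ : Program K
      unaryᵖ = ⟨ ⟨ snd , nil ⟩ , ⟨ fst , nil ⟩ ⟩ ⨾ oracle

      binaryᵖ : Program K
      binaryᵖ = ⟨ ⟨ fst , ⟨ snd , nil ⟩ ⟩ , ⟨ zero , ⟨ zero , nil ⟩ ⟩ ⟩ ⨾ oracle

      unary-run : ∀ {x y z} → oracle ∙ ((y ∷ nil) ∷ (x ∷ nil)) ⇓ z → unaryᵖ ∙ (x ∷ y) ⇓ z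
      unary-run d = seq (pair (pair snd nil) (pair fst nil)) d

      binary-run : ∀ {x y z} → oracle ∙ ((x ∷ y ∷ nil) ∷ (num 0# ∷ num 0# ∷ nil)) ⇓ z →
                   binaryᵖ ∙ (x ∷ y) ⇓ z
      binary-run d = seq (pair (pair fst (pair snd nil)) (pair zero (pair zero nil))) d

    descriptions : SetAlgebra (lsuc 0ℓ ⊔ b)
    descriptions = record
      { Obj     = Described
      ; ⟪_⟫     = set
      -- The empty polynomial has value 0, so the formula `[] >0` holds nowhere.
      ; ∅ᵒ      = record { set = ∅ ; member = empty ; description = [] >0
                         ; describes = 0≮0 , λ () }
      ; _∪ᵒ_    = λ A B → let (D , _ , _ , _ , _ , _ , d , _) = binary A B in record
        { set = set A ∪ set B ; member = union (member A) (member B) ; description = D ; describes = d }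
      ; _⊕ᵒ_    = λ A B → let (_ , D , _ , _ , _ , _ , _ , d , _) = binary A B in record
        { set = set A ⊕ set B ; member = minkowski (member A) (member B) ; description = D ; describes = d }
      ; _⋆ᵒ_    = λ A B → let (_ , _ , _ , D , _ , _ , _ , _ , _ , d , _) = binary A B in record
        { set = set A ⋆ set B ; member = join (member A) (member B) ; description = D ; describes = d }
      ; scaleᵒ  = λ ρ 0≤ρ A → let (_ , _ , D , _ , _ , _ , _ , _ , d , _) = unary ρ 0≤ρ A in record
        { set = ρ · set A ; member = scale 0≤ρ (member A) ; description = head D
        ; describes = Pointwise-head d }
      ; convᵒ   = λ A → let (_ , _ , _ , _ , D , _ , _ , _ , _ , _ , d) = unary 0# ≤-refl A in record
        { set = conv (set A) ; member = hull (member A) ; description = D ; describes = d }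
      ; ⟪∅⟫     = refl
      ; ⟪∪⟫     = λ _ _ → refl
      ; ⟪⊕⟫     = λ _ _ → refl
      ; ⟪⋆⟫     = λ _ _ → refl
      ; ⟪scale⟫ = λ _ _ _ → refl
      ; ⟪conv⟫  = λ _ → refl }

    descriptions-computable : ComputableSetAlgebra descriptions
    descriptions-computable = record
      { enc    = encFormula ∘ description
      -- The code of `[] >0`: tag `encℕ 1`, then the empty coefficient list.
      ; ∅ᶜ     = ⟨ ⟨ nil , nil ⟩ , nil ⟩ runs λ _ → pair (pair nil nil) nil
      ; ∪ᶜ     = (binaryᵖ ⨾ fst) runs λ (A , B) →
                   let (_ , _ , _ , _ , _ , r , _) = binary A B in seq (binary-run r) fst
      ; ⊕ᶜ     = (binaryᵖ ⨾ snd ⨾ fst) runs λ (A , B) →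
                   let (_ , _ , _ , _ , _ , r , _) = binary A B in seq (binary-run r) (seq snd fst)
      ; ⋆ᶜ     = (binaryᵖ ⨾ snd ⨾ snd ⨾ snd ⨾ fst) runs λ (A , B) →
                   let (_ , _ , _ , _ , _ , r , _) = binary A B in
                   seq (binary-run r) (seq snd (seq snd (seq snd fst)))
      -- A query with one set returns the scaled sets as a list with one entry, hence the final
      -- `headᶜ`.
      ; dilate = (unaryᵖ ⨾ snd ⨾ snd ⨾ fst ⨾ program (headᶜ {enc = encFormula {dim}})) runs λ ((ρ , 0≤ρ) , A) →
                   let (_ , _ , D , _ , _ , r , _) = unary ρ 0≤ρ A in
                   seq (unary-run r) (seq snd (seq snd (seq fst
                     (run (headᶜ {enc = encFormula {dim}}) (0 , D)))))
      -- The filler scalar 0 agrees with the query behind `convᵒ`; the hull of a union of one set is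
      -- its own hull.
      ; convᶜ  = (⟨ zero , id ⟩ ⨾ unaryᵖ ⨾ snd ⨾ snd ⨾ snd ⨾ snd) runs λ A →
                   let (_ , _ , _ , _ , _ , r , _) = unary 0# ≤-refl A in
                   seq (pair zero id) (seq (unary-run r) (seq snd (seq snd (seq snd snd)))) }

    -- The encoding of a described set retains its description only. Therefore the run on the
    -- objects built from `𝐏` and `D` is already a run on the encoded input, and the sets and
    -- membership proofs serve merely to certify the output.
    solve-program : ∃ λ (p : Program K) → ComputesSmallestSolution 𝓑 p
    solve-program = program solutionᶜ′ , λ {n} {k} I 𝐏 D 𝐏∈ D-describes 𝐗 smallest →
      let Ps = tabulate (λ j → record { set = 𝐏 j ; member = 𝐏∈ j ; description = lookup D j
                                      ; describes = D-describes j })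
          Xs = solution descriptions I Ps
      in Vec.map description Xs ,
         subst₂ (λ t u → program solutionᶜ′ ∙ (encSystem I ∷ t) ⇓ u)
           (trans (encVec-map Ps) (cong (encVec encFormula)
             (trans (sym (tabulate-∘ description _)) (tabulate∘lookup D))))
           (encVec-map Xs) (run solutionᶜ′ (n , k , I , Ps)) ,
         λ i → subst (_Describes 𝐗 i) (sym (lookup-map i description Xs))
           (describes-resp (describes (lookup Xs i))
             (solution-smallest descriptions I Ps (λ j → cong set (lookup∘tabulate _ j)) smallest i))
      where
      solutionᶜ′ = solutionᶜ descriptions-computable
      encVec-map : ∀ {m} (As : Vec Described m) →
                   encVec (encFormula ∘ description) As ≡ encVec encFormula (Vec.map description As)
      encVec-map []       = refl
      encVec-map (A ∷ As) = cong (encFormula (description A) ∷_) (encVec-map As)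
      describes-resp : ∀ {D A B} → D Describes A → A ≐ B → D Describes B
      describes-resp (f , g) (h , i) = (λ x → h (f x)) , λ x → g (i x)

theorem1 :
    ExcludedMiddle (lsuc 0ℓ) →
    (ℝ : RealNumbers) (V : FiniteDimensionalVectorSpace ℝ) →
    let open RealNumbers ℝ using (Carrier)
        open Syntax ℝ
        open Computation ℝ using (Program)
        open Geometry ℝ V
        open Effectivity ℝ V
    in
    {b : Level} (𝓑 : SetOfSubsets b) →
    ( GoodClosureProperty 𝓑 →
      ∀ {n k} (I : System n k) (𝐏 : Fin k → Subset) → (∀ j → 𝐏 j ∈ᴮ 𝓑) →
      ∀ (𝐗 : Fin n → Subset) → IsSmallestSolution I 𝐏 𝐗 →
      ∀ i → 𝐗 i ∈ᴮ 𝓑 )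
    ×
    ( ∀ (K : Pred Carrier 0ℓ) → EffectiveGoodClosureProperty K 𝓑 →
      ∃ λ (p : Program K) → ComputesSmallestSolution 𝓑 p )
theorem1 em ℝ V 𝓑 = smallest-member , λ _ → solve-program
  where open ClosedFamilies em ℝ V 𝓑
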